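{- Let $(K,v)$ be a Henselian valued field, let $\theta\in\overline{K}$ be separable and defectless over $K$, of degree $n>1$, and let $[\alpha_0,\alpha_1,\dots,\alpha_{r-1},\alpha_r=\theta]$ be an Okutsu sequence of $\theta$ with $\alpha_0,\dots,\alpha_{r-1}$ separable over $K$. Put $\delta_{ -1}=-\infty$, $\delta_i=v(\theta-\alpha_i)$ for $0\le i\le r$ (so $\delta_r=\infty$). For $0\le i\le r$ let $M/K$ be a finite Galois extension containing $K(\theta,\alpha_i)$, let $G=\operatorname{Gal}(M/K)$ and $$H_i=\{\sigma\in G\mid v(\theta-\sigma(\theta))>\delta_{i-1}\}\supseteq \overline{H}_i=\{\sigma\in G\mid v(\theta-\sigma(\theta))\ge\delta_i\}.$$ If for some $0\le i\le r$ the element $\alpha_i$ is tame over $K$, then $H_i=\overline{H}_i$. In particular, if $\theta$ is tame over $K$, then $\delta(\theta)=\omega(\theta)$.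
   Context: $(K,v)$ is a Henselian valued field of arbitrary rank; $v$ also denotes its unique extension to a fixed algebraic closure $\overline{K}$; $\deg_K\alpha=[K(\alpha):K]$. For a finite simple extension $L/K$, the defect $d(L/K)$ is defined by $[L:K]=e(L/K)f(L/K)d(L/K)$, where $e$ is the ramification index and $f$ the inertia degree. $L/K$ is defectless if $d(L/K)=1$. A separable and defectless extension $L/K$ is tame if the residue field extension $Lv/Kv$ is separable and $e(L/K)$ is not divisible by $\operatorname{char}(Kv)$. An element $\alpha\in\overline{K}$ is said to be separable, defectless, tame if $K(\alpha)/K$ is. An Okutsu sequence of the defectless element $\theta$ is a list $[\alpha_0,\dots,\alpha_{r-1},\alpha_r=\theta]$ in $\overline{K}$ with degrees $m_i=\deg_K\alpha_i$ satisfying $1=m_0<m_1<\cdots<m_r=n$, such that for all $0\le i<r$ and all $\beta\in\overline{K}$: $\deg_K\beta<m_{i+1}\Rightarrow v(\theta-\beta)\le v(\theta-\alpha_i)$; and $\deg_K\beta<m_i\Rightarrow v(\theta-\beta)<v(\theta-\alpha_i)$. The main invariant of $\theta$ is $\delta(\theta)=\sup\{v(\theta-\alpha)\mid\alpha\in\overline{K},\ \deg_K\alpha<\deg_K\theta\}$ (equal here to $\delta_{r-1}$). Krasner's constant of $\theta$ is $\omega(\theta)=\max\{v(\theta-\theta')\mid \theta'\ne\theta \text{ a root in }\overline{K}\text{ of the minimal polynomial of }\theta\text{ over }K\}$. -}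

module Defs where

open import Level using (Level)
open import Algebra.Bundles using (CommutativeRing; AbelianGroup)
open import Algebra.Morphism.Structures using (module RingMorphisms)
open import Data.Nat as ℕ using (ℕ; zero; suc)
open import Data.Nat.Divisibility using (_∣_)
open import Data.Fin using (Fin; zero; suc; inject₁; fromℕ)
open import Data.List using (List; []; _∷_; foldr; map)
open import Data.Product using (Σ; ∃; _×_; _,_; proj₁; proj₂)
open import Data.Sum as Sum using (_⊎_; inj₁; inj₂)
open import Function using (_⇔_; mk⇔; module Equivalence)
open import Relation.Binary.Core using (Rel)
open import Relation.Binary.Bundles using (TotalOrder)
open import Relation.Binary.Structures using (IsEquivalence; IsDecTotalOrder)
open import Relation.Binary.PropositionalEquality using (_≡_)
open import Relation.Nullary using (¬_; yes; no; contradiction)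
open import Relation.Nullary.Construct.Add.Supremum using (_⁺; ⊤⁺; [_])
open import Relation.Nullary.Construct.Add.Infimum using (_₋; ⊥₋)
open import Relation.Unary using (Pred; _∈_)
import Algebra.Construct.NaturalChoice.Min as Min
import Algebra.Definitions.RawMonoid as RawMonoidDefs
import Algebra.Properties.AbelianGroup as AbelianGroupProperties
import Algebra.Properties.Ring as RingProperties
import Relation.Binary.Construct.Add.Infimum.Strict as AddInfimum
import Relation.Binary.Construct.Add.Supremum.Equality as AddSupremumEq
import Relation.Binary.Construct.Add.Supremum.NonStrict as AddSupremum
import Relation.Binary.Construct.NonStrictToStrict as ToStrict
import Relation.Binary.Reasoning.Setoid as SetoidReasoning

-- Equality with 0# is decided; under excluded middle this is no restriction,
-- and likewise for the decidable order on value groups below.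
record Field (ℓ : Level) : Set (Level.suc ℓ) where
  field
    commutativeRing : CommutativeRing ℓ ℓ

  open CommutativeRing commutativeRing public

  field
    1≉0             : ¬ (1# ≈ 0#)
    zero-or-inverse : ∀ x → x ≈ 0# ⊎ ∃ λ y → x * y ≈ 1#

infix 4 _⟶_

record _⟶_ {ℓ} (F E : Field ℓ) : Set ℓ where
  private
    module F = Field F
    module E = Field E
  open RingMorphisms F.rawRing E.rawRing using (IsRingHomomorphism)
  field
    ⟦_⟧                : F.Carrier → E.Carrier
    isRingHomomorphism : IsRingHomomorphism ⟦_⟧

  open IsRingHomomorphism isRingHomomorphism public

-- For a field of characteristic zero p is 0, since 0 ∣ n only for n = 0.
HasCharacteristic : ∀ {ℓ} → Field ℓ → ℕ → Set ℓ
HasCharacteristic F p = ∀ n → (n ×ᶠ 1# ≈ 0#) ⇔ (p ∣ n)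
  where
  open Field F
  open RawMonoidDefs +-rawMonoid using () renaming (_×_ to _×ᶠ_)

-- Lists of coefficients, constant term first; trailing zeros are allowed,
-- so polynomials are compared by their coefficients.
module Polynomial {ℓ} (F : Field ℓ) where
  open Field F

  Poly : Set ℓ
  Poly = List Carrier

  coeff : Poly → ℕ → Carrier
  coeff []      _       = 0#
  coeff (a ∷ p) zero    = a
  coeff (a ∷ p) (suc i) = coeff p i

  infix  4 _≈ₚ_
  infixl 6 _+ₚ_
  infixl 7 _*ₚ_

  _≈ₚ_ : Rel Poly ℓ
  p ≈ₚ q = ∀ i → coeff p i ≈ coeff q i

  _+ₚ_ : Poly → Poly → Poly
  []      +ₚ q       = q
  (a ∷ p) +ₚ []      = a ∷ p
  (a ∷ p) +ₚ (b ∷ q) = (a + b) ∷ (p +ₚ q)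

  _*ₚ_ : Poly → Poly → Poly
  []      *ₚ q = []
  (a ∷ p) *ₚ q = map (a *_) q +ₚ (0# ∷ (p *ₚ q))

  -- (a + X p)′ = p + X p′
  derivative : Poly → Poly
  derivative []      = []
  derivative (a ∷ p) = p +ₚ (0# ∷ derivative p)

  DegreeBelow : ℕ → Poly → Set ℓ
  DegreeBelow n p = ∀ i → n ℕ.≤ i → coeff p i ≈ 0#

  Monic : ℕ → Poly → Set ℓ
  Monic n p = coeff p n ≈ 1# × DegreeBelow (suc n) p

  SeparablePoly : Poly → Set ℓ
  SeparablePoly p =
    ∃ λ a → ∃ λ b → (a *ₚ p) +ₚ (b *ₚ derivative p) ≈ₚ (1# ∷ [])

AlgebraicallyClosed : ∀ {ℓ} → Field ℓ → Set ℓ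
AlgebraicallyClosed F =
  ∀ n p → DegreeBelow (suc (suc n)) p → ¬ (coeff p (suc n) ≈ 0#) →
  ∃ λ x → foldr (λ a s → a + x * s) 0# p ≈ 0#
  where
  open Field F
  open Polynomial F

module Extension {ℓ} {F E : Field ℓ} (φ : F ⟶ E) where
  private
    module F = Field F
  open Field E
  open Polynomial F
  open _⟶_ φ using (⟦_⟧)
  open RawMonoidDefs +-rawMonoid using (sum)

  eval : Poly → Carrier → Carrier
  eval p x = foldr (λ a s → ⟦ a ⟧ + x * s) 0# p

  IsMinimalPolynomial : Poly → Carrier → Set ℓ
  IsMinimalPolynomial p x = ∃ λ n →
    Monic n p × eval p x ≈ 0# ×
    (∀ q → DegreeBelow n q → eval q x ≈ 0# → q ≈ₚ [])

  Algebraic : Set ℓ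
  Algebraic = ∀ x → ∃ λ p → ¬ (p ≈ₚ []) × eval p x ≈ 0#

  Separable : Set ℓ
  Separable = ∀ x → ∃ λ p → IsMinimalPolynomial p x × SeparablePoly p

  Conjugate : Rel Carrier ℓ
  Conjugate x y = ∃ λ p → IsMinimalPolynomial p x × eval p y ≈ 0#

  combination : ∀ {n} → (Fin n → F.Carrier) → (Fin n → Carrier) → Carrier
  combination c b = sum (λ i → ⟦ c i ⟧ * b i)

  record IsBasis {n} (b : Fin n → Carrier) : Set ℓ where
    field
      spans       : ∀ x → ∃ λ c → x ≈ combination c b
      independent : ∀ c → combination c b ≈ 0# → ∀ i → c i F.≈ F.0#

  HasDegree : ℕ → Set ℓ
  HasDegree n = Σ (Fin n → Carrier) IsBasis

  record Aut : Set ℓ where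
    open RingMorphisms rawRing rawRing using (IsRingIsomorphism)
    field
      σ                 : Carrier → Carrier
      isRingIsomorphism : IsRingIsomorphism σ
      fixes             : ∀ a → σ ⟦ a ⟧ ≈ ⟦ a ⟧

-- The ring on the elements satisfying P, with equality coarsened to _∼_:
-- a subring when _∼_ is inherited, a quotient of one in general.
module _ {ℓ} (R : CommutativeRing ℓ ℓ) where
  open CommutativeRing R

  module Subquotient
    (P : Pred Carrier ℓ)
    (P-+ : ∀ {x y} → P x → P y → P (x + y))
    (P-* : ∀ {x y} → P x → P y → P (x * y))
    (P-neg : ∀ {x} → P x → P (- x)) (P-0 : P 0#) (P-1 : P 1#)
    (_∼_ : Rel Carrier ℓ) (∼-refl : ∀ {x y} → x ≈ y → x ∼ y)
    (∼-sym : ∀ {x y} → x ∼ y → y ∼ x)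
    (∼-trans : ∀ {x y z} → x ∼ y → y ∼ z → x ∼ z)
    (∼-+ : ∀ {x x′ y y′} → x ∼ x′ → y ∼ y′ → (x + y) ∼ (x′ + y′))
    (∼-* : ∀ {x x′ y y′} → P x′ → P y → x ∼ x′ → y ∼ y′ → (x * y) ∼ (x′ * y′))
    (∼-neg : ∀ {x y} → x ∼ y → (- x) ∼ (- y))
    where

    subquotient : CommutativeRing ℓ ℓ
    subquotient = record
      { Carrier = Σ Carrier P
      ; _≈_ = λ x y → proj₁ x ∼ proj₁ y
      ; _+_ = λ (x , p) (y , q) → x + y , P-+ p q
      ; _*_ = λ (x , p) (y , q) → x * y , P-* p q
      ; -_ = λ (x , p) → - x , P-neg p
      ; 0# = 0# , P-0
      ; 1# = 1# , P-1
      ; isCommutativeRing = record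
        { isRing = record
          { +-isAbelianGroup = record
            { isGroup = record
              { isMonoid = record
                { isSemigroup = record
                  { isMagma = record
                    { isEquivalence = record
                      { refl = ∼-refl refl ; sym = ∼-sym ; trans = ∼-trans }
                    ; ∙-cong = ∼-+
                    }
                  ; assoc = λ _ _ _ → ∼-refl (+-assoc _ _ _)
                  }
                ; identity = (λ _ → ∼-refl (+-identityˡ _))
                           , (λ _ → ∼-refl (+-identityʳ _))
                }
              ; inverse = (λ _ → ∼-refl (-‿inverseˡ _))
                        , (λ _ → ∼-refl (-‿inverseʳ _))
              ; ⁻¹-cong = ∼-neg
              }
            ; comm = λ _ _ → ∼-refl (+-comm _ _)
            }
          ; *-cong = λ {_} {(_ , p)} {(_ , q)} → ∼-* p q
          ; *-assoc = λ _ _ _ → ∼-refl (*-assoc _ _ _)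
          ; *-identity = (λ _ → ∼-refl (*-identityˡ _))
                       , (λ _ → ∼-refl (*-identityʳ _))
          ; distrib = (λ _ _ _ → ∼-refl (distribˡ _ _ _))
                    , (λ _ _ _ → ∼-refl (distribʳ _ _ _))
          }
        ; *-comm = λ _ _ → ∼-refl (*-comm _ _)
        }
      }

record IntermediateField {ℓ} {K Ω : Field ℓ} (φ : K ⟶ Ω) : Set (Level.suc ℓ) where
  open Field Ω
  open _⟶_ φ using (⟦_⟧; ⟦⟧-cong; +-homo; *-homo; -‿homo; 0#-homo; 1#-homo)
  field
    Member    : Pred Carrier ℓ
    resp      : ∀ {x y} → x ≈ y → Member x → Member y
    contains  : ∀ a → Member ⟦ a ⟧
    +-closed  : ∀ {x y} → Member x → Member y → Member (x + y)
    *-closed  : ∀ {x y} → Member x → Member y → Member (x * y)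
    -‿closed  : ∀ {x} → Member x → Member (- x)
    ⁻¹-closed : ∀ {x y} → Member x → x * y ≈ 1# → Member y

  toField : Field ℓ
  toField = record
    { commutativeRing = Subquotient.subquotient commutativeRing Member
        +-closed *-closed -‿closed
        (resp 0#-homo (contains _)) (resp 1#-homo (contains _))
        _≈_ (λ e → e) sym trans +-cong (λ _ _ → *-cong) -‿cong
    ; 1≉0 = 1≉0
    ; zero-or-inverse = λ (x , p) → Sum.map₂
        (λ (y , xy≈1) → (y , ⁻¹-closed p xy≈1) , xy≈1) (zero-or-inverse x)
    }

  base : K ⟶ toField
  base = record
    { ⟦_⟧ = λ a → ⟦ a ⟧ , contains a
    ; isRingHomomorphism = record
      { isSemiringHomomorphism = record
        { isNearSemiringHomomorphism = record
          { +-isMonoidHomomorphism = record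
            { isMagmaHomomorphism = record
              { isRelHomomorphism = record { cong = ⟦⟧-cong }
              ; homo = +-homo
              }
            ; ε-homo = 0#-homo
            }
          ; *-homo = *-homo
          }
        ; 1#-homo = 1#-homo
        }
      ; -‿homo = -‿homo
      }
    }

  inclusion : toField ⟶ Ω
  inclusion = record
    { ⟦_⟧ = proj₁
    ; isRingHomomorphism = record
      { isSemiringHomomorphism = record
        { isNearSemiringHomomorphism = record
          { +-isMonoidHomomorphism = record
            { isMagmaHomomorphism = record
              { isRelHomomorphism = record { cong = λ e → e }
              ; homo = λ _ _ → refl
              }
            ; ε-homo = refl
            }
          ; *-homo = λ _ _ → refl
          }
        ; 1#-homo = refl
        }
      ; -‿homo = λ _ → refl
      }
    }

module Subextensions {ℓ} {K Ω : Field ℓ} (φ : K ⟶ Ω) where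
  open Field Ω
  open _⟶_ φ using (⟦_⟧)
  open IntermediateField

  infix 4 _⊑_

  _⊑_ : Rel (IntermediateField φ) ℓ
  L ⊑ M = ∀ {x} → Member L x → Member M x

  data Generated (S : Pred Carrier ℓ) : Pred Carrier ℓ where
    generator : ∀ {x} → S x → Generated S x
    scalar    : ∀ a → Generated S ⟦ a ⟧
    ≈-resp    : ∀ {x y} → x ≈ y → Generated S x → Generated S y
    plus      : ∀ {x y} → Generated S x → Generated S y → Generated S (x + y)
    times     : ∀ {x y} → Generated S x → Generated S y → Generated S (x * y)
    negate    : ∀ {x} → Generated S x → Generated S (- x)
    invert    : ∀ {x y} → Generated S x → x * y ≈ 1# → Generated S y

  adjoin : Pred Carrier ℓ → IntermediateField φ
  adjoin S = record
    { Member = Generated S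
    ; resp = ≈-resp
    ; contains = scalar
    ; +-closed = plus
    ; *-closed = times
    ; -‿closed = negate
    ; ⁻¹-closed = invert
    }

  K⟮_⟯ : Carrier → IntermediateField φ
  K⟮ α ⟯ = adjoin (_≈ α)

  K⟮_&_⟯ : Carrier → Carrier → IntermediateField φ
  K⟮ α & β ⟯ = adjoin (λ x → x ≈ α ⊎ x ≈ β)

  Deg : Carrier → ℕ → Set ℓ
  Deg α n = Extension.HasDegree (base K⟮ α ⟯) n

  Separable : Carrier → Set ℓ
  Separable α = Extension.Separable (base K⟮ α ⟯)

  -- Normality is expressed inside Ω, which is meant to be algebraically closed.
  record IsFiniteGalois (M : IntermediateField φ) : Set ℓ where
    field
      finite    : ∃ λ n → Extension.HasDegree (base M) n
      separable : Extension.Separable (base M)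
      normal    : ∀ {x y} → Member M x → Extension.Conjugate φ x y → Member M y

  Gal : IntermediateField φ → Set ℓ
  Gal M = Extension.Aut (base M)

record OrderedAbelianGroup (ℓ : Level) : Set (Level.suc ℓ) where
  field
    abelianGroup : AbelianGroup ℓ ℓ

  open AbelianGroup abelianGroup public

  infix 4 _≤_

  field
    _≤_             : Rel Carrier ℓ
    isDecTotalOrder : IsDecTotalOrder _≈_ _≤_
    ∙-monoˡ-≤       : ∀ z {x y} → x ≤ y → x ∙ z ≤ y ∙ z

-- Γ ∪ {∞}, with ⊤⁺ as ∞.
module Values {ℓ} (Γ : OrderedAbelianGroup ℓ) where
  private
    module Γ = OrderedAbelianGroup Γ
    module Γ≤ = IsDecTotalOrder Γ.isDecTotalOrder

  open AddSupremumEq Γ._≈_ public using (_≈⁺_; ⊤⁺≈⊤⁺; [_])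
  open AddSupremum Γ._≤_ public using (_≤⁺_; [_]; _≤⊤⁺)

  Value : Set ℓ
  Value = Γ.Carrier ⁺

  open IsDecTotalOrder (AddSupremum.≤⁺-isDecTotalOrder Γ._≤_ Γ.isDecTotalOrder) public
    using (isTotalOrder; isPartialOrder; _≟_; _≤?_; total; antisym; module Eq)
    renaming (refl to ≤⁺-refl; trans to ≤⁺-trans; reflexive to ≤⁺-reflexive
             ; ≤-respˡ-≈ to ≤⁺-respˡ; ≤-respʳ-≈ to ≤⁺-respʳ)

  totalOrder : TotalOrder ℓ ℓ ℓ
  totalOrder = record { isTotalOrder = isTotalOrder }

  open Min totalOrder public using (_⊓_; ⊓-sel; ⊓-glb)
  open ToStrict _≈⁺_ _≤⁺_ public using () renaming (_<_ to _<⁺_)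
  -- Also comparable with -∞, for the value δ₋₁.
  open AddInfimum _<⁺_ public using (_<₋_)

  infixl 6 _+⁺_

  _+⁺_ : Value → Value → Value
  [ a ] +⁺ [ b ] = [ a Γ.∙ b ]
  [ _ ] +⁺ ⊤⁺    = ⊤⁺
  ⊤⁺    +⁺ _     = ⊤⁺

  0⁺ : Value
  0⁺ = [ Γ.ε ]

  IsUpperBound : Pred Value ℓ → Value → Set ℓ
  IsUpperBound S s = ∀ γ → γ ∈ S → γ ≤⁺ s

  IsSupremum : Pred Value ℓ → Value → Set ℓ
  IsSupremum S s = IsUpperBound S s × (∀ u → IsUpperBound S u → s ≤⁺ u)

  IsMaximum : Pred Value ℓ → Value → Set ℓ
  IsMaximum S s = s ∈ S × IsUpperBound S s

  <⁺-≤⁺-trans : ∀ {a b c} → a <⁺ b → b ≤⁺ c → a <⁺ c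
  <⁺-≤⁺-trans =
    ToStrict.<-≤-trans _≈⁺_ _≤⁺_ Eq.sym ≤⁺-trans antisym ≤⁺-respʳ

  +⁺-cong : ∀ {a b c d} → a ≈⁺ b → c ≈⁺ d → a +⁺ c ≈⁺ b +⁺ d
  +⁺-cong [ p ]  [ q ]  = [ Γ.∙-cong p q ]
  +⁺-cong [ _ ]  ⊤⁺≈⊤⁺ = ⊤⁺≈⊤⁺
  +⁺-cong ⊤⁺≈⊤⁺ _      = ⊤⁺≈⊤⁺

  +⁺-comm : ∀ a b → a +⁺ b ≈⁺ b +⁺ a
  +⁺-comm [ a ] [ b ] = [ Γ.comm a b ]
  +⁺-comm [ _ ] ⊤⁺    = ⊤⁺≈⊤⁺
  +⁺-comm ⊤⁺    [ _ ] = ⊤⁺≈⊤⁺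
  +⁺-comm ⊤⁺    ⊤⁺    = ⊤⁺≈⊤⁺

  +⁺-identityˡ : ∀ a → 0⁺ +⁺ a ≈⁺ a
  +⁺-identityˡ [ a ] = [ Γ.identityˡ a ]
  +⁺-identityˡ ⊤⁺    = ⊤⁺≈⊤⁺

  0≤⇒≤+ : ∀ {a} b → 0⁺ ≤⁺ a → b ≤⁺ a +⁺ b
  0≤⇒≤+ [ b ] [ p ]      = [ Γ≤.≤-respˡ-≈ (Γ.identityˡ b) (Γ.∙-monoˡ-≤ b p) ]
  0≤⇒≤+ ⊤⁺    [ p ]      = ⊤⁺ ≤⊤⁺
  0≤⇒≤+ b     (_ ≤⊤⁺)    = b ≤⊤⁺

  idempotent⇒0 : ∀ a → ¬ (a ≈⁺ ⊤⁺) → a ≈⁺ a +⁺ a → a ≈⁺ 0⁺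
  idempotent⇒0 ⊤⁺    a≉∞ _      = contradiction ⊤⁺≈⊤⁺ a≉∞
  idempotent⇒0 [ a ] _   [ e ] = [ Γ.trans (Γ.sym (xyx⁻¹≈y a a))
    (Γ.trans (Γ.∙-congʳ (Γ.sym e)) (Γ.inverseʳ a)) ]
    where open AbelianGroupProperties Γ.abelianGroup using (xyx⁻¹≈y)

  double≈0⇒0 : ∀ a → a +⁺ a ≈⁺ 0⁺ → a ≈⁺ 0⁺
  double≈0⇒0 [ a ] [ e ] with Γ≤.total Γ.ε a
  ... | inj₁ ε≤a = [ Γ≤.antisym
        (Γ≤.≤-respˡ-≈ (Γ.identityˡ a) (Γ≤.≤-respʳ-≈ e (Γ.∙-monoˡ-≤ a ε≤a))) ε≤a ]
  ... | inj₂ a≤ε = [ Γ≤.antisym a≤ε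
        (Γ≤.≤-respˡ-≈ e (Γ≤.≤-respʳ-≈ (Γ.identityˡ a) (Γ.∙-monoˡ-≤ a a≤ε))) ]

record Valuation {ℓ} (F : Field ℓ) (Γ : OrderedAbelianGroup ℓ) : Set ℓ where
  open Field F
  open Values Γ
  field
    v      : Carrier → Value
    v-cong : ∀ {x y} → x ≈ y → v x ≈⁺ v y
    v-∞    : ∀ x → (v x ≈⁺ ⊤⁺) ⇔ (x ≈ 0#)
    v-*    : ∀ x y → v (x * y) ≈⁺ v x +⁺ v y
    v-+    : ∀ x y → v x ⊓ v y ≤⁺ v (x + y)

  v-1 : v 1# ≈⁺ 0⁺
  v-1 = idempotent⇒0 (v 1#) (λ e → 1≉0 (Equivalence.to (v-∞ 1#) e))
    (Eq.trans (v-cong (sym (*-identityˡ 1#))) (v-* 1# 1#))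

  v-neg : ∀ x → v (- x) ≈⁺ v x
  v-neg x = Eq.trans (v-cong (sym (-1*x≈-x x))) (Eq.trans (v-* (- 1#) x)
    (Eq.trans (+⁺-cong v-‿1 Eq.refl) (+⁺-identityˡ (v x))))
    where
    open RingProperties ring using (-1*x≈-x)
    open AbelianGroupProperties +-abelianGroup using (⁻¹-involutive)
    v-‿1 : v (- 1#) ≈⁺ 0⁺
    v-‿1 = double≈0⇒0 _ (Eq.trans (Eq.sym (v-* (- 1#) (- 1#)))
      (Eq.trans (v-cong (trans (-1*x≈-x (- 1#)) (⁻¹-involutive 1#))) v-1))

-- Valuations are identified when they induce the same order on elements,
-- i.e. differ by an order isomorphism of value groups.
Equivalent : ∀ {ℓ} {F : Field ℓ} {Γ Δ : OrderedAbelianGroup ℓ} →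
             Valuation F Γ → Valuation F Δ → Set ℓ
Equivalent {Γ = Γ} {Δ} v w = ∀ x y →
  (Values._≤⁺_ Γ (Valuation.v v x) (Valuation.v v y)) ⇔
  (Values._≤⁺_ Δ (Valuation.v w x) (Valuation.v w y))

restrict : ∀ {ℓ} {F E : Field ℓ} {Γ : OrderedAbelianGroup ℓ} →
           F ⟶ E → Valuation E Γ → Valuation F Γ
restrict {F = F} {E} {Γ} φ w = record
  { v      = λ x → v ⟦ x ⟧
  ; v-cong = λ e → v-cong (⟦⟧-cong e)
  ; v-∞    = λ x → mk⇔
      (λ e → injective (Equivalence.to (v-∞ ⟦ x ⟧) e))
      (λ e → Equivalence.from (v-∞ ⟦ x ⟧) (E.trans (⟦⟧-cong e) 0#-homo))
  ; v-*    = λ x y → Eq.trans (v-cong (*-homo x y)) (v-* ⟦ x ⟧ ⟦ y ⟧)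
  ; v-+    = λ x y → ≤⁺-respʳ (v-cong (E.sym (+-homo x y))) (v-+ ⟦ x ⟧ ⟦ y ⟧)
  }
  where
  module F = Field F
  module E = Field E
  open Values Γ
  open Valuation w
  open _⟶_ φ

  injective : ∀ {x} → ⟦ x ⟧ E.≈ E.0# → x F.≈ F.0#
  injective {x} e with F.zero-or-inverse x
  ... | inj₁ x≈0        = x≈0
  ... | inj₂ (y , xy≈1) = contradiction
    (E.trans (E.sym 1#-homo) (E.trans (⟦⟧-cong (F.sym xy≈1))
      (E.trans (*-homo x y) (E.trans (E.*-congʳ e) (E.zeroˡ ⟦ y ⟧)))))
    E.1≉0

Extends : ∀ {ℓ} {F E : Field ℓ} {Γ Δ : OrderedAbelianGroup ℓ} →
          Valuation F Γ → F ⟶ E → Valuation E Δ → Set ℓ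
Extends v φ w = Equivalent v (restrict φ w)

module ResidueField {ℓ} {F : Field ℓ} {Γ : OrderedAbelianGroup ℓ}
                    (val : Valuation F Γ) where
  open Field F
  open Values Γ
  open Valuation val

  Integral : Pred Carrier ℓ
  Integral x = 0⁺ ≤⁺ v x

  infix 4 _∼_

  _∼_ : Rel Carrier ℓ
  x ∼ y = 0⁺ <⁺ v (x - y)

  pos-resp : ∀ {x y} → x ≈ y → 0⁺ <⁺ v x → 0⁺ <⁺ v y
  pos-resp e p = <⁺-≤⁺-trans p (≤⁺-reflexive (v-cong e))

  v-0 : v 0# ≈⁺ ⊤⁺
  v-0 = Equivalence.from (v-∞ 0#) refl

  int-0 : Integral 0#
  int-0 = ≤⁺-respʳ (Eq.sym v-0) (_ ≤⊤⁺)

  int-1 : Integral 1#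
  int-1 = ≤⁺-reflexive (Eq.sym v-1)

  int-+ : ∀ {x y} → Integral x → Integral y → Integral (x + y)
  int-+ {x} {y} p q = ≤⁺-trans (⊓-glb p q) (v-+ x y)

  int-* : ∀ {x y} → Integral x → Integral y → Integral (x * y)
  int-* {x} {y} p q =
    ≤⁺-trans q (≤⁺-respʳ (Eq.sym (v-* x y)) (0≤⇒≤+ (v y) p))

  int-neg : ∀ {x} → Integral x → Integral (- x)
  int-neg {x} p = ≤⁺-respʳ (Eq.sym (v-neg x)) p

  pos-0 : 0⁺ <⁺ v 0#
  pos-0 = int-0 , λ e → 0≉∞ (Eq.trans e v-0)
    where
    0≉∞ : ¬ (0⁺ ≈⁺ ⊤⁺)
    0≉∞ ()

  pos-+ : ∀ {x y} → 0⁺ <⁺ v x → 0⁺ <⁺ v y → 0⁺ <⁺ v (x + y)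
  pos-+ {x} {y} p q with total (v x) (v y)
  ... | inj₁ vx≤vy =
        <⁺-≤⁺-trans p (≤⁺-trans (⊓-glb ≤⁺-refl vx≤vy) (v-+ x y))
  ... | inj₂ vy≤vx =
        <⁺-≤⁺-trans q (≤⁺-trans (⊓-glb vy≤vx ≤⁺-refl) (v-+ x y))

  pos-* : ∀ {x y} → Integral x → 0⁺ <⁺ v y → 0⁺ <⁺ v (x * y)
  pos-* {x} {y} p q =
    <⁺-≤⁺-trans q (≤⁺-respʳ (Eq.sym (v-* x y)) (0≤⇒≤+ (v y) p))

  pos-neg : ∀ {x} → 0⁺ <⁺ v x → 0⁺ <⁺ v (- x)
  pos-neg {x} p = <⁺-≤⁺-trans p (≤⁺-reflexive (Eq.sym (v-neg x)))

  open RingProperties ring using (-‿involutive; -0#≈0#; x[y-z]≈xy-xz)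
  open AbelianGroupProperties +-abelianGroup
    using (⁻¹-anti-homo‿-; ⁻¹-∙-comm; x≈y⇒x∙y⁻¹≈ε)
  open SetoidReasoning setoid

  telescope : ∀ x y z → (x - y) + (y - z) ≈ x - z
  telescope x y z = begin
    (x - y) + (y - z)     ≈⟨ +-assoc x (- y) (y - z) ⟩
    x + (- y + (y - z))   ≈⟨ +-congˡ (+-assoc (- y) y (- z)) ⟨
    x + ((- y + y) - z)   ≈⟨ +-congˡ (+-congʳ (-‿inverseˡ y)) ⟩
    x + (0# - z)          ≈⟨ +-congˡ (+-identityˡ (- z)) ⟩
    x - z                 ∎

  reflexive-∼ : ∀ {x y} → x ≈ y → x ∼ y
  reflexive-∼ e = pos-resp (sym (x≈y⇒x∙y⁻¹≈ε e)) pos-0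

  ∼-sym : ∀ {x y} → x ∼ y → y ∼ x
  ∼-sym {x} {y} p = pos-resp (⁻¹-anti-homo‿- x y) (pos-neg p)

  ∼-trans : ∀ {x y z} → x ∼ y → y ∼ z → x ∼ z
  ∼-trans {x} {y} {z} p q = pos-resp (telescope x y z) (pos-+ p q)

  ∼-+ˡ : ∀ z {x y} → x ∼ y → (z + x) ∼ (z + y)
  ∼-+ˡ z {x} {y} p = pos-resp (sym (begin
    (z + x) - (z + y)       ≈⟨ +-congʳ (+-comm z x) ⟩
    (x + z) - (z + y)       ≈⟨ +-congˡ (⁻¹-∙-comm z y) ⟨
    (x + z) + (- z - y)     ≈⟨ +-congʳ (+-congˡ (-‿involutive z)) ⟨
    (x - - z) + (- z - y)   ≈⟨ telescope x (- z) y ⟩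
    x - y                   ∎)) p

  ∼-+ : ∀ {x x′ y y′} → x ∼ x′ → y ∼ y′ → (x + y) ∼ (x′ + y′)
  ∼-+ {x} {x′} {y} {y′} p q = ∼-trans (∼-+ˡ x q)
    (∼-trans (reflexive-∼ (+-comm x y′))
      (∼-trans (∼-+ˡ y′ p) (reflexive-∼ (+-comm y′ x′))))

  ∼-*ˡ : ∀ {z x y} → Integral z → x ∼ y → (z * x) ∼ (z * y)
  ∼-*ˡ {z} {x} {y} i p = pos-resp (x[y-z]≈xy-xz z x y) (pos-* i p)

  ∼-* : ∀ {x x′ y y′} → Integral x′ → Integral y →
        x ∼ x′ → y ∼ y′ → (x * y) ∼ (x′ * y′)
  ∼-* {x} {x′} {y} {y′} i j p q = ∼-trans (reflexive-∼ (*-comm x y))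
    (∼-trans (∼-*ˡ j p) (∼-trans (reflexive-∼ (*-comm y x′)) (∼-*ˡ i q)))

  ∼-neg : ∀ {x y} → x ∼ y → (- x) ∼ (- y)
  ∼-neg {x} {y} p = pos-resp (sym (⁻¹-∙-comm x (- y))) (pos-neg p)

  residueRing : CommutativeRing ℓ ℓ
  residueRing = Subquotient.subquotient commutativeRing Integral
    int-+ int-* int-neg int-0 int-1
    _∼_ reflexive-∼ ∼-sym ∼-trans ∼-+ ∼-* ∼-neg

  residueField : Field ℓ
  residueField = record
    { commutativeRing = residueRing
    ; 1≉0 = λ p → proj₂ p (Eq.trans (Eq.sym v-1) (v-cong (sym (x-0≈x 1#))))
    ; zero-or-inverse = zero-or-unit
    }
    where
    module R = CommutativeRing residueRing

    x-0≈x : ∀ x → x - 0# ≈ x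
    x-0≈x x = trans (+-congˡ -0#≈0#) (+-identityʳ x)

    zero-or-unit : ∀ x → (x R.≈ R.0#) ⊎ ∃ λ y → (x R.* y) R.≈ R.1#
    zero-or-unit (x , i) with 0⁺ ≟ v x | zero-or-inverse x
    ... | no  0≉vx | _                 =
          inj₁ (pos-resp (sym (x-0≈x x)) (i , 0≉vx))
    ... | yes _    | inj₁ x≈0          = inj₁ (reflexive-∼ x≈0)
    ... | yes 0≈vx | inj₂ (y , xy≈1)   =
          inj₂ ((y , ≤⁺-reflexive 0≈vy) , reflexive-∼ xy≈1)
      where
      0≈vy : 0⁺ ≈⁺ v y
      0≈vy = Eq.trans (Eq.sym v-1) (Eq.trans (v-cong (sym xy≈1))
        (Eq.trans (v-* x y) (Eq.trans (+⁺-cong (Eq.sym 0≈vx) Eq.refl)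
          (+⁺-identityˡ (v y)))))

open ResidueField public using (residueField)

residueMap : ∀ {ℓ} {F E : Field ℓ} {Γ Δ : OrderedAbelianGroup ℓ}
             {v : Valuation F Γ} {w : Valuation E Δ} (φ : F ⟶ E) →
             Extends v φ w → residueField v ⟶ residueField w
residueMap {F = F} {E} {Γ} {Δ} {vF} {vE} φ ext = record
  { ⟦_⟧ = λ (x , i) → ⟦ x ⟧ , int i
  ; isRingHomomorphism = record
    { isSemiringHomomorphism = record
      { isNearSemiringHomomorphism = record
        { +-isMonoidHomomorphism = record
          { isMagmaHomomorphism = record
            { isRelHomomorphism = record { cong = cong }
            ; homo = λ (x , _) (y , _) → kE.reflexive-∼ (+-homo x y)
            }
          ; ε-homo = kE.reflexive-∼ 0#-homo
          }
        ; *-homo = λ (x , _) (y , _) → kE.reflexive-∼ (*-homo x y)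
        }
      ; 1#-homo = kE.reflexive-∼ 1#-homo
      }
    ; -‿homo = λ (x , _) → kE.reflexive-∼ (-‿homo x)
    }
  }
  where
  module F = Field F
  module E = Field E
  module vF where
    open Values Γ public
    open Valuation vF public
  module vE where
    open Values Δ public
    open Valuation vE public
  module kF = ResidueField vF
  module kE = ResidueField vE
  open _⟶_ φ

  vE-1 : vE.v ⟦ F.1# ⟧ vE.≈⁺ vE.0⁺
  vE-1 = vE.Eq.trans (vE.v-cong 1#-homo) vE.v-1

  int : ∀ {x} → kF.Integral x → kE.Integral ⟦ x ⟧
  int {x} i = vE.≤⁺-respˡ vE-1
    (Equivalence.to (ext F.1# x) (vF.≤⁺-respˡ (vF.Eq.sym vF.v-1) i))

  cong : ∀ {x y} → x kF.∼ y → ⟦ x ⟧ kE.∼ ⟦ y ⟧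
  cong {x} {y} (0≤d , 0≉d) = vE.<⁺-≤⁺-trans
    (int 0≤d , λ 0≈d → 0≉d (vF.antisym 0≤d (vF.≤⁺-respʳ vF.v-1
      (Equivalence.from (ext (x F.- y) F.1#)
        (vE.≤⁺-reflexive (vE.Eq.sym (vE.Eq.trans vE-1 0≈d)))))))
    (vE.≤⁺-reflexive (vE.v-cong
      (E.trans (+-homo x (F.- y)) (E.+-congˡ (-‿homo y)))))

-- v extends in at most one way to each algebraic extension of K; that an
-- extension always exists (Chevalley) holds for every valuation.
Henselian : ∀ {ℓ} {K : Field ℓ} {Γ : OrderedAbelianGroup ℓ} →
            Valuation K Γ → Set (Level.suc ℓ)
Henselian {ℓ} {K} v =
  (L : Field ℓ) (φ : K ⟶ L) → Extension.Algebraic φ →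
  (Δ Δ′ : OrderedAbelianGroup ℓ) (w : Valuation L Δ) (w′ : Valuation L Δ′) →
  Extends v φ w → Extends v φ w′ → Equivalent w w′

module ValuedExtension
  {ℓ} {F E : Field ℓ} {Γ Δ : OrderedAbelianGroup ℓ}
  {v : Valuation F Γ} {w : Valuation E Δ} (φ : F ⟶ E) (ext : Extends v φ w)
  where
  private
    module Δ = OrderedAbelianGroup Δ
  open Values Δ using (_≈⁺_; [_])

  ValueGroup : ∀ {E′ : Field ℓ} → Valuation E′ Δ → Pred Δ.Carrier ℓ
  ValueGroup u γ = ∃ λ x → Valuation.v u x ≈⁺ [ γ ]

  -- (A : B) = n, for subgroups A ⊇ B of Δ, by a system of representatives.
  HasIndex : Pred Δ.Carrier ℓ → Pred Δ.Carrier ℓ → ℕ → Set ℓ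
  HasIndex A B n = ∃ λ (rep : Fin n → Δ.Carrier) →
    (∀ i → rep i ∈ A) ×
    (∀ γ → γ ∈ A → ∃ λ i → (γ Δ.- rep i) ∈ B) ×
    (∀ i j → (rep i Δ.- rep j) ∈ B → i ≡ j)

  -- The value group of F is taken inside Δ, as that of w restricted to F.
  IsRamificationIndex : ℕ → Set ℓ
  IsRamificationIndex = HasIndex (ValueGroup w) (ValueGroup (restrict φ w))

  residue : residueField v ⟶ residueField w
  residue = residueMap {v = v} {w} φ ext

  IsInertiaDegree : ℕ → Set ℓ
  IsInertiaDegree = Extension.HasDegree residue

  -- d is a priori only rational, but a natural number by Ostrowski's lemma.
  HasDefect : ℕ → Set ℓ
  HasDefect d = ∃ λ n → ∃ λ e → ∃ λ f →
    Extension.HasDegree φ n × IsRamificationIndex e × IsInertiaDegree f ×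
    n ≡ e ℕ.* f ℕ.* d

  Defectless : Set ℓ
  Defectless = HasDefect 1

  record Tame : Set ℓ where
    field
      separable        : Extension.Separable φ
      defectless       : Defectless
      residueSeparable : Extension.Separable residue
      primeToChar      : ∀ {e p} → IsRamificationIndex e →
                         HasCharacteristic (residueField v) p → ¬ (p ∣ e)

record ValuedClosure {ℓ} {K : Field ℓ} {Γ : OrderedAbelianGroup ℓ}
                     (v : Valuation K Γ) : Set (Level.suc ℓ) where
  field
    K̄                   : Field ℓ
    ι                   : K ⟶ K̄
    algebraic           : Extension.Algebraic ι
    algebraicallyClosed : AlgebraicallyClosed K̄
    Γ̄                   : OrderedAbelianGroup ℓ
    valuation           : Valuation K̄ Γ̄
    extends             : Extends v ι valuation

  open Field K̄ public using (Carrier; _≈_; _-_)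
  open Values Γ̄ public
    using (Value; _≈⁺_; _≤⁺_; _<⁺_; _<₋_; IsSupremum; IsMaximum)
  open Valuation valuation public using () renaming (v to v̄)
  open Subextensions ι public
  open IntermediateField

  private
    module OverK (L : IntermediateField ι) =
      ValuedExtension {v = v} {restrict (inclusion L) valuation} (base L) extends

  Defectless : Carrier → Set ℓ
  Defectless α = OverK.Defectless K⟮ α ⟯

  Tame : Carrier → Set ℓ
  Tame α = OverK.Tame K⟮ α ⟯

  record IsOkutsuSequence (θ : Carrier) (n r : ℕ) (α : Fin (suc r) → Carrier) :
                          Set ℓ where
    field
      m          : Fin (suc r) → ℕ
      degrees    : ∀ i → Deg (α i) (m i)
      first      : m zero ≡ 1
      increasing : ∀ (i : Fin r) → m (inject₁ i) ℕ.< m (suc i)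
      lastDegree : m (fromℕ r) ≡ n
      last       : α (fromℕ r) ≈ θ
      closest    : ∀ (i : Fin r) β d → Deg β d → d ℕ.< m (suc i) →
                   v̄ (θ - β) ≤⁺ v̄ (θ - α (inject₁ i))
      closer     : ∀ (i : Fin r) β d → Deg β d → d ℕ.< m (inject₁ i) →
                   v̄ (θ - β) <⁺ v̄ (θ - α (inject₁ i))

  SmallerDegree : Rel Carrier ℓ
  SmallerDegree β θ = ∃ λ d → ∃ λ n → Deg β d × Deg θ n × d ℕ.< n

  IsMainInvariant : Carrier → Value → Set ℓ
  IsMainInvariant θ = IsSupremum λ γ → ∃ λ β → SmallerDegree β θ × γ ≈⁺ v̄ (θ - β)

  IsKrasnerConstant : Carrier → Value → Set ℓ
  IsKrasnerConstant θ = IsMaximum λ γ → ∃ λ θ′ →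
    ¬ (θ′ ≈ θ) × Extension.Conjugate ι θ θ′ × γ ≈⁺ v̄ (θ - θ′)

  module Filtration (θ : Carrier) {r : ℕ} (α : Fin (suc r) → Carrier)
                    (i : Fin (suc r)) (M : IntermediateField ι)
                    (K⟮θ&αᵢ⟯⊑M : K⟮ θ & α i ⟯ ⊑ M) where

    δ : Fin (suc r) → Value
    δ j = v̄ (θ - α j)

    -- δ₋ j is δ_{j-1}, with δ_{-1} = -∞.
    δ₋ : Fin (suc r) → Value ₋
    δ₋ zero    = ⊥₋
    δ₋ (suc j) = [ δ (inject₁ j) ]

    displacement : Gal M → Value
    displacement g = v̄ (θ - proj₁ (Extension.Aut.σ g (θ , θ∈M)))
      where
      θ∈M : Member M θ
      θ∈M = K⟮θ&αᵢ⟯⊑M (generator (inj₁ (Field.refl K̄)))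

    H : Pred (Gal M) ℓ
    H g = δ₋ i <₋ [ displacement g ]

    H̄ : Pred (Gal M) ℓ
    H̄ g = δ i ≤⁺ displacement g

{-# OPTIONS --safe #-}

-- Let α be tame over K of degree m and let α′ ≠ α be a conjugate such that
-- v(α - ρ) < v(α - α′) for every ρ of degree less than m. Each x ∈ K(α) is g(α) with
-- deg g < m; comparing the linear factors of g at α and at α′ shows that the embedding τ of
-- K(α) given by α ↦ α′ satisfies v(τx - x) > v(x) for all x ≠ 0. By Hensel's lemma such a τ
-- fixes lifts of a basis of the residue field (by separability) and elements representing
-- the cosets of the value group (as e is prime to the residue characteristic). Their products
-- are ef = m independent elements, so τ is the identity, which is absurd. Hence v(α - α′) is
-- at most v(α - ρ) for some ρ of smaller degree.
--
-- If δ_{i-1} < v(θ - σθ) < δ_i, then v(αᵢ - σαᵢ) = v(θ - σθ), while every ρ of degree less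
-- than mᵢ has v(αᵢ - ρ) = v(θ - ρ) ≤ δ_{i-1}; this is impossible for tame αᵢ.
-- For θ itself the same bound gives ω(θ) ≤ δ(θ); Krasner's lemma gives the converse.
module Submission where

open import Defs
open import Axiom.ExcludedMiddle using (ExcludedMiddle)
open import Data.Nat using (ℕ; suc; _<_)
open import Data.Fin using (Fin; inject₁)
open import Data.Product using (∃; _×_)
open import Relation.Unary using (_⊆_; _≐_)
open import Algebra.Bundles using (CommutativeMonoid; CommutativeRing)
open import Algebra.Morphism.Structures using (module RingMorphisms)
open import Data.Fin as Fin using (zero; suc; toℕ; fromℕ; punchIn; punchOut; combine; remQuot; _↑ˡ_; _↑ʳ_)
open import Data.Fin.Permutation using (Permutation; permutation; _⟨$⟩ʳ_)
open import Data.Fin.Relation.Unary.Top using (View; view; ‵fromℕ; ‵inject₁)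
open import Data.Integer as ℤ using (ℤ; +_; -[1+_])
open import Data.List using (List; []; _∷_; map; length; drop; tabulate)
open import Data.List.Relation.Unary.All as All using (All; []; _∷_)
open import Data.Maybe using (Maybe; just; nothing)
open import Data.Nat as ℕ using (zero; NonZero)
open import Data.Nat.Divisibility using (_∣_; divides; m%n≡0⇒n∣m)
open import Data.Nat.Induction using (<-rec)
open import Data.Product using (Σ; _,_; proj₁; proj₂)
open import Data.Sum using (_⊎_; inj₁; inj₂; [_,_]′)
open import Data.Vec.Functional using (removeAt)
open import Function using (module Equivalence; mk⇔)
open import Relation.Binary using (tri<; tri≈; tri>)
open import Relation.Binary.PropositionalEquality as ≡ using (_≡_; _≢_)
open import Relation.Nullary using (¬_; Dec; yes; no; contradiction; ¬?; _×-dec_)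
open import Relation.Nullary.Construct.Add.Supremum using (⊤⁺; [_])
open import Relation.Unary using (Pred)
import Algebra.Definitions.RawMonoid as RawMonoidDefinitions
import Algebra.Morphism.Construct.Composition as Composition
import Algebra.Properties.AbelianGroup as AbelianGroupProperties
import Algebra.Properties.CommutativeMonoid.Sum as MonoidSum
import Algebra.Properties.CommutativeSemiring.Exp as CommutativeExp
import Algebra.Properties.Ring as RingProperties
import Algebra.Properties.Semiring.Exp as Exp
import Algebra.Properties.Semiring.Mult as Mult
import Algebra.Properties.Semiring.Mult.TCOptimised as OptimisedMult
import Algebra.Properties.Semiring.Sum as Sum
import Algebra.Solver.Ring as RingSolver
import Algebra.Solver.Ring.AlmostCommutativeRing as ACR
import Data.Fin.Properties as Fin
import Data.Integer.Properties as ℤ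
import Data.Nat.DivMod as ℕ
import Data.Nat.Properties as ℕ
import Relation.Binary.Construct.Add.Infimum.Strict as AddInfimum
import Relation.Binary.Reasoning.Setoid as SetoidReasoning

-- `Henselian` says only that any two extensions of v to an algebraic extension order it alike;
-- Hensel's lemma is not assumed. Uniqueness is first turned into one tool: if c and c′ are
-- conjugate over a field F between K and K̄, then v(g(c)) = v(g(c′)) for every g over F.
-- Equivalence of two valuations gives equal orderings only; equality of values follows because
-- every value of K̄ is torsion modulo vK and an ordered group is torsion-free.
--
-- Hensel's and Krasner's lemmas then share one step: a simple root c outside F has a second
-- conjugate over F that values cannot distinguish from c. In Hensel's lemma it would be a second
-- root in the residue class of a simple root, which is impossible; in Krasner's lemma it is as
-- close to β as θ is.
--
-- K(α) need not be normal, so τ is an embedding into K̄ and not an element of a Galois group.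
-- Ramification groups are therefore replaced by counting dimensions: elements fixed by τ are
-- produced one at a time, and uniqueness of a simple root in its residue class shows that τ fixes
-- them.

-- Ring normalisation with integer coefficients, and field arithmetic.

module CommutativeRingSolver {c ℓ} (R : CommutativeRing c ℓ) where
  open CommutativeRing R
  open RingProperties ring
  open OptimisedMult semiring using (×-homo-+; ×1-homo-*; 1+×) renaming (_×_ to _×ᵣ_)
  open SetoidReasoning setoid

  private
    acr : ACR.AlmostCommutativeRing c ℓ
    acr = record
      { isAlmostCommutativeRing = record
        { isCommutativeSemiring = isCommutativeSemiring
        ; -‿cong = -‿cong
        ; -‿*-distribˡ = λ x y → sym (-‿distribˡ-* x y)
        ; -‿+-comm = -‿+-comm
        }
      }

    -- With the optimised multiple, `fromℤ (+ 1)` reduces to `1#`, so that `con (ℤ.+ 1)` matches a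
    -- literal `1#` and the solver calls close with `refl`.
    fromℤ : ℤ → Carrier
    fromℤ (+ n)    = n ×ᵣ 1#
    fromℤ -[1+ n ] = - (suc n ×ᵣ 1#)

    fromℤ-⊖ : ∀ m n → fromℤ (m ℤ.⊖ n) ≈ m ×ᵣ 1# - n ×ᵣ 1#
    fromℤ-⊖ m       zero    = sym (trans (+-congˡ -0#≈0#) (+-identityʳ _))
    fromℤ-⊖ zero    (suc n) = sym (+-identityˡ _)
    fromℤ-⊖ (suc m) (suc n) = begin
      fromℤ (suc m ℤ.⊖ suc n)              ≡⟨ ≡.cong fromℤ (ℤ.[1+m]⊖[1+n]≡m⊖n m n) ⟩
      fromℤ (m ℤ.⊖ n)                      ≈⟨ fromℤ-⊖ m n ⟩
      m ×ᵣ 1# - n ×ᵣ 1#                      ≈⟨ +-congʳ (xyx⁻¹≈y 1# _) ⟨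
      (1# + m ×ᵣ 1# - 1#) - n ×ᵣ 1#          ≈⟨ +-assoc _ _ _ ⟩
      (1# + m ×ᵣ 1#) + (- 1# - n ×ᵣ 1#)      ≈⟨ +-congˡ (-‿+-comm 1# _) ⟩
      (1# + m ×ᵣ 1#) - (1# + n ×ᵣ 1#)        ≈⟨ +-cong (1+× m 1#) (-‿cong (1+× n 1#)) ⟨
      suc m ×ᵣ 1# - suc n ×ᵣ 1#              ∎

    fromℤ-neg : ∀ i → fromℤ (ℤ.- i) ≈ - fromℤ i
    fromℤ-neg (+ zero)  = sym -0#≈0#
    fromℤ-neg (+ suc n) = refl
    fromℤ-neg -[1+ n ]  = sym (-‿involutive _)

    fromℤ-+ : ∀ i j → fromℤ (i ℤ.+ j) ≈ fromℤ i + fromℤ j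
    fromℤ-+ (+ m)    (+ n)    = ×-homo-+ 1# m n
    fromℤ-+ (+ m)    -[1+ n ] = fromℤ-⊖ m (suc n)
    fromℤ-+ -[1+ m ] (+ n)    = trans (fromℤ-⊖ n (suc m)) (+-comm _ _)
    fromℤ-+ -[1+ m ] -[1+ n ] = begin
      - (suc (suc (m ℕ.+ n)) ×ᵣ 1#)         ≡⟨ ≡.cong (λ k → - (suc k ×ᵣ 1#)) (≡.sym (ℕ.+-suc m n)) ⟩
      - ((suc m ℕ.+ suc n) ×ᵣ 1#)           ≈⟨ -‿cong (×-homo-+ 1# (suc m) (suc n)) ⟩
      - (suc m ×ᵣ 1# + suc n ×ᵣ 1#)          ≈⟨ -‿+-comm _ _ ⟨
      - (suc m ×ᵣ 1#) - (suc n ×ᵣ 1#)        ∎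

    fromℤ-+* : ∀ m j → fromℤ (+ m ℤ.* j) ≈ m ×ᵣ 1# * fromℤ j
    fromℤ-+* m (+ n)    = trans (reflexive (≡.cong fromℤ (≡.sym (ℤ.pos-* m n)))) (×1-homo-* m n)
    fromℤ-+* m -[1+ n ] = begin
      fromℤ (+ m ℤ.* -[1+ n ])             ≡⟨ ≡.cong fromℤ (ℤ.neg-distribʳ-* (+ m) (+ suc n)) ⟨
      fromℤ (ℤ.- (+ m ℤ.* + suc n))        ≈⟨ fromℤ-neg (+ m ℤ.* + suc n) ⟩
      - fromℤ (+ m ℤ.* + suc n)            ≈⟨ -‿cong (fromℤ-+* m (+ suc n)) ⟩
      - (m ×ᵣ 1# * suc n ×ᵣ 1#)              ≈⟨ -‿distribʳ-* _ _ ⟩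
      m ×ᵣ 1# * - (suc n ×ᵣ 1#)              ∎

    fromℤ-* : ∀ i j → fromℤ (i ℤ.* j) ≈ fromℤ i * fromℤ j
    fromℤ-* (+ m)    j = fromℤ-+* m j
    fromℤ-* -[1+ m ] j = begin
      fromℤ (-[1+ m ] ℤ.* j)               ≡⟨ ≡.cong fromℤ (ℤ.neg-distribˡ-* (+ suc m) j) ⟨
      fromℤ (ℤ.- (+ suc m ℤ.* j))          ≈⟨ fromℤ-neg (+ suc m ℤ.* j) ⟩
      - fromℤ (+ suc m ℤ.* j)              ≈⟨ -‿cong (fromℤ-+* (suc m) j) ⟩
      - (suc m ×ᵣ 1# * fromℤ j)             ≈⟨ -‿distribˡ-* _ _ ⟩
      - (suc m ×ᵣ 1#) * fromℤ j             ∎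

    weaken : ∀ i j → Maybe (fromℤ i ≈ fromℤ j)
    weaken i j with i ℤ.≟ j
    ... | yes ≡.refl = just refl
    ... | no  _      = nothing

    morphism : ℤ.+-*-rawRing ACR.-Raw-AlmostCommutative⟶ acr
    morphism = record
      { ⟦_⟧ = fromℤ ; +-homo = fromℤ-+ ; *-homo = fromℤ-* ; -‿homo = fromℤ-neg
      ; 0-homo = refl ; 1-homo = refl }

  open RingSolver ℤ.+-*-rawRing acr morphism weaken
    public using (solve; _:=_; _:+_; _:*_; _:-_; :-_; con)

module FieldProperties {ℓ} (F : Field ℓ) where
  open Field F
  open RingProperties ring public
  open CommutativeRingSolver commutativeRing public
  open SetoidReasoning setoid

  zero? : ∀ x → x ≈ 0# ⊎ ¬ (x ≈ 0#)
  zero? x with zero-or-inverse x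
  ... | inj₁ x≈0 = inj₁ x≈0
  ... | inj₂ (y , xy≈1) = inj₂ λ x≈0 → 1≉0 (trans (sym xy≈1) (trans (*-congʳ x≈0) (zeroˡ y)))

  ≉0? : ∀ x → Dec (¬ (x ≈ 0#))
  ≉0? x = [ (λ x≈0 → no λ x≉0 → x≉0 x≈0) , yes ]′ (zero? x)

  inverse : ∀ {x} → ¬ (x ≈ 0#) → ∃ λ y → x * y ≈ 1#
  inverse {x} x≉0 with zero-or-inverse x
  ... | inj₁ x≈0 = contradiction x≈0 x≉0
  ... | inj₂ inv = inv

  invertible⇒≉0 : ∀ {x y} → x * y ≈ 1# → ¬ (x ≈ 0#)
  invertible⇒≉0 {x} {y} xy≈1 x≈0 = 1≉0 (trans (sym xy≈1) (trans (*-congʳ x≈0) (zeroˡ y)))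

  *-cancelˡ-0 : ∀ {x y} → ¬ (x ≈ 0#) → x * y ≈ 0# → y ≈ 0#
  *-cancelˡ-0 {x} {y} x≉0 xy≈0 with inverse x≉0
  ... | x⁻¹ , e = begin
    y               ≈⟨ *-identityˡ y ⟨
    1# * y          ≈⟨ *-congʳ e ⟨
    x * x⁻¹ * y     ≈⟨ solve 3 (λ x i y → x :* i :* y := i :* (x :* y)) refl x x⁻¹ y ⟩
    x⁻¹ * (x * y)   ≈⟨ *-congˡ xy≈0 ⟩
    x⁻¹ * 0#        ≈⟨ zeroʳ x⁻¹ ⟩
    0#              ∎

  x-y≈0⇒x≈y : ∀ {x y} → x - y ≈ 0# → x ≈ y
  x-y≈0⇒x≈y {x} {y} e = begin
    x             ≈⟨ solve 2 (λ x y → x := (x :- y) :+ y) refl x y ⟩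
    (x - y) + y   ≈⟨ +-congʳ e ⟩
    0# + y        ≈⟨ +-identityˡ y ⟩
    y             ∎

  x≈y⇒x-y≈0 : ∀ {x y} → x ≈ y → x - y ≈ 0#
  x≈y⇒x-y≈0 {x} {y} e = trans (+-congʳ e) (-‿inverseʳ y)

-- Polynomials: evaluation, formal derivative, division by a monic polynomial.

module PolynomialProperties {ℓ} (F : Field ℓ) where
  open Field F
  open FieldProperties F
  open Polynomial F public

  infixr 7 _·ₚ_
  _·ₚ_ : Carrier → Poly → Poly
  a ·ₚ p = map (a *_) p

  coeff-+ₚ : ∀ p q i → coeff (p +ₚ q) i ≈ coeff p i + coeff q i
  coeff-+ₚ []      q       i       = sym (+-identityˡ _)
  coeff-+ₚ (a ∷ p) []      i       = sym (+-identityʳ _)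
  coeff-+ₚ (a ∷ p) (b ∷ q) zero    = refl
  coeff-+ₚ (a ∷ p) (b ∷ q) (suc i) = coeff-+ₚ p q i

  coeff-·ₚ : ∀ a p i → coeff (a ·ₚ p) i ≈ a * coeff p i
  coeff-·ₚ a []      i       = sym (zeroʳ a)
  coeff-·ₚ a (b ∷ p) zero    = refl
  coeff-·ₚ a (b ∷ p) (suc i) = coeff-·ₚ a p i

  HasLeadingTerm : ℕ → Poly → Set ℓ
  HasLeadingTerm n p = DegreeBelow (suc n) p × ¬ (coeff p n ≈ 0#)

  ∷-degreeBelow : ∀ {n} a p → DegreeBelow n p → DegreeBelow (suc n) (a ∷ p)
  ∷-degreeBelow a p d (suc i) (ℕ.s≤s n≤i) = d i n≤i

  zero-or-leadingTerm : ∀ p → (p ≈ₚ []) ⊎ ∃ λ n → HasLeadingTerm n p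
  zero-or-leadingTerm [] = inj₁ λ _ → refl
  zero-or-leadingTerm (a ∷ p) with zero-or-leadingTerm p | zero? a
  ... | inj₂ (n , d , l) | _ = inj₂ (suc n , ∷-degreeBelow a p d , l)
  ... | inj₁ p≈0 | inj₁ a≈0 = inj₁ λ { zero → a≈0 ; (suc i) → p≈0 i }
  ... | inj₁ p≈0 | inj₂ a≉0 = inj₂ (0 , (λ { (suc i) _ → p≈0 i }) , a≉0)

  leadingTerm-< : ∀ {m n p} → DegreeBelow m p → HasLeadingTerm n p → n ℕ.< m
  leadingTerm-< {m} {n} d (_ , l) with n ℕ.<? m
  ... | yes n<m = n<m
  ... | no  n≮m = contradiction (d n (ℕ.≮⇒≥ n≮m)) l

module Evaluation {ℓ} {F E : Field ℓ} (φ : F ⟶ E) where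
  private module F = Field F
  open Field E hiding (zero)
  open FieldProperties E
  open PolynomialProperties F
  open _⟶_ φ
  open Extension φ public
  open SetoidReasoning setoid

  ⟦⟧-injective : ∀ {a} → ⟦ a ⟧ ≈ 0# → a F.≈ F.0#
  ⟦⟧-injective {a} e with FieldProperties.zero? F a
  ... | inj₁ a≈0 = a≈0
  ... | inj₂ a≉0 with FieldProperties.inverse F a≉0
  ...   | b , ab≈1 = contradiction e (invertible⇒≉0 {y = ⟦ b ⟧}
            (trans (sym (*-homo a b)) (trans (⟦⟧-cong ab≈1) 1#-homo)))

  -- The value of the formal derivative, by (a + X p)′ = p + X p′. Following the recursion of `eval`
  -- keeps its proofs parallel to those for values.
  eval′ : Poly → Carrier → Carrier
  eval′ []      x = 0#
  eval′ (a ∷ p) x = eval p x + x * eval′ p x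

  coeff-map : ∀ p i → Polynomial.coeff E (map ⟦_⟧ p) i ≈ ⟦ coeff p i ⟧
  coeff-map []      i       = sym 0#-homo
  coeff-map (a ∷ p) zero    = refl
  coeff-map (a ∷ p) (suc i) = coeff-map p i

  map-leadingTerm : ∀ {n p} → HasLeadingTerm n p →
    PolynomialProperties.HasLeadingTerm E n (map ⟦_⟧ p)
  map-leadingTerm {n} {p} (d , l) =
    (λ i n<i → trans (coeff-map p i) (trans (⟦⟧-cong (d i n<i)) 0#-homo)) ,
    λ e → l (⟦⟧-injective (trans (sym (coeff-map p n)) e))

  eval-cong : ∀ p {x y} → x ≈ y → eval p x ≈ eval p y
  eval-cong []      e = refl
  eval-cong (a ∷ p) e = +-congˡ (*-cong e (eval-cong p e))

  eval′-cong : ∀ p {x y} → x ≈ y → eval′ p x ≈ eval′ p y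
  eval′-cong []      e = refl
  eval′-cong (a ∷ p) e = +-cong (eval-cong p e) (*-cong e (eval′-cong p e))

  eval-+ₚ : ∀ p q x → eval (p +ₚ q) x ≈ eval p x + eval q x
  eval-+ₚ []      q       x = sym (+-identityˡ _)
  eval-+ₚ (a ∷ p) []      x = sym (+-identityʳ _)
  eval-+ₚ (a ∷ p) (b ∷ q) x = begin
    ⟦ a F.+ b ⟧ + x * eval (p +ₚ q) x
      ≈⟨ +-cong (+-homo a b) (*-congˡ (eval-+ₚ p q x)) ⟩
    (⟦ a ⟧ + ⟦ b ⟧) + x * (eval p x + eval q x)
      ≈⟨ solve 5 (λ a b x p q → (a :+ b) :+ x :* (p :+ q) := (a :+ x :* p) :+ (b :+ x :* q))
           refl ⟦ a ⟧ ⟦ b ⟧ x (eval p x) (eval q x) ⟩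
    (⟦ a ⟧ + x * eval p x) + (⟦ b ⟧ + x * eval q x)  ∎

  eval′-+ₚ : ∀ p q x → eval′ (p +ₚ q) x ≈ eval′ p x + eval′ q x
  eval′-+ₚ []      q       x = sym (+-identityˡ _)
  eval′-+ₚ (a ∷ p) []      x = sym (+-identityʳ _)
  eval′-+ₚ (a ∷ p) (b ∷ q) x = begin
    eval (p +ₚ q) x + x * eval′ (p +ₚ q) x
      ≈⟨ +-cong (eval-+ₚ p q x) (*-congˡ (eval′-+ₚ p q x)) ⟩
    (eval p x + eval q x) + x * (eval′ p x + eval′ q x)
      ≈⟨ solve 5 (λ a b x p q → (a :+ b) :+ x :* (p :+ q) := (a :+ x :* p) :+ (b :+ x :* q))
           refl (eval p x) (eval q x) x (eval′ p x) (eval′ q x) ⟩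
    (eval p x + x * eval′ p x) + (eval q x + x * eval′ q x)  ∎

  eval-·ₚ : ∀ a p x → eval (a ·ₚ p) x ≈ ⟦ a ⟧ * eval p x
  eval-·ₚ a []      x = sym (zeroʳ _)
  eval-·ₚ a (b ∷ p) x = begin
    ⟦ a F.* b ⟧ + x * eval (a ·ₚ p) x
      ≈⟨ +-cong (*-homo a b) (*-congˡ (eval-·ₚ a p x)) ⟩
    ⟦ a ⟧ * ⟦ b ⟧ + x * (⟦ a ⟧ * eval p x)
      ≈⟨ solve 4 (λ a b x p → a :* b :+ x :* (a :* p) := a :* (b :+ x :* p))
           refl ⟦ a ⟧ ⟦ b ⟧ x (eval p x) ⟩
    ⟦ a ⟧ * (⟦ b ⟧ + x * eval p x)  ∎

  eval′-·ₚ : ∀ a p x → eval′ (a ·ₚ p) x ≈ ⟦ a ⟧ * eval′ p x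
  eval′-·ₚ a []      x = sym (zeroʳ _)
  eval′-·ₚ a (b ∷ p) x = begin
    eval (a ·ₚ p) x + x * eval′ (a ·ₚ p) x
      ≈⟨ +-cong (eval-·ₚ a p x) (*-congˡ (eval′-·ₚ a p x)) ⟩
    ⟦ a ⟧ * eval p x + x * (⟦ a ⟧ * eval′ p x)
      ≈⟨ solve 4 (λ a b x p → a :* b :+ x :* (a :* p) := a :* (b :+ x :* p))
           refl ⟦ a ⟧ (eval p x) x (eval′ p x) ⟩
    ⟦ a ⟧ * (eval p x + x * eval′ p x)  ∎

  eval-0∷ : ∀ p x → eval (F.0# ∷ p) x ≈ x * eval p x
  eval-0∷ p x = trans (+-congʳ 0#-homo) (+-identityˡ _)

  eval-*ₚ : ∀ p q x → eval (p *ₚ q) x ≈ eval p x * eval q x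
  eval-*ₚ []      q x = sym (zeroˡ _)
  eval-*ₚ (a ∷ p) q x = begin
    eval (a ·ₚ q +ₚ (F.0# ∷ (p *ₚ q))) x
      ≈⟨ eval-+ₚ (a ·ₚ q) _ x ⟩
    eval (a ·ₚ q) x + eval (F.0# ∷ (p *ₚ q)) x
      ≈⟨ +-cong (eval-·ₚ a q x) (trans (eval-0∷ (p *ₚ q) x) (*-congˡ (eval-*ₚ p q x))) ⟩
    ⟦ a ⟧ * eval q x + x * (eval p x * eval q x)
      ≈⟨ solve 4 (λ a q x p → a :* q :+ x :* (p :* q) := (a :+ x :* p) :* q)
           refl ⟦ a ⟧ (eval q x) x (eval p x) ⟩
    (⟦ a ⟧ + x * eval p x) * eval q x  ∎

  eval-derivative : ∀ p x → eval (derivative p) x ≈ eval′ p x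
  eval-derivative []      x = refl
  eval-derivative (a ∷ p) x = trans (eval-+ₚ p _ x)
    (+-congˡ (trans (eval-0∷ (derivative p) x) (*-congˡ (eval-derivative p x))))

  eval-zero : ∀ p → p ≈ₚ [] → ∀ x → eval p x ≈ 0#
  eval-zero []      _ x = refl
  eval-zero (a ∷ p) z x = begin
    ⟦ a ⟧ + x * eval p x  ≈⟨ +-cong (trans (⟦⟧-cong (z 0)) 0#-homo) (*-congˡ (eval-zero p (λ i → z (suc i)) x)) ⟩
    0# + x * 0#           ≈⟨ trans (+-identityˡ _) (zeroʳ x) ⟩
    0#                    ∎

  eval′-zero : ∀ p → p ≈ₚ [] → ∀ x → eval′ p x ≈ 0#
  eval′-zero []      _ x = refl
  eval′-zero (a ∷ p) z x = begin
    eval p x + x * eval′ p x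
      ≈⟨ +-cong (eval-zero p (λ i → z (suc i)) x) (*-congˡ (eval′-zero p (λ i → z (suc i)) x)) ⟩
    0# + x * 0#           ≈⟨ trans (+-identityˡ _) (zeroʳ x) ⟩
    0#                    ∎

  eval-≈ₚ : ∀ p q → p ≈ₚ q → ∀ x → eval p x ≈ eval q x
  eval-≈ₚ []      q       e x = sym (eval-zero q (λ i → F.sym (e i)) x)
  eval-≈ₚ (a ∷ p) []      e x = eval-zero (a ∷ p) e x
  eval-≈ₚ (a ∷ p) (b ∷ q) e x =
    +-cong (⟦⟧-cong (e 0)) (*-congˡ (eval-≈ₚ p q (λ i → e (suc i)) x))

  eval-1ₚ : ∀ x → eval (F.1# ∷ []) x ≈ 1#
  eval-1ₚ x = trans (+-cong 1#-homo (zeroʳ x)) (+-identityʳ 1#)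

  eval-X : ∀ x → eval (F.0# ∷ F.1# ∷ []) x ≈ x
  eval-X x = trans (eval-0∷ (F.1# ∷ []) x) (trans (*-congˡ (eval-1ₚ x)) (*-identityʳ x))

  eval-constant : ∀ a x → eval (a ∷ []) x ≈ ⟦ a ⟧
  eval-constant a x = trans (+-congˡ (zeroʳ x)) (+-identityʳ ⟦ a ⟧)

  -ₚ_ : Poly → Poly
  -ₚ p = (F.- F.1#) ·ₚ p

  eval--ₚ : ∀ p x → eval (-ₚ p) x ≈ - eval p x
  eval--ₚ p x = begin
    eval (-ₚ p) x                 ≈⟨ eval-·ₚ _ p x ⟩
    ⟦ F.- F.1# ⟧ * eval p x       ≈⟨ *-congʳ (trans (-‿homo F.1#) (-‿cong 1#-homo)) ⟩
    - 1# * eval p x               ≈⟨ -1*x≈-x _ ⟩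
    - eval p x                    ∎

  -- Evaluate the Bézout identity at the root: if p and p′ both vanished there, 1 would be 0.
  separable⇒eval′≉0 : ∀ p → SeparablePoly p → ∀ x → eval p x ≈ 0# → ¬ (eval′ p x ≈ 0#)
  separable⇒eval′≉0 p (a , b , e) x px≈0 p′x≈0 = 1≉0 (begin
    1#                                              ≈⟨ eval-1ₚ x ⟨
    eval (F.1# ∷ []) x                              ≈⟨ eval-≈ₚ ((a *ₚ p) +ₚ (b *ₚ derivative p)) (F.1# ∷ []) e x ⟨
    eval ((a *ₚ p) +ₚ (b *ₚ derivative p)) x        ≈⟨ eval-+ₚ (a *ₚ p) _ x ⟩
    eval (a *ₚ p) x + eval (b *ₚ derivative p) x    ≈⟨ +-cong (eval-*ₚ a p x) (eval-*ₚ b (derivative p) x) ⟩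
    eval a x * eval p x + eval b x * eval (derivative p) x
      ≈⟨ +-cong (*-congˡ px≈0) (*-congˡ (trans (eval-derivative p x) p′x≈0)) ⟩
    eval a x * 0# + eval b x * 0#                   ≈⟨ +-cong (zeroʳ _) (zeroʳ _) ⟩
    0# + 0#                                         ≈⟨ +-identityˡ 0# ⟩
    0#                                              ∎)

  -- Only values are kept, not the quotient: for g = h q + r the equation g′ = h′ q + h q′ + r′
  -- shows that g′ and r′ agree where q and q′ both vanish.
  record Remainder (n : ℕ) (q g : Poly) : Set ℓ where
    field
      remainder   : Poly
      degreeBelow : DegreeBelow n remainder
      eval-≈      : ∀ x → eval q x ≈ 0# → eval g x ≈ eval remainder x
      eval′-≈     : ∀ x → eval q x ≈ 0# → eval′ q x ≈ 0# → eval′ g x ≈ eval′ remainder x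

  remainderBy : ∀ {n q} → Monic n q → ∀ g → Remainder n q g
  remainderBy _ [] = record
    { remainder = [] ; degreeBelow = λ _ _ → F.refl
    ; eval-≈ = λ _ _ → refl ; eval′-≈ = λ _ _ _ → refl }
  remainderBy {n} {q} (l , d) (a ∷ g) = record
    { remainder = h
    ; degreeBelow = below
    ; eval-≈ = λ x qx≈0 → begin
        ⟦ a ⟧ + x * eval g x              ≈⟨ +-congˡ (*-congˡ (R.eval-≈ x qx≈0)) ⟩
        eval (a ∷ r) x                    ≈⟨ +-identityʳ _ ⟨
        eval (a ∷ r) x + 0#               ≈⟨ +-congˡ (trans (*-congˡ qx≈0) (zeroʳ _)) ⟨
        eval (a ∷ r) x + ⟦ t ⟧ * eval q x ≈⟨ +-congˡ (eval-·ₚ t q x) ⟨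
        eval (a ∷ r) x + eval (t ·ₚ q) x  ≈⟨ eval-+ₚ (a ∷ r) (t ·ₚ q) x ⟨
        eval h x                          ∎
    ; eval′-≈ = λ x qx≈0 q′x≈0 → begin
        eval g x + x * eval′ g x            ≈⟨ +-cong (R.eval-≈ x qx≈0) (*-congˡ (R.eval′-≈ x qx≈0 q′x≈0)) ⟩
        eval′ (a ∷ r) x                     ≈⟨ +-identityʳ _ ⟨
        eval′ (a ∷ r) x + 0#                ≈⟨ +-congˡ (trans (*-congˡ q′x≈0) (zeroʳ _)) ⟨
        eval′ (a ∷ r) x + ⟦ t ⟧ * eval′ q x ≈⟨ +-congˡ (eval′-·ₚ t q x) ⟨
        eval′ (a ∷ r) x + eval′ (t ·ₚ q) x  ≈⟨ eval′-+ₚ (a ∷ r) (t ·ₚ q) x ⟨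
        eval′ h x                           ∎
    }
    where
    module R = Remainder (remainderBy {q = q} (l , d) g)
    module FP = FieldProperties F
    r = R.remainder
    -- a + X r may have degree n; subtracting its n-th coefficient times the monic q restores the
    -- bound.
    t = F.- coeff (a ∷ r) n
    h = (a ∷ r) +ₚ t ·ₚ q
    coeff-h : ∀ i → coeff h i F.≈ coeff (a ∷ r) i F.+ t F.* coeff q i
    coeff-h i = F.trans (coeff-+ₚ (a ∷ r) (t ·ₚ q) i) (F.+-congˡ (coeff-·ₚ t q i))
    below : DegreeBelow n h
    below i n≤i with ℕ.m≤n⇒m<n∨m≡n n≤i
    ... | inj₂ ≡.refl = F.trans (coeff-h n) (F.trans (F.+-congˡ (F.trans (F.*-congˡ l) (F.*-identityʳ t)))
                          (F.-‿inverseʳ _))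
    ... | inj₁ n<i = F.trans (coeff-h i) (F.trans
        (F.+-cong (∷-degreeBelow a r R.degreeBelow i n<i) (F.trans (F.*-congˡ (d i n<i)) (F.zeroʳ t)))
        (F.+-identityˡ F.0#))

module _ {ℓ} {F E E′ : Field ℓ} (φ : F ⟶ E) (ψ : E ⟶ E′) (χ : F ⟶ E′) where
  private
    module φ = _⟶_ φ
    module χ = _⟶_ χ
    module Eφ = Evaluation φ
    module Eψ = Evaluation ψ
    module Eχ = Evaluation χ
  open Field E′
  open _⟶_ ψ

  module _ (commutes : ∀ a → ⟦ φ.⟦ a ⟧ ⟧ ≈ χ.⟦ a ⟧) where

    ⟦eval⟧ : ∀ p x → ⟦ Eφ.eval p x ⟧ ≈ Eχ.eval p ⟦ x ⟧
    ⟦eval⟧ []      x = 0#-homo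
    ⟦eval⟧ (a ∷ p) x = trans (+-homo _ _)
      (+-cong (commutes a) (trans (*-homo _ _) (*-congˡ (⟦eval⟧ p x))))

    eval-map : ∀ p x → Eψ.eval (map φ.⟦_⟧ p) x ≈ Eχ.eval p x
    eval-map []      x = refl
    eval-map (a ∷ p) x = +-cong (commutes a) (*-congˡ (eval-map p x))

    eval′-map : ∀ p x → Eψ.eval′ (map φ.⟦_⟧ p) x ≈ Eχ.eval′ p x
    eval′-map []      x = refl
    eval′-map (a ∷ p) x = +-cong (eval-map p x) (*-congˡ (eval′-map p x))

-- Linear dependence, degrees and minimal polynomials.

least : ∀ {a} → ExcludedMiddle a → (P : ℕ → Set a) → ∃ P →
        ∃ λ n → P n × (∀ m → m ℕ.< n → ¬ P m)
least em P (n , Pn) = <-rec (λ n → P n → ∃ λ n → P n × (∀ m → m ℕ.< n → ¬ P m)) step n Pn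
  where
  step : ∀ n → (∀ {m} → m ℕ.< n → P m → _) → P n → _
  step n rec Pn with em {∃ λ m → m ℕ.< n × P m}
  ... | yes (m , m<n , Pm) = rec m<n Pm
  ... | no  minimal        = n , Pn , λ m m<n Pm → minimal (m , m<n , Pm)

module LinearDependence {ℓ} (F : Field ℓ) where
  open Field F hiding (zero)
  open FieldProperties F
  open Sum semiring using (sum; sum-cong-≋; sum-replicate-zero)
  open SetoidReasoning setoid

  sum-≈0 : ∀ {n} (t : Fin n → Carrier) → (∀ i → t i ≈ 0#) → sum t ≈ 0#
  sum-≈0 {n} t z = trans (sum-cong-≋ z) (sum-replicate-zero n)

  private
    -- Supplies the coefficient - Σ cᵢ lᵢ of row zero that turns a relation between the reduced rows
    -- into one between the original rows.
    sum-eliminate : ∀ {k} (c A l : Fin k → Carrier) a →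
      - sum (λ i → c i * l i) * a + sum (λ i → c i * A i) ≈ sum (λ i → c i * (A i - l i * a))
    sum-eliminate {zero}  c A l a = solve 1 (λ a → :- con (ℤ.+ 0) :* a :+ con (ℤ.+ 0) := con (ℤ.+ 0)) refl a
    sum-eliminate {suc k} c A l a = begin
      - (c₀ * l₀ + S) * a + (c₀ * A₀ + T)
        ≈⟨ solve 6 (λ c l S a A T → :- (c :* l :+ S) :* a :+ (c :* A :+ T)
             := c :* (A :- l :* a) :+ (:- S :* a :+ T)) refl c₀ l₀ S a A₀ T ⟩
      c₀ * (A₀ - l₀ * a) + (- S * a + T)
        ≈⟨ +-congˡ (sum-eliminate (λ i → c (suc i)) (λ i → A (suc i)) (λ i → l (suc i)) a) ⟩
      _ ∎
      where
      c₀ = c zero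
      l₀ = l zero
      A₀ = A zero
      S = sum (λ i → c (suc i) * l (suc i))
      T = sum (λ i → c (suc i) * A (suc i))

  -- Gaussian elimination, one column at a time. If row zero vanishes it is a relation by itself;
  -- otherwise it clears its pivot column, and a relation among the remaining rows extends to row
  -- zero.
  dependent-rows : ∀ {n n′} → n ℕ.< n′ → (A : Fin n′ → Fin n → Carrier) →
    ∃ λ (c : Fin n′ → Carrier) → (∃ λ i → ¬ (c i ≈ 0#)) × (∀ j → sum (λ i → c i * A i j) ≈ 0#)
  dependent-rows {n} {suc k} n<n′ A with Fin.any? (λ j → ≉0? (A zero j))
  ... | no row₀≈0 = e₀ , (zero , 1≉0) , λ j →
        trans (+-cong (trans (*-identityˡ _) (row-zero j)) (sum-≈0 _ λ i → zeroˡ (A (suc i) j)))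
          (+-identityˡ 0#)
    where
    e₀ : Fin (suc k) → Carrier
    e₀ zero    = 1#
    e₀ (suc _) = 0#
    row-zero : ∀ j → A zero j ≈ 0#
    row-zero j with zero? (A zero j)
    ... | inj₁ e  = e
    ... | inj₂ ¬e = contradiction (j , ¬e) row₀≈0
  dependent-rows {suc m} {suc k} (ℕ.s≤s m<k) A | yes (p , pivot)
    with inverse pivot
  ... | A₀ₚ⁻¹ , inv with dependent-rows m<k (λ i j →
          A (suc i) (punchIn p j) - A (suc i) p * A₀ₚ⁻¹ * A zero (punchIn p j))
  ...   | c , (i , cᵢ≉0) , relation = c′ , (suc i , cᵢ≉0) , λ j →
          trans (sum-eliminate c (λ i → A (suc i) j) l (A zero j)) (column j)
    where
    l : Fin k → Carrier
    l i = A (suc i) p * A₀ₚ⁻¹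
    c′ : Fin (suc k) → Carrier
    c′ zero    = - sum (λ i → c i * l i)
    c′ (suc i) = c i
    column : ∀ j → sum (λ i → c i * (A (suc i) j - l i * A zero j)) ≈ 0#
    column j with p Fin.≟ j
    ... | no p≢j = ≡.subst (λ j → sum (λ i → c i * (A (suc i) j - l i * A zero j)) ≈ 0#)
                     (Fin.punchIn-punchOut p≢j) (relation (punchOut p≢j))
    ... | yes ≡.refl = sum-≈0 _ λ i → begin
      c i * (A (suc i) p - A (suc i) p * A₀ₚ⁻¹ * A zero p)
        ≈⟨ solve 4 (λ c a v b → c :* (a :- a :* v :* b) := c :* (a :- a :* (b :* v)))
             refl (c i) (A (suc i) p) A₀ₚ⁻¹ (A zero p) ⟩
      c i * (A (suc i) p - A (suc i) p * (A zero p * A₀ₚ⁻¹))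
        ≈⟨ *-congˡ (+-congˡ (-‿cong (trans (*-congˡ inv) (*-identityʳ _)))) ⟩
      c i * (A (suc i) p - A (suc i) p)
        ≈⟨ trans (*-congˡ (-‿inverseʳ _)) (zeroʳ _) ⟩
      0# ∎

module LinearCombinations {ℓ} {F E : Field ℓ} (φ : F ⟶ E) where
  private
    module F where
      open Field F public
      open Sum semiring public
  open Field E hiding (zero)
  open FieldProperties E
  open LinearDependence E using (sum-≈0) public
  open Sum semiring
  open _⟶_ φ
  open Evaluation φ
  open PolynomialProperties F
  open Exp semiring using (_^_) public
  open SetoidReasoning setoid

  Independent : ∀ {n} → (Fin n → Carrier) → Set ℓ
  Independent b = ∀ c → combination c b ≈ 0# → ∀ i → c i F.≈ F.0#

  ⟦sum⟧ : ∀ {n} (t : Fin n → F.Carrier) → ⟦ F.sum t ⟧ ≈ sum (λ i → ⟦ t i ⟧)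
  ⟦sum⟧ {zero}  t = 0#-homo
  ⟦sum⟧ {suc n} t = trans (+-homo _ _) (+-congˡ (⟦sum⟧ (λ i → t (suc i))))

  dependent : ∀ {n n′} → n ℕ.< n′ → (b : Fin n → Carrier) (w : Fin n′ → Carrier) →
    (∀ i → ∃ λ c → w i ≈ combination c b) →
    ∃ λ (c : Fin n′ → F.Carrier) → (∃ λ i → ¬ (c i F.≈ F.0#)) × combination c w ≈ 0#
  dependent n<n′ b w spanned with LinearDependence.dependent-rows F n<n′ (λ i → proj₁ (spanned i))
  ... | c , nonzero , relation = c , nonzero , (begin
    sum (λ i → ⟦ c i ⟧ * w i)
      ≈⟨ sum-cong-≋ (λ i → trans (*-congˡ (proj₂ (spanned i)))
           (*-distribˡ-sum ⟦ c i ⟧ (λ j → ⟦ A i j ⟧ * b j))) ⟩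
    sum (λ i → sum (λ j → ⟦ c i ⟧ * (⟦ A i j ⟧ * b j)))
      ≈⟨ ∑-comm (λ i j → ⟦ c i ⟧ * (⟦ A i j ⟧ * b j)) ⟩
    sum (λ j → sum (λ i → ⟦ c i ⟧ * (⟦ A i j ⟧ * b j)))
      ≈⟨ sum-≈0 _ (λ j → begin
           sum (λ i → ⟦ c i ⟧ * (⟦ A i j ⟧ * b j))
             ≈⟨ sum-cong-≋ (λ i → trans (sym (*-assoc _ _ _)) (*-congʳ (sym (*-homo (c i) (A i j))))) ⟩
           sum (λ i → ⟦ c i F.* A i j ⟧ * b j)
             ≈⟨ *-distribʳ-sum (b j) (λ i → ⟦ c i F.* A i j ⟧) ⟨
           sum (λ i → ⟦ c i F.* A i j ⟧) * b j
             ≈⟨ *-congʳ (⟦sum⟧ (λ i → c i F.* A i j)) ⟨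
           ⟦ F.sum (λ i → c i F.* A i j) ⟧ * b j
             ≈⟨ *-congʳ (trans (⟦⟧-cong (relation j)) 0#-homo) ⟩
           0# * b j
             ≈⟨ zeroˡ (b j) ⟩
           0# ∎) ⟩
    0# ∎)
    where
    A : Fin _ → Fin _ → F.Carrier
    A i = proj₁ (spanned i)

  independent⇒≤ : ∀ {n n′} (b : Fin n → Carrier) (w : Fin n′ → Carrier) → Independent w →
    (∀ i → ∃ λ c → w i ≈ combination c b) → n′ ℕ.≤ n
  independent⇒≤ {n} {n′} b w indep spanned with n′ ℕ.≤? n
  ... | yes n′≤n = n′≤n
  ... | no  n′≰n with dependent (ℕ.≰⇒> n′≰n) b w spanned
  ...   | c , (i , cᵢ≉0) , relation = contradiction (indep c relation i) cᵢ≉0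

  degree-unique : ∀ {n n′} → HasDegree n → HasDegree n′ → n ≡ n′
  degree-unique (b , B) (b′ , B′) = ℕ.≤-antisym
    (independent⇒≤ b′ b B.independent (λ i → B′.spans (b i)))
    (independent⇒≤ b b′ B′.independent (λ i → B.spans (b′ i)))
    where
    module B = IsBasis B
    module B′ = IsBasis B′

  eval-drop : ∀ p x → eval p x ≈ ⟦ coeff p 0 ⟧ + x * eval (drop 1 p) x
  eval-drop []      x = sym (trans (+-cong 0#-homo (zeroʳ x)) (+-identityˡ 0#))
  eval-drop (a ∷ p) x = refl

  coeff-drop : ∀ p i → coeff (drop 1 p) i ≡ coeff p (suc i)
  coeff-drop []      i = ≡.refl
  coeff-drop (a ∷ p) i = ≡.refl

  eval-powers : ∀ n p x → DegreeBelow n p →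
    eval p x ≈ combination (λ i → coeff p (toℕ i)) (λ (i : Fin n) → x ^ toℕ i)
  eval-powers zero    p x d = eval-zero p (λ i → d i ℕ.z≤n) x
  eval-powers (suc n) p x d = begin
    eval p x
      ≈⟨ eval-drop p x ⟩
    ⟦ coeff p 0 ⟧ + x * eval (drop 1 p) x
      ≈⟨ +-cong (sym (*-identityʳ _)) (*-congˡ (eval-powers n (drop 1 p) x
           λ i n≤i → F.trans (F.reflexive (coeff-drop p i)) (d (suc i) (ℕ.s≤s n≤i)))) ⟩
    ⟦ coeff p 0 ⟧ * 1# + x * combination (λ i → coeff (drop 1 p) (toℕ i)) (λ (i : Fin n) → x ^ toℕ i)
      ≈⟨ +-congˡ (*-distribˡ-sum x (λ (i : Fin n) → ⟦ coeff (drop 1 p) (toℕ i) ⟧ * x ^ toℕ i)) ⟩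
    ⟦ coeff p 0 ⟧ * 1# + sum (λ (i : Fin n) → x * (⟦ coeff (drop 1 p) (toℕ i) ⟧ * x ^ toℕ i))
      ≈⟨ +-congˡ (sum-cong-≋ λ (i : Fin n) → begin
           x * (⟦ coeff (drop 1 p) (toℕ i) ⟧ * x ^ toℕ i)
             ≡⟨ ≡.cong (λ a → x * (⟦ a ⟧ * x ^ toℕ i)) (coeff-drop p (toℕ i)) ⟩
           x * (⟦ coeff p (suc (toℕ i)) ⟧ * x ^ toℕ i)
             ≈⟨ solve 3 (λ x a y → x :* (a :* y) := a :* (x :* y)) refl x ⟦ coeff p (suc (toℕ i)) ⟧ (x ^ toℕ i) ⟩
           ⟦ coeff p (suc (toℕ i)) ⟧ * (x * x ^ toℕ i) ∎) ⟩
    _ ∎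

  tabulate-degreeBelow : ∀ n (c : Fin n → F.Carrier) → DegreeBelow n (tabulate c)
  tabulate-degreeBelow zero    c i       n≤i          = F.refl
  tabulate-degreeBelow (suc n) c (suc i) (ℕ.s≤s n≤i) = tabulate-degreeBelow n (λ i → c (suc i)) i n≤i

  coeff-tabulate : ∀ n (c : Fin n → F.Carrier) i → coeff (tabulate c) (toℕ i) ≡ c i
  coeff-tabulate (suc n) c zero    = ≡.refl
  coeff-tabulate (suc n) c (suc i) = coeff-tabulate n (λ i → c (suc i)) i

  MinimalOfDegree : ℕ → Poly → Carrier → Set ℓ
  MinimalOfDegree n p x =
    Monic n p × eval p x ≈ 0# × (∀ q → DegreeBelow n q → eval q x ≈ 0# → q ≈ₚ [])

  -- The coefficients of a relation form a polynomial of degree below n vanishing at x.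
  powers-independent : ∀ {n p x} → MinimalOfDegree n p x → Independent (λ (i : Fin n) → x ^ toℕ i)
  powers-independent {n} {p} {x} (_ , _ , minimal) c relation i = F.trans
    (F.reflexive (≡.sym (coeff-tabulate n c i)))
    (minimal (tabulate c) (tabulate-degreeBelow n c) (trans
      (eval-powers n (tabulate c) x (tabulate-degreeBelow n c))
      (trans (sum-cong-≋ λ i → *-congʳ (reflexive (≡.cong ⟦_⟧ (coeff-tabulate n c i)))) relation))
      (toℕ i))

  -- An annihilating polynomial of least degree, made monic; a nonzero one of smaller degree would
  -- contradict the choice.
  minimalPolynomial : ExcludedMiddle ℓ → ∀ x → (∃ λ p → ¬ (p ≈ₚ []) × eval p x ≈ 0#) →
    ∃ λ n → ∃ λ p → MinimalOfDegree n p x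
  minimalPolynomial em x (p , p≉0 , px≈0) with least em
    (λ n → ∃ λ p → HasLeadingTerm n p × eval p x ≈ 0#) (vanishing p p≉0 px≈0)
    where
    vanishing : ∀ p → ¬ (p ≈ₚ []) → eval p x ≈ 0# →
      ∃ λ n → ∃ λ p → HasLeadingTerm n p × eval p x ≈ 0#
    vanishing p p≉0 px≈0 with zero-or-leadingTerm p
    ... | inj₁ p≈0     = contradiction p≈0 p≉0
    ... | inj₂ (n , l) = n , p , l , px≈0
  ... | n , (q , (d , l) , qx≈0) , minimal with FieldProperties.inverse F l
  ...   | l⁻¹ , inv = n , l⁻¹ ·ₚ q
        , ( F.trans (coeff-·ₚ l⁻¹ q n) (F.trans (F.*-comm _ _) inv)
          , λ i n<i → F.trans (coeff-·ₚ l⁻¹ q i) (F.trans (F.*-congˡ (d i n<i)) (F.zeroʳ _)))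
        , trans (eval-·ₚ l⁻¹ q x) (trans (*-congˡ qx≈0) (zeroʳ _))
        , λ r r<n rx≈0 → [ (λ r≈0 → r≈0)
            , (λ (k , lead) → contradiction (r , lead , rx≈0) (minimal k (leadingTerm-< {p = r} r<n lead))) ]′
            (zero-or-leadingTerm r)

module _ {ℓ} {F E E′ : Field ℓ} (φ : F ⟶ E) (ψ : E ⟶ E′) (χ : F ⟶ E′) where
  private
    module φ = _⟶_ φ
    module χ = _⟶_ χ
    module E = Field E
  open Field E′ hiding (zero)
  open _⟶_ ψ

  ⟦combination⟧ : (∀ a → ⟦ φ.⟦ a ⟧ ⟧ ≈ χ.⟦ a ⟧) → ∀ {n} (c : Fin n → Field.Carrier F) (b : Fin n → E.Carrier) →
    ⟦ Extension.combination φ c b ⟧ ≈ Extension.combination χ c (λ i → ⟦ b i ⟧)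
  ⟦combination⟧ commutes {zero}  c b = 0#-homo
  ⟦combination⟧ commutes {suc n} c b = trans (+-homo _ _) (+-cong
    (trans (*-homo _ _) (*-congʳ (commutes _)))
    (⟦combination⟧ commutes (λ i → c (suc i)) (λ i → b (suc i))))

-- Subfields generated by algebraic elements.

module AlgebraicExtension {ℓ} {F Ω : Field ℓ} (φ : F ⟶ Ω) (algebraic : Extension.Algebraic φ) where
  open Field Ω hiding (zero)
  open FieldProperties Ω
  open _⟶_ φ
  open Evaluation φ
  open PolynomialProperties F
  open LinearCombinations φ
  open SetoidReasoning setoid

  -- Inversion is left out: in an algebraic extension a subring containing F is a field.
  record IsSubalgebra (P : Pred Carrier ℓ) : Set ℓ where
    field
      resp     : ∀ {x y} → x ≈ y → P x → P y
      contains : ∀ a → P ⟦ a ⟧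
      +-closed : ∀ {x y} → P x → P y → P (x + y)
      *-closed : ∀ {x y} → P x → P y → P (x * y)
      -‿closed : ∀ {x} → P x → P (- x)

    eval-closed : ∀ p {x} → P x → P (eval p x)
    eval-closed []      Px = resp 0#-homo (contains _)
    eval-closed (a ∷ p) Px = +-closed (contains a) (*-closed Px (eval-closed p Px))

    -- A polynomial relation a + x p(x) = 0 with a ≠ 0 exhibits - p(x) / a as the inverse of x.
    ⁻¹-closed : ∀ {x y} → P x → x * y ≈ 1# → P y
    ⁻¹-closed {x} {y} Px xy≈1 with algebraic x
    ... | p , p≉0 , px≈0 = go p p≉0 px≈0
      where
      go : ∀ p → ¬ (p ≈ₚ []) → eval p x ≈ 0# → P y
      go []      p≉0 px≈0 = contradiction (λ _ → Field.refl F) p≉0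
      go (a ∷ p) p≉0 px≈0 with FieldProperties.zero? F a
      ... | inj₁ a≈0 = go p (λ p≈0 → p≉0 λ { zero → a≈0 ; (suc i) → p≈0 i })
            (*-cancelˡ-0 (invertible⇒≉0 xy≈1)
              (trans (sym (trans (+-congʳ (trans (⟦⟧-cong a≈0) 0#-homo)) (+-identityˡ _))) px≈0))
      ... | inj₂ a≉0 with FieldProperties.inverse F a≉0
      ...   | b , ab≈1 = resp e (-‿closed (*-closed (contains b) (eval-closed p Px)))
        where
        A = ⟦ a ⟧
        B = ⟦ b ⟧
        Q = eval p x
        e : - (B * Q) ≈ y
        e = begin
          - (B * Q)
            ≈⟨ solve 2 (λ B Q → :- (B :* Q) := :- (B :* Q) :* con (ℤ.+ 1)) refl B Q ⟩
          - (B * Q) * 1#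
            ≈⟨ *-congˡ xy≈1 ⟨
          - (B * Q) * (x * y)
            ≈⟨ solve 5 (λ A B Q x y → :- (B :* Q) :* (x :* y)
                 := (A :* B) :* y :- (B :* y) :* (A :+ x :* Q)) refl A B Q x y ⟩
          (A * B) * y - (B * y) * (A + x * Q)
            ≈⟨ +-cong (*-congʳ (trans (sym (*-homo a b)) (trans (⟦⟧-cong ab≈1) 1#-homo)))
                 (-‿cong (trans (*-congˡ px≈0) (zeroʳ _))) ⟩
          1# * y - 0#
            ≈⟨ trans (+-congˡ -0#≈0#) (trans (+-identityʳ _) (*-identityˡ y)) ⟩
          y ∎

    intermediateField : IntermediateField φ
    intermediateField = record
      { Member = P ; resp = resp ; contains = contains ; +-closed = +-closed
      ; *-closed = *-closed ; -‿closed = -‿closed ; ⁻¹-closed = ⁻¹-closed }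

  open Subextensions φ
  open IntermediateField

  module _ (c : Carrier) where

    -- This has the elements of F(c), but each comes with a polynomial whose value it is, so that a
    -- map out of the field can evaluate that polynomial at another point.
    F[_] : IntermediateField φ
    F[_] = IsSubalgebra.intermediateField {λ x → ∃ λ g → eval g c ≈ x} record
      { resp     = λ e (g , gc≈x) → g , trans gc≈x e
      ; contains = λ a → a ∷ [] , eval-constant a c
      ; +-closed = λ (g , gc≈x) (h , hc≈y) → g +ₚ h , trans (eval-+ₚ g h c) (+-cong gc≈x hc≈y)
      ; *-closed = λ (g , gc≈x) (h , hc≈y) → g *ₚ h , trans (eval-*ₚ g h c) (*-cong gc≈x hc≈y)
      ; -‿closed = λ (g , gc≈x) → -ₚ g , trans (eval--ₚ g c) (-‿cong gc≈x)
      }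

    c∈F[c] : Member F[_] c
    c∈F[c] = Field.0# F ∷ Field.1# F ∷ [] , eval-X c

  adjoin-least : ∀ {S} (L : IntermediateField φ) → (∀ {x} → S x → Member L x) → adjoin S ⊑ L
  adjoin-least L S⊆L (generator s)   = S⊆L s
  adjoin-least L S⊆L (scalar a)      = contains L a
  adjoin-least L S⊆L (≈-resp e x)    = resp L e (adjoin-least L S⊆L x)
  adjoin-least L S⊆L (plus x y)      = +-closed L (adjoin-least L S⊆L x) (adjoin-least L S⊆L y)
  adjoin-least L S⊆L (times x y)     = *-closed L (adjoin-least L S⊆L x) (adjoin-least L S⊆L y)
  adjoin-least L S⊆L (negate x)      = -‿closed L (adjoin-least L S⊆L x)
  adjoin-least L S⊆L (invert x e)    = ⁻¹-closed L (adjoin-least L S⊆L x) e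

  α∈K⟮α⟯ : ∀ α → Member K⟮ α ⟯ α
  α∈K⟮α⟯ α = generator refl

  K⟮α⟯⊑K[α] : ∀ α → K⟮ α ⟯ ⊑ F[ α ]
  K⟮α⟯⊑K[α] α = adjoin-least F[ α ] λ e → resp F[ α ] (sym e) (c∈F[c] α)

  ^-closed : ∀ (L : IntermediateField φ) {x} → Member L x → ∀ n → Member L (x ^ n)
  ^-closed L x∈L zero    = resp L 1#-homo (contains L _)
  ^-closed L x∈L (suc n) = *-closed L x∈L (^-closed L x∈L n)

  minimalPolynomial⇒Deg : ∀ {n p x} → MinimalOfDegree n p x → Deg x n
  minimalPolynomial⇒Deg {n} {p} {x} min@(monic , px≈0 , minimal) = powers , record
    { spans = λ (y , y∈) → spans (K⟮α⟯⊑K[α] x y∈)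
    ; independent = λ c relation → powers-independent {p = p} min c
        (trans (sym (in-Ω c)) relation)
    }
    where
    powers : Fin n → Σ Carrier (Member K⟮ x ⟯)
    powers i = x ^ toℕ i , ^-closed K⟮ x ⟯ (α∈K⟮α⟯ x) (toℕ i)
    in-Ω : ∀ c → proj₁ (Extension.combination (base K⟮ x ⟯) c powers) ≈ combination c (λ i → x ^ toℕ i)
    in-Ω c = ⟦combination⟧ (base K⟮ x ⟯) (inclusion K⟮ x ⟯) φ (λ _ → refl) c powers
    spans : ∀ {y} → Member F[ x ] y →
      ∃ λ c → y ≈ proj₁ (Extension.combination (base K⟮ x ⟯) c powers)
    spans {y} (g , gx≈y) = (λ i → coeff R.remainder (toℕ i)) , (begin
      y                   ≈⟨ gx≈y ⟨
      eval g x            ≈⟨ R.eval-≈ x px≈0 ⟩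
      eval R.remainder x  ≈⟨ eval-powers n R.remainder x R.degreeBelow ⟩
      combination (λ i → coeff R.remainder (toℕ i)) (λ (i : Fin n) → x ^ toℕ i)
                          ≈⟨ in-Ω (λ i → coeff R.remainder (toℕ i)) ⟨
      _ ∎)
      where module R = Remainder (remainderBy {q = p} monic g)

-- Splitting into linear factors over an algebraically closed field.

identity : ∀ {ℓ} (F : Field ℓ) → F ⟶ F
identity F = record
  { ⟦_⟧ = λ x → x
  ; isRingHomomorphism = record
    { isSemiringHomomorphism = record
      { isNearSemiringHomomorphism = record
        { +-isMonoidHomomorphism = record
          { isMagmaHomomorphism = record
            { isRelHomomorphism = record { cong = λ e → e }
            ; homo = λ _ _ → refl
            }
          ; ε-homo = refl
          }
        ; *-homo = λ _ _ → refl
        }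
      ; 1#-homo = refl
      }
    ; -‿homo = λ _ → refl
    }
  }
  where open Field F

module Factorisation {ℓ} (Ω : Field ℓ) where
  open Field Ω hiding (zero)
  open FieldProperties Ω
  open PolynomialProperties Ω
  open Evaluation (identity Ω)
  open LinearCombinations (identity Ω) using (eval-drop; coeff-drop)
  open SetoidReasoning setoid

  -- Horner's scheme: the quotient of p by X - ρ, up to a trailing zero.
  synthetic : Carrier → Poly → Poly
  synthetic ρ []      = []
  synthetic ρ (a ∷ p) = eval p ρ ∷ synthetic ρ p

  eval-synthetic : ∀ ρ p x → eval p x ≈ eval p ρ + (x - ρ) * eval (synthetic ρ p) x
  eval-synthetic ρ []      x = sym (trans (+-identityˡ _) (zeroʳ _))
  eval-synthetic ρ (a ∷ p) x = begin
    a + x * eval p x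
      ≈⟨ +-congˡ (*-congˡ (eval-synthetic ρ p x)) ⟩
    a + x * (eval p ρ + (x - ρ) * eval (synthetic ρ p) x)
      ≈⟨ solve 5 (λ a x p ρ s → a :+ x :* (p :+ (x :- ρ) :* s)
           := (a :+ ρ :* p) :+ (x :- ρ) :* (p :+ x :* s)) refl a x (eval p ρ) ρ (eval (synthetic ρ p) x) ⟩
    (a + ρ * eval p ρ) + (x - ρ) * (eval p ρ + x * eval (synthetic ρ p) x) ∎

  eval′-synthetic : ∀ ρ p x →
    eval′ p x ≈ eval (synthetic ρ p) x + (x - ρ) * eval′ (synthetic ρ p) x
  eval′-synthetic ρ []      x = sym (trans (+-identityˡ _) (zeroʳ _))
  eval′-synthetic ρ (a ∷ p) x = begin
    eval p x + x * eval′ p x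
      ≈⟨ +-cong (eval-synthetic ρ p x) (*-congˡ (eval′-synthetic ρ p x)) ⟩
    (eval p ρ + (x - ρ) * s) + x * (s + (x - ρ) * s′)
      ≈⟨ solve 5 (λ p x ρ s s′ → (p :+ (x :- ρ) :* s) :+ x :* (s :+ (x :- ρ) :* s′)
           := (p :+ x :* s) :+ (x :- ρ) :* (s :+ x :* s′)) refl (eval p ρ) x ρ s s′ ⟩
    (eval p ρ + x * s) + (x - ρ) * (s + x * s′) ∎
    where
    s = eval (synthetic ρ p) x
    s′ = eval′ (synthetic ρ p) x

  private
    synthetic-degreeBelow : ∀ {n} ρ p → DegreeBelow (suc n) p → DegreeBelow n (synthetic ρ p)
    synthetic-degreeBelow ρ [] d i n≤i = refl
    synthetic-degreeBelow ρ (a ∷ p) d zero ℕ.z≤n =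
      eval-zero p (λ i → d (suc i) (ℕ.s≤s ℕ.z≤n)) ρ
    synthetic-degreeBelow ρ (a ∷ p) d (suc i) ℕ.z≤n =
      synthetic-degreeBelow {zero} ρ p (λ j _ → d (suc j) (ℕ.s≤s ℕ.z≤n)) i ℕ.z≤n
    synthetic-degreeBelow ρ (a ∷ p) d (suc i) (ℕ.s≤s n≤i) =
      synthetic-degreeBelow ρ p (λ j n<j → d (suc j) (ℕ.s≤s n<j)) i n≤i

    synthetic-coeff : ∀ n ρ a p → DegreeBelow (suc n) p →
      coeff (synthetic ρ (a ∷ p)) n ≈ coeff p n
    synthetic-coeff zero    ρ a p d = trans (eval-drop p ρ)
      (trans (+-congˡ (trans (*-congˡ (eval-zero (drop 1 p) (λ i → trans (reflexive (coeff-drop p i))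
        (d (suc i) (ℕ.s≤s ℕ.z≤n))) ρ)) (zeroʳ ρ))) (+-identityʳ _))
    synthetic-coeff (suc n) ρ a []      d = refl
    synthetic-coeff (suc n) ρ a (b ∷ p) d = synthetic-coeff n ρ b p λ i n<i → d (suc i) (ℕ.s≤s n<i)

  synthetic-leadingTerm : ∀ {n} ρ p → HasLeadingTerm (suc n) p → HasLeadingTerm n (synthetic ρ p)
  synthetic-leadingTerm ρ []      (_ , l) = contradiction refl l
  synthetic-leadingTerm {n} ρ (a ∷ p) (d , l) = synthetic-degreeBelow ρ (a ∷ p) d ,
    λ e → l (trans (sym (synthetic-coeff n ρ a p (λ i n<i → d (suc i) (ℕ.s≤s n<i)))) e)

  linearProduct : List Carrier → Carrier → Carrier
  linearProduct []       x = 1#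
  linearProduct (ρ ∷ ρs) x = (x - ρ) * linearProduct ρs x

  -- The derivative of `linearProduct` by the product rule: the sum over the roots of the product
  -- with that one factor left out.
  linearProduct′ : List Carrier → Carrier → Carrier
  linearProduct′ []       x = 0#
  linearProduct′ (ρ ∷ ρs) x = linearProduct ρs x + (x - ρ) * linearProduct′ ρs x

  -- Roots are listed with multiplicity; the formula for the derivative makes repeated roots
  -- visible.
  record Splitting (n : ℕ) (p : Poly) : Set ℓ where
    field
      lead     : Carrier
      lead≉0   : ¬ (lead ≈ 0#)
      roots    : List Carrier
      length≡n : length roots ≡ n
      areRoots : All (λ ρ → eval p ρ ≈ 0#) roots
      eval-≈   : ∀ x → eval p x ≈ lead * linearProduct roots x
      eval′-≈  : ∀ x → eval′ p x ≈ lead * linearProduct′ roots x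

  splitting : AlgebraicallyClosed Ω → ∀ n p → HasLeadingTerm n p → Splitting n p
  splitting closed zero p (d , l) = record
    { lead = coeff p 0 ; lead≉0 = l ; roots = [] ; length≡n = ≡.refl ; areRoots = []
    ; eval-≈ = λ x → trans (constant p d x) (sym (*-identityʳ _))
    ; eval′-≈ = λ x → trans (constant′ p d x) (sym (zeroʳ _)) }
    where
    constant : ∀ p → DegreeBelow 1 p → ∀ x → eval p x ≈ coeff p 0
    constant []      d x = refl
    constant (a ∷ p) d x = trans (+-congˡ (trans (*-congˡ (eval-zero p (λ i → d (suc i) (ℕ.s≤s ℕ.z≤n)) x))
      (zeroʳ x))) (+-identityʳ a)
    constant′ : ∀ p → DegreeBelow 1 p → ∀ x → eval′ p x ≈ 0#
    constant′ []      d x = refl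
    constant′ (a ∷ p) d x = trans (+-cong (eval-zero p p≈0 x) (trans (*-congˡ (eval′-zero p p≈0 x)) (zeroʳ x)))
      (+-identityˡ 0#)
      where
      p≈0 : p ≈ₚ []
      p≈0 i = d (suc i) (ℕ.s≤s ℕ.z≤n)
  splitting closed (suc n) p lt@(d , l) with closed n p d l
  ... | ρ , pρ≈0 = record
    { lead = S.lead ; lead≉0 = S.lead≉0 ; roots = ρ ∷ S.roots
    ; length≡n = ≡.cong suc S.length≡n
    ; areRoots = pρ≈0 ∷ All.map (λ {x} e → trans (eval-factor x) (trans (*-congˡ e) (zeroʳ _))) S.areRoots
    ; eval-≈ = λ x → begin
        eval p x                                    ≈⟨ eval-factor x ⟩
        (x - ρ) * eval q x                          ≈⟨ *-congˡ (S.eval-≈ x) ⟩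
        (x - ρ) * (S.lead * linearProduct S.roots x) ≈⟨ solve 3 (λ y a z → y :* (a :* z) := a :* (y :* z)) refl _ _ _ ⟩
        S.lead * ((x - ρ) * linearProduct S.roots x) ∎
    ; eval′-≈ = λ x → begin
        eval′ p x                                   ≈⟨ eval′-synthetic ρ p x ⟩
        eval q x + (x - ρ) * eval′ q x              ≈⟨ +-cong (S.eval-≈ x) (*-congˡ (S.eval′-≈ x)) ⟩
        S.lead * linearProduct S.roots x + (x - ρ) * (S.lead * linearProduct′ S.roots x)
          ≈⟨ solve 4 (λ y a z z′ → a :* z :+ y :* (a :* z′) := a :* (z :+ y :* z′)) refl (x - ρ) S.lead _ _ ⟩
        S.lead * (linearProduct S.roots x + (x - ρ) * linearProduct′ S.roots x) ∎
    }
    where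
    q = synthetic ρ p
    module S = Splitting (splitting closed n q (synthetic-leadingTerm ρ p lt))
    eval-factor : ∀ x → eval p x ≈ (x - ρ) * eval q x
    eval-factor x = trans (eval-synthetic ρ p x) (trans (+-congʳ pρ≈0) (+-identityˡ _))

-- Comparison of elements by their values.

module ValuationOrder {ℓ} {Ω : Field ℓ} {Γ : OrderedAbelianGroup ℓ} (val : Valuation Ω Γ) where
  private module Γ = OrderedAbelianGroup Γ
  open Field Ω hiding (zero)
  open FieldProperties Ω
  open Values Γ
  open Valuation val
  open Sum semiring using (sum; sum-remove)

  infix 4 _≼_ _≺_ _≍_

  -- Inequalities of values are written between elements, so that sums and products are taken in the
  -- field. Larger means smaller in size: 0 is the greatest element.
  _≼_ _≺_ _≍_ : Carrier → Carrier → Set ℓ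
  x ≼ y = v x ≤⁺ v y
  x ≺ y = v x <⁺ v y
  x ≍ y = v x ≈⁺ v y

  ≼-refl : ∀ {x} → x ≼ x
  ≼-refl = ≤⁺-refl

  ≼-trans : ∀ {x y z} → x ≼ y → y ≼ z → x ≼ z
  ≼-trans = ≤⁺-trans

  ≍⇒≼ : ∀ {x y} → x ≍ y → x ≼ y
  ≍⇒≼ = ≤⁺-reflexive

  ≍-sym : ∀ {x y} → x ≍ y → y ≍ x
  ≍-sym = Eq.sym

  ≍-trans : ∀ {x y z} → x ≍ y → y ≍ z → x ≍ z
  ≍-trans = Eq.trans

  ≈⇒≍ : ∀ {x y} → x ≈ y → x ≍ y
  ≈⇒≍ = v-cong

  ≼-antisym : ∀ {x y} → x ≼ y → y ≼ x → x ≍ y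
  ≼-antisym = antisym

  ≺⇒≼ : ∀ {x y} → x ≺ y → x ≼ y
  ≺⇒≼ = proj₁

  ≺⇒⋡ : ∀ {x y} → x ≺ y → ¬ (y ≼ x)
  ≺⇒⋡ (x≼y , x≭y) y≼x = x≭y (antisym x≼y y≼x)

  ≼-or-≻ : ∀ x y → x ≼ y ⊎ y ≺ x
  ≼-or-≻ x y with v x ≤? v y | total (v x) (v y)
  ... | yes x≼y | _        = inj₁ x≼y
  ... | no  x⋠y | inj₁ x≼y = inj₁ x≼y
  ... | no  x⋠y | inj₂ y≼x = inj₂ (y≼x , λ e → x⋠y (≤⁺-reflexive (Eq.sym e)))

  ⋡⇒≺ : ∀ {x y} → ¬ (y ≼ x) → x ≺ y
  ⋡⇒≺ {x} {y} y⋠x = [ (λ y≼x → contradiction y≼x y⋠x) , (λ x≺y → x≺y) ]′ (≼-or-≻ y x)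

  ≺-≼-trans : ∀ {x y z} → x ≺ y → y ≼ z → x ≺ z
  ≺-≼-trans = <⁺-≤⁺-trans

  ≼-≺-trans : ∀ {x y z} → x ≼ y → y ≺ z → x ≺ z
  ≼-≺-trans x≼y y≺z = ⋡⇒≺ λ z≼x → ≺⇒⋡ y≺z (≼-trans z≼x x≼y)

  ≺-irrefl : ∀ {x} → ¬ (x ≺ x)
  ≺-irrefl x≺x = ≺⇒⋡ x≺x ≼-refl

  ≺-resp : ∀ {x x′ y y′} → x ≍ x′ → y ≍ y′ → x ≺ y → x′ ≺ y′
  ≺-resp e f x≺y = ≼-≺-trans (≍⇒≼ (≍-sym e)) (≺-≼-trans x≺y (≍⇒≼ f))

  ≼-resp : ∀ {x x′ y y′} → x ≍ x′ → y ≍ y′ → x ≼ y → x′ ≼ y′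
  ≼-resp e f x≼y = ≼-trans (≍⇒≼ (≍-sym e)) (≼-trans x≼y (≍⇒≼ f))

  0-maximal : ∀ x → x ≼ 0#
  0-maximal x = ≤⁺-respʳ (Eq.sym (Equivalence.from (v-∞ 0#) refl)) (v x ≤⊤⁺)

  0≼⇒≈0 : ∀ {x} → 0# ≼ x → x ≈ 0#
  0≼⇒≈0 {x} 0≼x = Equivalence.to (v-∞ x)
    (Eq.trans (antisym (0-maximal x) 0≼x) (Equivalence.from (v-∞ 0#) refl))

  ≺⇒≉0 : ∀ {x y} → x ≺ y → ¬ (x ≈ 0#)
  ≺⇒≉0 {x} {y} x≺y x≈0 = ≺⇒⋡ x≺y (≼-trans (0-maximal y) (≍⇒≼ (≈⇒≍ (sym x≈0))))

  ≉0⇒≺0 : ∀ {x} → ¬ (x ≈ 0#) → x ≺ 0#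
  ≉0⇒≺0 x≉0 = ⋡⇒≺ λ 0≼x → x≉0 (0≼⇒≈0 0≼x)

  ≉0-resp : ∀ {x y} → x ≍ y → ¬ (x ≈ 0#) → ¬ (y ≈ 0#)
  ≉0-resp x≍y x≉0 y≈0 = x≉0 (0≼⇒≈0 (≼-resp (≈⇒≍ y≈0) (≍-sym x≍y) ≼-refl))

  +-≼ : ∀ {x y z} → z ≼ x → z ≼ y → z ≼ x + y
  +-≼ {x} {y} z≼x z≼y = ≤⁺-trans (⊓-glb z≼x z≼y) (v-+ x y)

  +-≺ : ∀ {x y z} → z ≺ x → z ≺ y → z ≺ x + y
  +-≺ {x} {y} {z} z≺x z≺y with ≼-or-≻ x y
  ... | inj₁ x≼y = ≺-≼-trans z≺x (+-≼ ≼-refl x≼y)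
  ... | inj₂ y≺x = ≺-≼-trans z≺y (+-≼ (≺⇒≼ y≺x) ≼-refl)

  -‿≍ : ∀ x → - x ≍ x
  -‿≍ = v-neg

  -swap-≍ : ∀ x y → x - y ≍ y - x
  -swap-≍ x y = ≍-trans (≈⇒≍ (solve 2 (λ x y → x :- y := :- (y :- x)) refl x y)) (-‿≍ (y - x))

  minus-≼ : ∀ {x y z} → z ≼ x → z ≼ y → z ≼ x - y
  minus-≼ {y = y} z≼x z≼y = +-≼ z≼x (≼-trans z≼y (≍⇒≼ (≍-sym (-‿≍ y))))

  minus-≺ : ∀ {x y z} → z ≺ x → z ≺ y → z ≺ x - y
  minus-≺ {y = y} z≺x z≺y = +-≺ z≺x (≺-≼-trans z≺y (≍⇒≼ (≍-sym (-‿≍ y))))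

  -- If x + y had a value above v(x), so would x = (x + y) - y.
  +-dominant : ∀ {x y} → x ≺ y → x + y ≍ x
  +-dominant {x} {y} x≺y = antisym
    ([ (λ x+y≼x → x+y≼x)
     , (λ x≺x+y → contradiction (≺-resp (≈⇒≍ refl)
         (≈⇒≍ (solve 2 (λ x y → (x :+ y) :- y := x) refl x y)) (minus-≺ x≺x+y x≺y)) ≺-irrefl) ]′
     (≼-or-≻ (x + y) x))
    (+-≼ ≼-refl (≺⇒≼ x≺y))

  *-≼ : ∀ z {x y} → x ≼ y → z * x ≼ z * y
  *-≼ z {x} {y} x≼y =
    ≤⁺-respˡ (Eq.sym (v-* z x)) (≤⁺-respʳ (Eq.sym (v-* z y)) (mono (v z) x≼y))
    where
    mono : ∀ c {a b} → a ≤⁺ b → c +⁺ a ≤⁺ c +⁺ b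
    mono ⊤⁺    p         = ⊤⁺ ≤⊤⁺
    mono [ c ] (_ ≤⊤⁺)   = _ ≤⊤⁺
    mono [ c ] {[ a ]} {[ b ]} [ p ] = ≤⁺-respˡ [ Γ.comm a c ] (≤⁺-respʳ [ Γ.comm b c ] [ Γ.∙-monoˡ-≤ c p ])

  *-cong-≍ : ∀ {x x′ y y′} → x ≍ x′ → y ≍ y′ → x * y ≍ x′ * y′
  *-cong-≍ {x} {x′} {y} {y′} e f =
    Eq.trans (v-* x y) (Eq.trans (+⁺-cong e f) (Eq.sym (v-* x′ y′)))

  *-cancel-≼ : ∀ {z x y} → ¬ (z ≈ 0#) → z * x ≼ z * y → x ≼ y
  *-cancel-≼ {z} {x} {y} z≉0 zx≼zy with inverse z≉0
  ... | z⁻¹ , e = ≼-resp (≈⇒≍ (cancel x)) (≈⇒≍ (cancel y)) (*-≼ z⁻¹ zx≼zy)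
    where
    cancel : ∀ w → z⁻¹ * (z * w) ≈ w
    cancel w = trans (sym (*-assoc _ _ _)) (trans (*-congʳ (trans (*-comm _ _) e)) (*-identityˡ w))

  *-≺ : ∀ {z x y} → ¬ (z ≈ 0#) → x ≺ y → z * x ≺ z * y
  *-≺ z≉0 x≺y = ⋡⇒≺ λ zy≼zx → ≺⇒⋡ x≺y (*-cancel-≼ z≉0 zy≼zx)

  *-cancel-≍ : ∀ {z x y} → ¬ (z ≈ 0#) → z * x ≍ z * y → x ≍ y
  *-cancel-≍ z≉0 e = antisym (*-cancel-≼ z≉0 (≍⇒≼ e)) (*-cancel-≼ z≉0 (≍⇒≼ (≍-sym e)))

  sum-≼ : ∀ {n z} (t : Fin n → Carrier) → (∀ i → z ≼ t i) → z ≼ sum t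
  sum-≼ {zero}  t z≼ = 0-maximal _
  sum-≼ {suc n} t z≼ = +-≼ (z≼ zero) (sum-≼ (λ i → t (suc i)) (λ i → z≼ (suc i)))

  sum-≺ : ∀ {n z} (t : Fin n → Carrier) → ¬ (z ≈ 0#) → (∀ i → z ≺ t i) → z ≺ sum t
  sum-≺ {zero}  t z≉0 z≺ = ≉0⇒≺0 z≉0
  sum-≺ {suc n} t z≉0 z≺ = +-≺ (z≺ zero) (sum-≺ (λ i → t (suc i)) z≉0 (λ i → z≺ (suc i)))

  minimum : ∀ {n} (t : Fin (suc n) → Carrier) → ∃ λ k → ∀ i → t k ≼ t i
  minimum {zero}  t = zero , λ { zero → ≼-refl }
  minimum {suc n} t with minimum (λ i → t (suc i))
  ... | k , k-min with ≼-or-≻ (t zero) (t (suc k))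
  ...   | inj₁ p = zero  , λ { zero → ≼-refl ; (suc i) → ≼-trans p (k-min i) }
  ...   | inj₂ p = suc k , λ { zero → ≺⇒≼ p ; (suc i) → k-min i }

  -- A nonzero term of uniquely least value would determine the value of the whole sum.
  vanishing-sum : ∀ {n} (t : Fin n → Carrier) → sum t ≈ 0# → ∀ i → ¬ (t i ≈ 0#) →
    ∃ λ j → ∃ λ k → j ≢ k × ¬ (t j ≈ 0#) × t j ≍ t k
  vanishing-sum {suc n} t sum≈0 i tᵢ≉0 with minimum t
  ... | k , k-min with Fin.any? (λ j → ¬? (k Fin.≟ j) ×-dec (v (t k) ≟ v (t j)))
  ...   | yes (j , k≢j , tk≍tj) = k , j , k≢j , tk≉0 , tk≍tj
    where
    tk≉0 : ¬ (t k ≈ 0#)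
    tk≉0 e = tᵢ≉0 (0≼⇒≈0 (≼-resp (≈⇒≍ e) (≈⇒≍ refl) (k-min i)))
  ...   | no unique = contradiction (trans (sym (sum-remove {i = k} t)) sum≈0)
            (≉0-resp (≍-sym (+-dominant (sum-≺ (removeAt t k) tk≉0 above))) tk≉0)
    where
    tk≉0 : ¬ (t k ≈ 0#)
    tk≉0 e = tᵢ≉0 (0≼⇒≈0 (≼-resp (≈⇒≍ e) (≈⇒≍ refl) (k-min i)))
    above : ∀ j → t k ≺ t (punchIn k j)
    above j = k-min _ , λ e → unique (punchIn k j , (λ k≡ → Fin.punchInᵢ≢i k j (≡.sym k≡)) , e)

-- Uniqueness of extension: conjugate elements have equal values.

infixr 9 _∘ᵣ_
_∘ᵣ_ : ∀ {ℓ} {F E E′ : Field ℓ} → E ⟶ E′ → F ⟶ E → F ⟶ E′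
_∘ᵣ_ {E′ = E′} ψ φ = record
  { ⟦_⟧ = λ a → _⟶_.⟦ ψ ⟧ (_⟶_.⟦ φ ⟧ a)
  ; isRingHomomorphism = Composition.isRingHomomorphism (Field.trans E′)
      (_⟶_.isRingHomomorphism φ) (_⟶_.isRingHomomorphism ψ)
  }

length-degreeBelow : ∀ {ℓ} (F : Field ℓ) p → Polynomial.DegreeBelow F (length p) p
length-degreeBelow F []      i       _           = Field.refl F
length-degreeBelow F (a ∷ p) (suc i) (ℕ.s≤s l) = length-degreeBelow F p i l

module _ {ℓ} {F E : Field ℓ} (φ : F ⟶ E) where
  open Field E hiding (zero)
  open Exp semiring using (_^_)
  open _⟶_ φ

  ⟦^⟧ : ∀ x n → ⟦ Exp._^_ (Field.semiring F) x n ⟧ ≈ ⟦ x ⟧ ^ n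
  ⟦^⟧ x zero    = 1#-homo
  ⟦^⟧ x (suc n) = trans (*-homo x _) (*-congˡ (⟦^⟧ x n))

module HenselianClosure
  {ℓ} (em : ExcludedMiddle ℓ) {K : Field ℓ} {Γ : OrderedAbelianGroup ℓ} {v : Valuation K Γ}
  (henselian : Henselian v) (C : ValuedClosure v) where

  open ValuedClosure C using (K̄; ι; algebraic; algebraicallyClosed; Γ̄; valuation; extends)
  private module ι where
    open _⟶_ ι public
    open Evaluation ι public
  open Field K̄ hiding (zero)
  open FieldProperties K̄
  open ValuationOrder valuation
  open Sum semiring using (sum)
  open Exp semiring using (_^_; ^-homo-*)
  open SetoidReasoning setoid

  ^-≉0 : ∀ {x} → ¬ (x ≈ 0#) → ∀ n → ¬ (x ^ n ≈ 0#)
  ^-≉0 x≉0 zero    = 1≉0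
  ^-≉0 x≉0 (suc n) = λ e → ^-≉0 x≉0 n (*-cancelˡ-0 x≉0 e)

  ^-mono-≼ : ∀ {x y} → x ≼ y → ∀ n → x ^ n ≼ y ^ n
  ^-mono-≼ x≼y zero = ≼-refl
  ^-mono-≼ {x} {y} x≼y (suc n) = ≼-trans (*-≼ x (^-mono-≼ x≼y n))
    (≼-resp (≈⇒≍ (*-comm _ _)) (≈⇒≍ (*-comm _ _)) (*-≼ (y ^ n) x≼y))

  ^-mono-≺ : ∀ {x y} → ¬ (y ≈ 0#) → x ≺ y → ∀ n → x ^ suc n ≺ y ^ suc n
  ^-mono-≺ {x} {y} y≉0 x≺y n = ≼-≺-trans (*-≼ x (^-mono-≼ (≺⇒≼ x≺y) n))
    (≺-resp (≈⇒≍ (*-comm _ _)) (≈⇒≍ (*-comm _ _)) (*-≺ (^-≉0 y≉0 n) x≺y))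

  -- The value group is totally ordered, hence torsion-free.
  ^-cancel-≍ : ∀ {x y} → ¬ (x ≈ 0#) → ¬ (y ≈ 0#) → ∀ n → x ^ suc n ≍ y ^ suc n → x ≍ y
  ^-cancel-≍ {x} {y} x≉0 y≉0 n e with ≼-or-≻ x y | ≼-or-≻ y x
  ... | inj₂ y≺x | _        = contradiction (≺-resp (≈⇒≍ refl) e (^-mono-≺ x≉0 y≺x n)) ≺-irrefl
  ... | _        | inj₂ x≺y = contradiction (≺-resp e (≈⇒≍ refl) (^-mono-≺ y≉0 x≺y n)) ≺-irrefl
  ... | inj₁ x≼y | inj₁ y≼x = ≼-antisym x≼y y≼x

  -- In an algebraic equation for x two terms share the least value; comparing them puts a positive
  -- multiple of v(x) into vK.
  value-relation : ∀ {x} → ¬ (x ≈ 0#) → ∃ λ j → ∃ λ k → ∃ λ a → ∃ λ b → j ℕ.< k ×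
    ¬ (ι.⟦ a ⟧ ≈ 0#) × ¬ (ι.⟦ b ⟧ ≈ 0#) × ι.⟦ a ⟧ * x ^ j ≍ ι.⟦ b ⟧ * x ^ k
  value-relation {x} x≉0 with algebraic x
  ... | p , p≉0 , px≈0 with PolynomialProperties.zero-or-leadingTerm K p
  ...   | inj₁ p≈0 = contradiction p≈0 p≉0
  ...   | inj₂ (i , l) = go (vanishing-sum t sum≈0 i′ tᵢ≉0)
    where
    open PolynomialProperties K using (coeff; leadingTerm-<)
    t : Fin (length p) → Carrier
    t k = ι.⟦ coeff p (toℕ k) ⟧ * x ^ toℕ k
    sum≈0 : sum t ≈ 0#
    sum≈0 = trans (sym (LinearCombinations.eval-powers ι (length p) p x (length-degreeBelow K p))) px≈0
    i<length : i ℕ.< length p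
    i<length = leadingTerm-< {p = p} (length-degreeBelow K p) l
    i′ : Fin (length p)
    i′ = Fin.fromℕ< i<length
    tᵢ≉0 : ¬ (t i′ ≈ 0#)
    tᵢ≉0 e = ^-≉0 x≉0 (toℕ i′) (*-cancelˡ-0 (λ c≈0 → proj₂ l (ι.⟦⟧-injective
      (trans (reflexive (≡.cong (λ k → ι.⟦ coeff p k ⟧) (≡.sym (Fin.toℕ-fromℕ< i<length)))) c≈0))) e)
    coeff≉0 : ∀ k → ¬ (t k ≈ 0#) → ¬ (ι.⟦ coeff p (toℕ k) ⟧ ≈ 0#)
    coeff≉0 k tₖ≉0 c≈0 = tₖ≉0 (trans (*-congʳ c≈0) (zeroˡ _))
    go : (∃ λ j → ∃ λ k → j ≢ k × ¬ (t j ≈ 0#) × t j ≍ t k) → _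
    go (j , k , j≢k , tⱼ≉0 , e) with ℕ.<-cmp (toℕ j) (toℕ k)
    ... | tri< j<k _ _ = toℕ j , toℕ k , _ , _ , j<k , coeff≉0 j tⱼ≉0 , coeff≉0 k (≉0-resp e tⱼ≉0) , e
    ... | tri≈ _ j≡k _ = contradiction (Fin.toℕ-injective j≡k) j≢k
    ... | tri> _ _ k<j = toℕ k , toℕ j , _ , _ , k<j , coeff≉0 k (≉0-resp e tⱼ≉0) , coeff≉0 j tⱼ≉0 , ≍-sym e

  module _ (L : Field ℓ) (κ : K ⟶ L) (i τ : L ⟶ K̄)
           (iκ≈ι : ∀ a → _⟶_.⟦ i ⟧ (_⟶_.⟦ κ ⟧ a) ≈ ι.⟦ a ⟧)
           (τκ≈ι : ∀ a → _⟶_.⟦ τ ⟧ (_⟶_.⟦ κ ⟧ a) ≈ ι.⟦ a ⟧) where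
    private
      module L where
        open Field L public
        open Exp (Field.semiring L) public
      module κ = _⟶_ κ
      module i where
        open _⟶_ i public
        open Evaluation i public
      module τ where
        open _⟶_ τ public
        open Evaluation τ public

      extends-by : (σ : L ⟶ K̄) → (∀ a → _⟶_.⟦ σ ⟧ (κ.⟦ a ⟧) ≈ ι.⟦ a ⟧) → Extends v κ (restrict σ valuation)
      extends-by σ σκ≈ι a b = mk⇔
        (λ p → ≼-resp (≈⇒≍ (sym (σκ≈ι a))) (≈⇒≍ (sym (σκ≈ι b))) (Equivalence.to (extends a b) p))
        (λ p → Equivalence.from (extends a b) (≼-resp (≈⇒≍ (σκ≈ι a)) (≈⇒≍ (σκ≈ι b)) p))

      κ-algebraic : Extension.Algebraic κ
      κ-algebraic x with algebraic i.⟦ x ⟧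
      ... | p , p≉0 , e = p , p≉0 , i.⟦⟧-injective (trans (⟦eval⟧ κ i ι iκ≈ι p x) e)

      i≼⇒τ≼ : ∀ x y → i.⟦ x ⟧ ≼ i.⟦ y ⟧ → τ.⟦ x ⟧ ≼ τ.⟦ y ⟧
      i≼⇒τ≼ x y = Equivalence.to (henselian L κ κ-algebraic Γ̄ Γ̄ (restrict i valuation) (restrict τ valuation)
        (extends-by i iκ≈ι) (extends-by τ τκ≈ι) x y)

      ⟦term⟧ : ∀ (σ : L ⟶ K̄) → (∀ a → _⟶_.⟦ σ ⟧ (κ.⟦ a ⟧) ≈ ι.⟦ a ⟧) → ∀ a x n →
        _⟶_.⟦ σ ⟧ (κ.⟦ a ⟧ L.* x L.^ n) ≈ ι.⟦ a ⟧ * _⟶_.⟦ σ ⟧ x ^ n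
      ⟦term⟧ σ σκ≈ι a x n = trans (_⟶_.*-homo σ _ _) (*-cong (σκ≈ι a) (⟦^⟧ σ x n))

      split-power : ∀ y {j k} → j ℕ.< k → ∃ λ d → ∀ b → b * y ^ k ≈ y ^ j * (b * y ^ suc d)
      split-power y {j} {k} j<k = k ℕ.∸ suc j , λ b → begin
        b * y ^ k                        ≡⟨ ≡.cong (λ m → b * y ^ m) k≡ ⟩
        b * y ^ (j ℕ.+ suc d)            ≈⟨ *-congˡ (^-homo-* y j (suc d)) ⟩
        b * (y ^ j * y ^ suc d)          ≈⟨ solve 3 (λ b p q → b :* (p :* q) := p :* (b :* q)) refl b (y ^ j) (y ^ suc d) ⟩
        y ^ j * (b * y ^ suc d)          ∎
        where
        d = k ℕ.∸ suc j
        k≡ : k ≡ j ℕ.+ suc d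
        k≡ = ≡.trans (≡.sym (ℕ.m+[n∸m]≡n j<k)) (≡.sym (ℕ.+-suc j d))

    -- The two valuations of L are equivalent. They agree on K, and some power
    -- of x has the value of an element of K, so they agree on x.
    embeddings-≍ : ∀ x → i.⟦ x ⟧ ≍ τ.⟦ x ⟧
    embeddings-≍ x with zero? i.⟦ x ⟧
    ... | inj₁ ix≈0 = ≈⇒≍ (trans ix≈0 (sym (trans (τ.⟦⟧-cong (i.⟦⟧-injective ix≈0)) τ.0#-homo)))
    ... | inj₂ ix≉0 with value-relation ix≉0
    ...   | j , k , a , b , j<k , a≉0 , b≉0 , e = ^-cancel-≍ ix≉0 τx≉0 (k ℕ.∸ suc j) (*-cancel-≍ b≉0
            (≍-trans (≍-sym (cancel i.⟦ x ⟧ ix≉0 e)) (cancel τ.⟦ x ⟧ τx≉0 e′)))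
      where
      τx≉0 : ¬ (τ.⟦ x ⟧ ≈ 0#)
      τx≉0 τx≈0 = ix≉0 (trans (i.⟦⟧-cong (τ.⟦⟧-injective τx≈0)) i.0#-homo)
      term : L.Carrier × L.Carrier
      term = κ.⟦ a ⟧ L.* x L.^ j , κ.⟦ b ⟧ L.* x L.^ k
      ie : i.⟦ proj₁ term ⟧ ≍ i.⟦ proj₂ term ⟧
      ie = ≍-trans (≈⇒≍ (⟦term⟧ i iκ≈ι a x j)) (≍-trans e (≈⇒≍ (sym (⟦term⟧ i iκ≈ι b x k))))
      e′ : ι.⟦ a ⟧ * τ.⟦ x ⟧ ^ j ≍ ι.⟦ b ⟧ * τ.⟦ x ⟧ ^ k
      e′ = ≍-trans (≈⇒≍ (sym (⟦term⟧ τ τκ≈ι a x j))) (≍-trans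
        (≼-antisym (i≼⇒τ≼ _ _ (≍⇒≼ ie)) (i≼⇒τ≼ _ _ (≍⇒≼ (≍-sym ie))))
        (≈⇒≍ (⟦term⟧ τ τκ≈ι b x k)))
      cancel : ∀ y → ¬ (y ≈ 0#) → ι.⟦ a ⟧ * y ^ j ≍ ι.⟦ b ⟧ * y ^ k →
        ι.⟦ a ⟧ ≍ ι.⟦ b ⟧ * y ^ suc (k ℕ.∸ suc j)
      cancel y y≉0 f = *-cancel-≍ (^-≉0 y≉0 j) (≍-trans (≈⇒≍ (*-comm _ _))
        (≍-trans f (≈⇒≍ (proj₂ (split-power y j<k) ι.⟦ b ⟧))))

  -- Conjugation relative to a field F between K and K̄. The map κ stays in view because `Henselian`
  -- speaks of extensions of K.
  module Over {F : Field ℓ} (κ : K ⟶ F) (φ : F ⟶ K̄)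
              (φκ≈ι : ∀ a → _⟶_.⟦ φ ⟧ (_⟶_.⟦ κ ⟧ a) ≈ ι.⟦ a ⟧) where
    private
      module F = Field F
      module κ = _⟶_ κ
    open _⟶_ φ
    open Evaluation φ
    open PolynomialProperties F

    algebraic-over : Extension.Algebraic φ
    algebraic-over x with algebraic x
    ... | p , p≉0 , e = map κ.⟦_⟧ p
        , (λ κp≈0 → p≉0 λ i → Evaluation.⟦⟧-injective κ (F.trans (F.sym (Evaluation.coeff-map κ p i)) (κp≈0 i)))
        , trans (eval-map κ φ ι φκ≈ι p x) e

    open AlgebraicExtension φ algebraic-over public
    open LinearCombinations φ using (MinimalOfDegree; minimalPolynomial; eval-powers)
    open IntermediateField using (toField; base; inclusion)

    minimal-vanishes : ∀ {n q c c′} → MinimalOfDegree n q c → eval q c′ ≈ 0# →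
      ∀ g → eval g c ≈ 0# → eval g c′ ≈ 0#
    minimal-vanishes {n} {q} {c} {c′} (monic , qc≈0 , minimal) qc′≈0 g gc≈0 =
      trans (R.eval-≈ c′ qc′≈0) (eval-zero R.remainder
        (minimal R.remainder R.degreeBelow (trans (sym (R.eval-≈ c qc≈0)) gc≈0)) c′)
      where module R = Remainder (remainderBy {q = q} monic g)

    minimal-determines : ∀ {n q c c′} → MinimalOfDegree n q c → eval q c′ ≈ 0# →
      ∀ g h → eval g c ≈ eval h c → eval g c′ ≈ eval h c′
    minimal-determines {q = q} {c} {c′} min qc′≈0 g h e = x-y≈0⇒x≈y (trans (sym (eval-minus c′))
      (minimal-vanishes {q = q} min qc′≈0 (g +ₚ (-ₚ h)) (trans (eval-minus c) (x≈y⇒x-y≈0 e))))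
      where
      eval-minus : ∀ x → eval (g +ₚ (-ₚ h)) x ≈ eval g x - eval h x
      eval-minus x = trans (eval-+ₚ g (-ₚ h) x) (+-congˡ (eval--ₚ h x))

    -- The embedding c ↦ c′, evaluating at c′ the polynomial stored with each member; by minimality
    -- of q the result does not depend on that polynomial.
    conjugation : ∀ {n q c c′} → MinimalOfDegree n q c → eval q c′ ≈ 0# → toField F[ c ] ⟶ K̄
    conjugation {q = q} {c} {c′} min qc′≈0 = record
      { ⟦_⟧ = λ (_ , g , _) → eval g c′
      ; isRingHomomorphism = record
        { isSemiringHomomorphism = record
          { isNearSemiringHomomorphism = record
            { +-isMonoidHomomorphism = record
              { isMagmaHomomorphism = record
                { isRelHomomorphism = record
                  { cong = λ { {_ , g , gc≈x} {_ , h , hc≈y} x≈y →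
                      minimal-determines {q = q} min qc′≈0 g h (trans gc≈x (trans x≈y (sym hc≈y))) } }
                ; homo = λ { (_ , g , _) (_ , h , _) → eval-+ₚ g h c′ }
                }
              ; ε-homo = trans (eval-constant F.0# c′) 0#-homo
              }
            ; *-homo = λ { (_ , g , _) (_ , h , _) → eval-*ₚ g h c′ }
            }
          ; 1#-homo = eval-1ₚ c′
          }
        ; -‿homo = λ { (_ , g , _) → eval--ₚ g c′ }
        }
      }

    conjugate-≍ : ∀ {n q c c′} → MinimalOfDegree n q c → eval q c′ ≈ 0# →
      ∀ g → eval g c ≍ eval g c′
    conjugate-≍ {q = q} {c} {c′} min qc′≈0 g =
      embeddings-≍ (toField F[ c ]) (base F[ c ] ∘ᵣ κ) (inclusion F[ c ]) (conjugation {q = q} min qc′≈0)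
        φκ≈ι (λ a → trans (eval-constant κ.⟦ a ⟧ c′) (φκ≈ι a)) (eval g c , g , refl)

    private
      -- A simple root of f is a simple root of the minimal polynomial q over F, and c outside F
      -- makes q nonlinear; hence the roots of q are not all equal to c.
      moved-conjugate-by : ∀ {n q c} → MinimalOfDegree n q c → ∀ f →
        eval f c ≈ 0# → ¬ (eval′ f c ≈ 0#) → (∀ a → ¬ (⟦ a ⟧ ≈ c)) →
        ∃ λ c′ → ¬ (c′ ≈ c) × ∀ g → eval g c ≍ eval g c′
      moved-conjugate-by {n} {q} {c} min@((q-lead , q-below) , qc≈0 , minimal) f fc≈0 f′c≉0 c∉F =
        conclude (search S.areRoots)
        where
        module Ω where
          open PolynomialProperties K̄ public
          open Evaluation (identity K̄) public
          open Factorisation K̄ public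
        q̄ : Ω.Poly
        q̄ = map ⟦_⟧ q
        module S = Ω.Splitting (Ω.splitting algebraicallyClosed n q̄
          (map-leadingTerm {p = q} (q-below , λ e → F.1≉0 (F.trans (F.sym q-lead) e))))
        eval-q : ∀ x → eval q x ≈ Ω.eval q̄ x
        eval-q x = sym (eval-map φ (identity K̄) φ (λ _ → refl) q x)

        search : ∀ {ρs} → All (λ ρ → Ω.eval q̄ ρ ≈ 0#) ρs →
          All (_≈ c) ρs ⊎ ∃ λ ρ → ¬ (ρ ≈ c) × Ω.eval q̄ ρ ≈ 0#
        search []       = inj₁ []
        search (_∷_ {ρ} e es) with zero? (ρ - c) | search es
        ... | inj₂ ρ-c≉0 | _       = inj₂ (ρ , (λ ρ≈c → ρ-c≉0 (x≈y⇒x-y≈0 ρ≈c)) , e)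
        ... | inj₁ _     | inj₂ r  = inj₂ r
        ... | inj₁ ρ-c≈0 | inj₁ cs = inj₁ (x-y≈0⇒x≈y ρ-c≈0 ∷ cs)

        -- The remainder of f modulo q vanishes, so a double root of q would be a double root of f.
        q′c≉0 : ¬ (eval′ q c ≈ 0#)
        q′c≉0 q′c≈0 = f′c≉0 (trans (R.eval′-≈ c qc≈0 q′c≈0) (eval′-zero R.remainder
          (minimal R.remainder R.degreeBelow (trans (sym (R.eval-≈ c qc≈0)) fc≈0)) c))
          where module R = Remainder (remainderBy {q = q} (q-lead , q-below) f)

        c∈F : n ≡ 1 → ∃ λ a → ⟦ a ⟧ ≈ c
        c∈F ≡.refl = F.- coeff q 0 , (begin
          ⟦ F.- coeff q 0 ⟧     ≈⟨ -‿homo _ ⟩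
          - ⟦ coeff q 0 ⟧       ≈⟨ +-identityʳ _ ⟨
          - ⟦ coeff q 0 ⟧ + 0#  ≈⟨ +-congˡ qc≈0 ⟨
          - ⟦ coeff q 0 ⟧ + eval q c
            ≈⟨ +-congˡ (eval-powers 2 q c q-below) ⟩
          - ⟦ coeff q 0 ⟧ + (⟦ coeff q 0 ⟧ * 1# + (⟦ coeff q 1 ⟧ * (c * 1#) + 0#))
            ≈⟨ solve 3 (λ a b c → :- a :+ (a :* con (ℤ.+ 1) :+ (b :* (c :* con (ℤ.+ 1)) :+ con (ℤ.+ 0))) := b :* c)
                 refl ⟦ coeff q 0 ⟧ ⟦ coeff q 1 ⟧ c ⟩
          ⟦ coeff q 1 ⟧ * c     ≈⟨ *-congʳ (trans (⟦⟧-cong q-lead) 1#-homo) ⟩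
          1# * c                ≈⟨ *-identityˡ c ⟩
          c                     ∎)

        -- The list is generalised to permit case analysis: no root makes q a nonzero constant, one
        -- root makes q linear, and two roots equal to c make q′(c) vanish.
        all-c-impossible : ∀ ρs → ρs ≡ S.roots → ¬ All (_≈ c) ρs
        all-c-impossible [] e _ = S.lead≉0 (trans (sym (*-identityʳ _)) (trans
          (reflexive (≡.cong (λ ρs → S.lead * Ω.linearProduct ρs c) e))
          (trans (sym (S.eval-≈ c)) (trans (sym (eval-q c)) qc≈0))))
        all-c-impossible (ρ ∷ []) e _ with c∈F (≡.trans (≡.sym S.length≡n) (≡.cong length (≡.sym e)))
        ... | a , a≈c = c∉F a a≈c
        all-c-impossible (ρ₁ ∷ ρ₂ ∷ ρs) e (ρ₁≈c ∷ ρ₂≈c ∷ _) = q′c≉0 (begin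
          eval′ q c                                   ≈⟨ eval′-map φ (identity K̄) φ (λ _ → refl) q c ⟨
          Ω.eval′ q̄ c                                 ≈⟨ S.eval′-≈ c ⟩
          S.lead * Ω.linearProduct′ S.roots c         ≡⟨ ≡.cong (λ ρs → S.lead * Ω.linearProduct′ ρs c) e ⟨
          S.lead * ((c - ρ₂) * P + (c - ρ₁) * Q)
            ≈⟨ *-congˡ (+-cong (*-congʳ (x≈y⇒x-y≈0 (sym ρ₂≈c))) (*-congʳ (x≈y⇒x-y≈0 (sym ρ₁≈c)))) ⟩
          S.lead * (0# * P + 0# * Q)
            ≈⟨ trans (*-congˡ (trans (+-cong (zeroˡ P) (zeroˡ Q)) (+-identityˡ 0#))) (zeroʳ _) ⟩
          0# ∎)
          where
          P = Ω.linearProduct ρs c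
          Q = Ω.linearProduct′ (ρ₂ ∷ ρs) c

        conclude : (All (_≈ c) S.roots ⊎ ∃ λ ρ → ¬ (ρ ≈ c) × Ω.eval q̄ ρ ≈ 0#) →
          ∃ λ c′ → ¬ (c′ ≈ c) × ∀ g → eval g c ≍ eval g c′
        conclude (inj₁ all-c) = contradiction all-c (all-c-impossible S.roots ≡.refl)
        conclude (inj₂ (c′ , c′≉c , q̄c′≈0)) = c′ , c′≉c ,
          conjugate-≍ {q = q} min (trans (eval-q c′) q̄c′≈0)

    moved-conjugate : ∀ f {c} → eval f c ≈ 0# → ¬ (eval′ f c ≈ 0#) → (∀ a → ¬ (⟦ a ⟧ ≈ c)) →
      ∃ λ c′ → ¬ (c′ ≈ c) × ∀ g → eval g c ≍ eval g c′
    moved-conjugate f {c} =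
      let n , q , min = minimalPolynomial em c (algebraic-over c) in moved-conjugate-by {q = q} min f

-- Roots in a residue class, and Hensel's lemma.

module RootsNear {ℓ} {Ω : Field ℓ} {Γ : OrderedAbelianGroup ℓ} (val : Valuation Ω Γ) where
  open Field Ω hiding (zero)
  open FieldProperties Ω
  open PolynomialProperties Ω
  open Evaluation (identity Ω)
  open Factorisation Ω
  open Values Γ using (module Eq)
  open Valuation val using (v-1)
  open ValuationOrder val
  open ResidueField val using (Integral; _∼_; int-0; int-+; int-*; int-neg; reflexive-∼; ∼-sym; ∼-trans; ∼-+; ∼-*)

  integral⇒1≼ : ∀ {x} → Integral x → 1# ≼ x
  integral⇒1≼ = Values.≤⁺-respˡ Γ (Eq.sym v-1)

  1≼⇒integral : ∀ {x} → 1# ≼ x → Integral x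
  1≼⇒integral = Values.≤⁺-respˡ Γ v-1

  ∼⇒1≺ : ∀ {x y} → x ∼ y → 1# ≺ x - y
  ∼⇒1≺ (p , ne) = integral⇒1≼ p , λ e → ne (Eq.trans (Eq.sym v-1) e)

  1≺⇒∼ : ∀ {x y} → 1# ≺ x - y → x ∼ y
  1≺⇒∼ (p , ne) = 1≼⇒integral p , λ e → ne (Eq.trans v-1 e)

  ∼-integral : ∀ {x y} → Integral x → x ∼ y → Integral y
  ∼-integral {x} {y} ix (p , _) = Values.≤⁺-respʳ Γ
    (≈⇒≍ (solve 2 (λ x y → x :- (x :- y) := y) refl x y)) (int-+ ix (int-neg p))

  ≁0⇒≍1 : ∀ {x} → Integral x → ¬ (x ∼ 0#) → x ≍ 1#
  ≁0⇒≍1 {x} ix x≁0 = ≼-antisym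
    ([ (λ x≼1 → x≼1) , (λ 1≺x → contradiction (1≺⇒∼ (≺-resp (≈⇒≍ refl)
        (≈⇒≍ (sym (trans (+-congˡ -0#≈0#) (+-identityʳ x)))) 1≺x)) x≁0) ]′ (≼-or-≻ x 1#))
    (integral⇒1≼ ix)

  ≍1⇒integral : ∀ {x} → x ≍ 1# → Integral x
  ≍1⇒integral e = 1≼⇒integral (≍⇒≼ (≍-sym e))

  ∼≍1⇒≍1 : ∀ {x y} → x ∼ y → y ≍ 1# → x ≍ 1#
  ∼≍1⇒≍1 {x} {y} x∼y y≍1 = ≍-trans (≈⇒≍ (solve 2 (λ x y → x := y :+ (x :- y)) refl x y))
    (≍-trans (+-dominant (≺-resp (≍-sym y≍1) (≈⇒≍ refl) (∼⇒1≺ x∼y))) y≍1)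

  eval-integral : ∀ {p x} → All Integral p → Integral x → Integral (eval p x)
  eval-integral []       ix = int-0
  eval-integral (a ∷ is) ix = int-+ a (int-* ix (eval-integral is ix))

  eval-∼ : ∀ {p x y} → All Integral p → Integral x → Integral y → x ∼ y → eval p x ∼ eval p y
  eval-∼ []       ix iy e = reflexive-∼ refl
  eval-∼ (a ∷ is) ix iy e = ∼-+ (reflexive-∼ refl) (∼-* iy (eval-integral is ix) e (eval-∼ is ix iy e))

  eval′-integral : ∀ {p x} → All Integral p → Integral x → Integral (eval′ p x)
  eval′-integral []       ix = int-0
  eval′-integral (a ∷ is) ix = int-+ (eval-integral is ix) (int-* ix (eval′-integral is ix))

  eval′-∼ : ∀ {p x y} → All Integral p → Integral x → Integral y → x ∼ y → eval′ p x ∼ eval′ p y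
  eval′-∼ []       ix iy e = reflexive-∼ refl
  eval′-∼ (a ∷ is) ix iy e =
    ∼-+ (eval-∼ is ix iy e) (∼-* iy (eval′-integral is ix) e (eval′-∼ is ix iy e))

  synthetic-integral : ∀ {ρ p} → All Integral p → Integral ρ → All Integral (synthetic ρ p)
  synthetic-integral []       iρ = []
  synthetic-integral (a ∷ is) iρ = eval-integral is iρ ∷ synthetic-integral is iρ

  -- With p(X) = (X - c) s(X) one has s(c) = p′(c). A second root c′ gives s(c′) = 0, and c ∼ c′
  -- carries this back to s(c) ∼ 0.
  simple-root-unique : ∀ {p c c′} → All Integral p → Integral c → c ∼ c′ →
    eval p c ≈ 0# → eval p c′ ≈ 0# → ¬ (eval′ p c ∼ 0#) → c′ ≈ c
  simple-root-unique {p} {c} {c′} ip ic c∼c′ pc≈0 pc′≈0 p′c≁0 with zero? (c′ - c)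
  ... | inj₁ e = x-y≈0⇒x≈y e
  ... | inj₂ c′-c≉0 = contradiction
        (∼-trans (reflexive-∼ p′c≈) (∼-trans (eval-∼ (synthetic-integral ip ic) ic (∼-integral ic c∼c′) c∼c′)
          (reflexive-∼ sc′≈0)))
        p′c≁0
    where
    s = synthetic c p
    p′c≈ : eval′ p c ≈ eval s c
    p′c≈ = trans (eval′-synthetic c p c)
      (trans (+-congˡ (trans (*-congʳ (-‿inverseʳ c)) (zeroˡ _))) (+-identityʳ _))
    sc′≈0 : eval s c′ ≈ 0#
    sc′≈0 = *-cancelˡ-0 c′-c≉0 (trans (sym (trans (eval-synthetic c p c′)
      (trans (+-congʳ pc≈0) (+-identityˡ _)))) pc′≈0)

  -- Every v(y - ρ) is at most 0, so leaving out one factor cannot lower the value of the product.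
  far-linearProduct : ∀ {y ρs} → All (λ ρ → ¬ (ρ ∼ y)) ρs → linearProduct ρs y ≼ linearProduct′ ρs y
  far-linearProduct []       = 0-maximal 1#
  far-linearProduct {y} {ρ ∷ ρs} (ρ≁y ∷ far) = +-≼
    (≼-resp (≈⇒≍ (*-comm _ _)) (≈⇒≍ (*-identityʳ _)) (*-≼ (linearProduct ρs y) y-ρ≼1))
    (*-≼ (y - ρ) (far-linearProduct far))
    where
    y-ρ≼1 : y - ρ ≼ 1#
    y-ρ≼1 = [ (λ p → p) , (λ p → contradiction (∼-sym (1≺⇒∼ p)) ρ≁y) ]′ (≼-or-≻ (y - ρ) 1#)

  -- p′/p is the sum of the 1 / (X - ρ) over the roots ρ of p.
  root-near : ExcludedMiddle ℓ → AlgebraicallyClosed Ω → ∀ p y →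
    eval p y ∼ 0# → ¬ (eval′ p y ∼ 0#) → ∃ λ ρ → eval p ρ ≈ 0# × ρ ∼ y
  root-near em closed p y py∼0 p′y≁0 = go (zero-or-leadingTerm p)
    where
    go : (p ≈ₚ []) ⊎ (∃ λ n → HasLeadingTerm n p) → ∃ λ ρ → eval p ρ ≈ 0# × ρ ∼ y
    go (inj₁ p≈0)     = contradiction (reflexive-∼ (eval′-zero p p≈0 y)) p′y≁0
    -- With no root near y, v(p′(y)) ≥ v(p(y)) > 0, contrary to the choice of y.
    go (inj₂ (n , l)) = search S.areRoots (λ far → p′y≁0 (1≺⇒∼ (≺-≼-trans
        (≺-resp (≈⇒≍ refl) (≈⇒≍ (trans (x-0≈x _) (S.eval-≈ y))) (∼⇒1≺ py∼0))
        (≼-resp (≈⇒≍ refl) (≈⇒≍ (trans (sym (S.eval′-≈ y)) (sym (x-0≈x _))))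
          (*-≼ S.lead (far-linearProduct far))))))
      where
      module S = Splitting (splitting closed n p l)
      x-0≈x : ∀ x → x - 0# ≈ x
      x-0≈x x = trans (+-congˡ -0#≈0#) (+-identityʳ x)
      search : ∀ {ρs} → All (λ ρ → eval p ρ ≈ 0#) ρs → ¬ All (λ ρ → ¬ (ρ ∼ y)) ρs →
        ∃ λ ρ → eval p ρ ≈ 0# × ρ ∼ y
      search []       none = contradiction [] none
      search (_∷_ {ρ} e es) none with em {ρ ∼ y}
      ... | yes ρ∼y = ρ , e , ρ∼y
      ... | no  ρ≁y = search es λ far → none (ρ≁y ∷ far)

module Hensel
  {ℓ} (em : ExcludedMiddle ℓ) {K : Field ℓ} {Γ : OrderedAbelianGroup ℓ} {v : Valuation K Γ}
  (henselian : Henselian v) (C : ValuedClosure v) where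

  open ValuedClosure C using (K̄; ι; algebraicallyClosed; valuation)
  open HenselianClosure em henselian C using (module Over)
  open Field K̄ hiding (zero)
  open FieldProperties K̄
  open ValuationOrder valuation
  open ResidueField valuation using (Integral; _∼_; ∼-sym; ∼-trans; reflexive-∼)
  open RootsNear valuation
  open PolynomialProperties K̄ using (Poly)
  open Evaluation (identity K̄) using (eval; eval′)
  open IntermediateField

  private module _ (L : IntermediateField ι) where
    module L = Field (toField L)
    module E where
      open PolynomialProperties (toField L) public
      open Evaluation (inclusion L) public

  -- K̄ contains a root ρ near y. Outside L it would have a second conjugate ρ′ over L, equal to it
  -- in all values of polynomials over L: comparing f gives f(ρ′) = 0, comparing X - y gives ρ′ ∼ y,
  -- against uniqueness of the simple root.
  hensel : (L : IntermediateField ι) (f : List (Field.Carrier (toField L))) →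
    All Integral (map proj₁ f) → ∀ {y} → Member L y → Integral y →
    eval (map proj₁ f) y ∼ 0# → ¬ (eval′ (map proj₁ f) y ∼ 0#) →
    ∃ λ c → Member L c × eval (map proj₁ f) c ≈ 0# × c ∼ y
  hensel L f integral {y} y∈L iy fy∼0 f′y≁0 =
    go (root-near em algebraicallyClosed f̄ y fy∼0 f′y≁0)
    where
    f̄ = map proj₁ f
    module ℰ = E L
    module O = Over (base L) (inclusion L) (λ _ → refl)
    eval-f : ∀ x → ℰ.eval f x ≈ eval f̄ x
    eval-f x = sym (eval-map (inclusion L) (identity K̄) (inclusion L) (λ _ → refl) f x)
    eval′-f : ∀ x → ℰ.eval′ f x ≈ eval′ f̄ x
    eval′-f x = sym (eval′-map (inclusion L) (identity K̄) (inclusion L) (λ _ → refl) f x)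
    X-y : ℰ.Poly
    X-y = L.-_ L (y , y∈L) ∷ L.1# L ∷ []
    eval-X-y : ∀ x → ℰ.eval X-y x ≈ x - y
    eval-X-y x = solve 2 (λ x y → :- y :+ x :* (con (ℤ.+ 1) :+ x :* con (ℤ.+ 0)) := x :- y) refl x y

    go : (∃ λ ρ → eval f̄ ρ ≈ 0# × ρ ∼ y) → _
    go (ρ , fρ≈0 , ρ∼y) with em {Member L ρ}
    ... | yes ρ∈L = ρ , ρ∈L , fρ≈0 , ρ∼y
    ... | no  ρ∉L = contradiction (simple-root-unique {f̄} integral iρ ρ∼ρ′ fρ≈0 fρ′≈0 f′ρ≁0) ρ′≉ρ
      where
      iρ : Integral ρ
      iρ = ∼-integral iy (∼-sym ρ∼y)
      f′ρ≁0 : ¬ (eval′ f̄ ρ ∼ 0#)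
      f′ρ≁0 e = f′y≁0 (∼-trans (eval′-∼ integral iy iρ (∼-sym ρ∼y)) e)
      conjugate : ∃ λ ρ′ → ¬ (ρ′ ≈ ρ) × ∀ g → ℰ.eval g ρ ≍ ℰ.eval g ρ′
      conjugate = O.moved-conjugate f (trans (eval-f ρ) fρ≈0)
        (λ e → f′ρ≁0 (reflexive-∼ (trans (sym (eval′-f ρ)) e)))
        (λ (a , a∈L) a≈ρ → ρ∉L (resp L a≈ρ a∈L))
      ρ′ = proj₁ conjugate
      ρ′≉ρ = proj₁ (proj₂ conjugate)
      ≍ρ′ = proj₂ (proj₂ conjugate)
      fρ′≈0 : eval f̄ ρ′ ≈ 0#
      fρ′≈0 = 0≼⇒≈0 (≼-resp (≈⇒≍ (trans (eval-f ρ) fρ≈0)) (≈⇒≍ (eval-f ρ′)) (≍⇒≼ (≍ρ′ f)))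
      ρ∼ρ′ : ρ ∼ ρ′
      ρ∼ρ′ = ∼-trans ρ∼y (∼-sym (1≺⇒∼ (≺-resp (≈⇒≍ refl)
        (≍-trans (≈⇒≍ (sym (eval-X-y ρ))) (≍-trans (≍ρ′ X-y) (≈⇒≍ (eval-X-y ρ′)))) (∼⇒1≺ ρ∼y))))

-- Double sums, the characteristic, and cosets of the value group.

module _ {c ℓ} (M : CommutativeMonoid c ℓ) where
  open CommutativeMonoid M
  open MonoidSum M using (sum)

  sum-splitAt : ∀ m {n} (t : Fin (m ℕ.+ n) → Carrier) →
    sum t ≈ sum (λ i → t (i ↑ˡ n)) ∙ sum (λ j → t (m ↑ʳ j))
  sum-splitAt zero    t = sym (identityˡ _)
  sum-splitAt (suc m) t = trans (∙-congˡ (sum-splitAt m (λ i → t (suc i)))) (sym (assoc _ _ _))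

  sum-combine : ∀ m {n} (t : Fin (m ℕ.* n) → Carrier) →
    sum t ≈ sum (λ (i : Fin m) → sum (λ (j : Fin n) → t (combine i j)))
  sum-combine zero        t = refl
  sum-combine (suc m) {n} t = trans (sum-splitAt n t) (∙-congˡ (sum-combine m (λ l → t (n ↑ʳ l))))

module _ {ℓ} (em : ExcludedMiddle ℓ) (F : Field ℓ) where
  open Field F hiding (zero)
  open Mult semiring using (×-homo-+; ×-assocˡ; ×-congʳ) renaming (_×_ to _×ᶠ_)
  open SetoidReasoning setoid

  private
    ×-∣ : ∀ {p n} → p ×ᶠ 1# ≈ 0# → p ∣ n → n ×ᶠ 1# ≈ 0#
    ×-∣ {p} p×1≈0 (divides q ≡.refl) = begin
      (q ℕ.* p) ×ᶠ 1#     ≈⟨ ×-assocˡ 1# q p ⟨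
      q ×ᶠ (p ×ᶠ 1#)      ≈⟨ ×-congʳ q p×1≈0 ⟩
      q ×ᶠ 0#             ≈⟨ multiple-of-0 q ⟩
      0#                  ∎
      where
      multiple-of-0 : ∀ q → q ×ᶠ 0# ≈ 0#
      multiple-of-0 zero    = refl
      multiple-of-0 (suc q) = trans (+-identityˡ _) (multiple-of-0 q)

  -- The least positive p with p · 1 = 0 is the characteristic, by division with remainder.
  characteristic-∣ : ∀ {n} .{{_ : NonZero n}} → n ×ᶠ 1# ≈ 0# → ∃ λ p → HasCharacteristic F p × p ∣ n
  characteristic-∣ {suc n′} n×1≈0
    -- The search runs over predecessors, which excludes the trivial multiple 0.
    with least em (λ k → suc k ×ᶠ 1# ≈ 0#) (n′ , n×1≈0)
  ... | p′ , p×1≈0 , minimal = p , (λ m → mk⇔ (vanishes m) (×-∣ p×1≈0)) , vanishes (suc n′) n×1≈0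
    where
    p = suc p′
    vanishes : ∀ m → m ×ᶠ 1# ≈ 0# → p ∣ m
    vanishes m m×1≈0 with m ℕ.% p in r≡
    ... | zero  = m%n≡0⇒n∣m m p r≡
    ... | suc r = contradiction r×1≈0 (minimal r (ℕ.s<s⁻¹ (≡.subst (ℕ._< p) r≡ (ℕ.m%n<n m p))))
      where
      r×1≈0 : suc r ×ᶠ 1# ≈ 0#
      r×1≈0 = begin
        suc r ×ᶠ 1#                                  ≡⟨ ≡.cong (_×ᶠ 1#) r≡ ⟨
        (m ℕ.% p) ×ᶠ 1#                              ≈⟨ +-identityʳ _ ⟨
        (m ℕ.% p) ×ᶠ 1# + 0#                         ≈⟨ +-congˡ (×-∣ p×1≈0 (divides (m ℕ./ p) ≡.refl)) ⟨
        (m ℕ.% p) ×ᶠ 1# + (m ℕ./ p ℕ.* p) ×ᶠ 1#      ≈⟨ ×-homo-+ 1# (m ℕ.% p) (m ℕ./ p ℕ.* p) ⟨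
        (m ℕ.% p ℕ.+ m ℕ./ p ℕ.* p) ×ᶠ 1#            ≡⟨ ≡.cong (_×ᶠ 1#) (ℕ.m≡m%n+[m/n]*n m p) ⟨
        m ×ᶠ 1#                                      ≈⟨ m×1≈0 ⟩
        0#                                           ∎

module ValuedSubfield
  {ℓ} (em : ExcludedMiddle ℓ) {K : Field ℓ} {Γ : OrderedAbelianGroup ℓ} {v : Valuation K Γ}
  (henselian : Henselian v) (C : ValuedClosure v)
  (L : IntermediateField (ValuedClosure.ι C)) where

  open ValuedClosure C using (K̄; ι; Γ̄; valuation; extends)
  open HenselianClosure em henselian C using (^-≉0)
  open Field K̄ hiding (zero)
  open FieldProperties K̄
  open ValuationOrder valuation
  open ResidueField valuation using (_∼_; pos-resp)
  open RootsNear valuation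
  open IntermediateField
  open Exp semiring using (_^_)
  open SetoidReasoning setoid
  module ι where
    open _⟶_ ι public
    open Evaluation ι public
    open LinearCombinations ι using (Independent) public
  module L = Field (toField L)
  module K = Field K
  module LP = FieldProperties (toField L)
  open ValuedExtension {v = v} {restrict (inclusion L) valuation} (base L) extends public
    using (residue; IsRamificationIndex; IsInertiaDegree; Tame)

  K-inverse : ∀ {a} → ¬ (ι.⟦ a ⟧ ≈ 0#) → ∃ λ b → ι.⟦ a ⟧ * ι.⟦ b ⟧ ≈ 1#
  K-inverse {a} a≉0 = let b , ab≈1 = FieldProperties.inverse K (λ a≈0 → a≉0 (trans (ι.⟦⟧-cong a≈0) ι.0#-homo))
    in b , trans (sym (ι.*-homo a b)) (trans (ι.⟦⟧-cong ab≈1) ι.1#-homo)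

  module Ramification {e} (index : IsRamificationIndex e) where
    private
      module Δ where
        open OrderedAbelianGroup Γ̄ public
        open AbelianGroupProperties abelianGroup public
      open Values Γ̄ using (_≈⁺_; +⁺-cong; module Eq; [_])
      open Valuation valuation using (v-*; v-∞) renaming (v to v̄)
      rep = proj₁ index
      rep∈ = proj₁ (proj₂ index)
      covers = proj₁ (proj₂ (proj₂ index))
      distinct = proj₂ (proj₂ (proj₂ index))

      finite-value : ∀ x → ¬ (x ≈ 0#) → ∃ λ γ → v̄ x ≈⁺ [ γ ]
      finite-value x x≉0 with v̄ x in e
      ... | ⊤⁺    = contradiction (Equivalence.to (v-∞ x) (Eq.reflexive e)) x≉0
      ... | [ γ ] = γ , Eq.refl

    -- Elements of L whose values represent the cosets of vK in vL.
    representative : Fin e → L.Carrier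
    representative i = proj₁ (rep∈ i)

    private
      ρ : Fin e → Carrier
      ρ i = proj₁ (representative i)
      v-ρ : ∀ i → v̄ (ρ i) ≈⁺ [ rep i ]
      v-ρ i = proj₂ (rep∈ i)

    representative≉0 : ∀ i → ¬ (ρ i ≈ 0#)
    representative≉0 i ρᵢ≈0 with Eq.trans (Eq.sym (v-ρ i)) (Equivalence.from (v-∞ (ρ i)) ρᵢ≈0)
    ... | ()

    coset : (x : L.Carrier) → ¬ (proj₁ x ≈ 0#) →
      ∃ λ i → ∃ λ a → ¬ (ι.⟦ a ⟧ ≈ 0#) × proj₁ x ≍ ρ i * ι.⟦ a ⟧
    coset (x , x∈L) x≉0 with finite-value x x≉0
    ... | γ , vx≈γ with covers γ ((x , x∈L) , vx≈γ)
    ...   | i , a , va≈ = i , a , a≉0 , Eq.trans vx≈γ (Eq.sym (Eq.trans (v-* (ρ i) ι.⟦ a ⟧)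
              (Eq.trans (+⁺-cong (v-ρ i) va≈) [ Δ.trans (Δ.comm (rep i) (γ Δ.- rep i)) (Δ.//-rightDividesˡ (rep i) γ) ])))
      where
      a≉0 : ¬ (ι.⟦ a ⟧ ≈ 0#)
      a≉0 a≈0 with Eq.trans (Eq.sym va≈) (Equivalence.from (v-∞ _) a≈0)
      ... | ()

    coset-unique : ∀ i j a → ρ i ≍ ρ j * ι.⟦ a ⟧ → i ≡ j
    coset-unique i j a ρᵢ≍ρⱼa with finite-value ι.⟦ a ⟧ a≉0
      where
      a≉0 : ¬ (ι.⟦ a ⟧ ≈ 0#)
      a≉0 a≈0 = ≉0-resp ρᵢ≍ρⱼa (representative≉0 i) (trans (*-congˡ a≈0) (zeroʳ _))
    ... | α , va≈α = distinct i j (a , Eq.trans va≈α [ α≈ ])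
      where
      α≈ : α Δ.≈ rep i Δ.- rep j
      α≈ with Eq.trans (Eq.sym (v-ρ i)) (Eq.trans ρᵢ≍ρⱼa (Eq.trans (v-* (ρ j) ι.⟦ a ⟧) (+⁺-cong (v-ρ j) va≈α)))
      ... | [ e ] = Δ.trans (Δ.sym (Δ.xyx⁻¹≈y (rep j) α)) (Δ.∙-congʳ (Δ.sym e))

    coset-unique′ : ∀ i j a b → ¬ (ι.⟦ a ⟧ ≈ 0#) → ρ i * ι.⟦ a ⟧ ≍ ρ j * ι.⟦ b ⟧ → i ≡ j
    coset-unique′ i j a b a≉0 e with K-inverse a≉0
    ... | a⁻¹ , inv = coset-unique i j (b K.* a⁻¹) (≍-trans
            (≈⇒≍ (begin
              ρ i                             ≈⟨ *-identityʳ _ ⟨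
              ρ i * 1#                        ≈⟨ *-congˡ inv ⟨
              ρ i * (ι.⟦ a ⟧ * ι.⟦ a⁻¹ ⟧)     ≈⟨ *-assoc _ _ _ ⟨
              ρ i * ι.⟦ a ⟧ * ι.⟦ a⁻¹ ⟧       ∎))
            (≍-trans (*-cong-≍ e (≈⇒≍ refl))
              (≈⇒≍ (trans (*-assoc _ _ _) (*-congˡ (sym (ι.*-homo b a⁻¹)))))))

    private
      module Π = MonoidSum *-commutativeMonoid

      Π-cong-≍ : ∀ {n} {s t : Fin n → Carrier} → (∀ i → s i ≍ t i) → Π.sum s ≍ Π.sum t
      Π-cong-≍ {zero}  e = ≈⇒≍ refl
      Π-cong-≍ {suc n} e = *-cong-≍ (e zero) (Π-cong-≍ (λ i → e (suc i)))

      Π-≉0 : ∀ {n} (t : Fin n → Carrier) → (∀ i → ¬ (t i ≈ 0#)) → ¬ (Π.sum t ≈ 0#)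
      Π-≉0 {zero}  t t≉0 = 1≉0
      Π-≉0 {suc n} t t≉0 e = Π-≉0 (λ i → t (suc i)) (λ i → t≉0 (suc i)) (*-cancelˡ-0 (t≉0 zero) e)

      Π-in-K : ∀ {n} (a : Fin n → K.Carrier) → ∃ λ b → ι.⟦ b ⟧ ≈ Π.sum (λ i → ι.⟦ a i ⟧)
      Π-in-K {zero}  a = K.1# , ι.1#-homo
      Π-in-K {suc n} a = let b , e = Π-in-K (λ i → a (suc i)) in
        a zero K.* b , trans (ι.*-homo _ _) (*-congˡ e)

    -- Multiplication by x permutes the cosets; compare the products of all representatives.
    power-in-K : (x : L.Carrier) → ¬ (proj₁ x ≈ 0#) →
      ∃ λ a → ¬ (ι.⟦ a ⟧ ≈ 0#) × proj₁ x ^ e ≍ ι.⟦ a ⟧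
    power-in-K x x≉0 = b , ≉0-resp x^e≍b (^-≉0 x≉0 e) , x^e≍b
      where
      x⁻¹ = proj₁ (LP.inverse {x} x≉0)
      xx⁻¹≈1 : proj₁ x * proj₁ x⁻¹ ≈ 1#
      xx⁻¹≈1 = proj₂ (LP.inverse {x} x≉0)
      x⁻¹≉0 : ¬ (proj₁ x⁻¹ ≈ 0#)
      x⁻¹≉0 = invertible⇒≉0 (trans (*-comm _ _) xx⁻¹≈1)
      shift : (y : L.Carrier) → ¬ (proj₁ y ≈ 0#) → ∀ i →
        ∃ λ j → ∃ λ a → ¬ (ι.⟦ a ⟧ ≈ 0#) × ρ i * proj₁ y ≍ ρ j * ι.⟦ a ⟧
      shift y y≉0 i = coset (representative i L.* y) λ e → y≉0 (*-cancelˡ-0 (representative≉0 i) e)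
      coset-inverse : ∀ {i j k a b y z} → y * z ≈ 1# →
        ρ i * z ≍ ρ j * ι.⟦ a ⟧ → ρ j * y ≍ ρ k * ι.⟦ b ⟧ → k ≡ i
      coset-inverse {i} {j} {k} {a} {b} {y} {z} yz≈1 e f = ≡.sym (coset-unique i k (b K.* a) (≍-trans
        (≈⇒≍ (begin
          ρ i                            ≈⟨ *-identityʳ _ ⟨
          ρ i * 1#                       ≈⟨ *-congˡ yz≈1 ⟨
          ρ i * (y * z)                  ≈⟨ solve 3 (λ r y z → r :* (y :* z) := (r :* z) :* y) refl (ρ i) y z ⟩
          (ρ i * z) * y                  ∎))
        (≍-trans (*-cong-≍ e (≈⇒≍ refl)) (≍-trans
          (≈⇒≍ (solve 3 (λ r a y → (r :* a) :* y := (r :* y) :* a) refl (ρ j) ι.⟦ a ⟧ y))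
          (≍-trans (*-cong-≍ f (≈⇒≍ refl))
            (≈⇒≍ (trans (*-assoc _ _ _) (*-congˡ (sym (ι.*-homo b a))))))))))
      shift-inverse : ∀ y z (y≉0 : ¬ (proj₁ y ≈ 0#)) (z≉0 : ¬ (proj₁ z ≈ 0#)) → proj₁ y * proj₁ z ≈ 1# →
        ∀ i → proj₁ (shift y y≉0 (proj₁ (shift z z≉0 i))) ≡ i
      shift-inverse y z y≉0 z≉0 yz≈1 i =
        let j , _ , _ , e = shift z z≉0 i
            k , _ , _ , f = shift y y≉0 j
        in coset-inverse yz≈1 e f
      -- Multiplication by x⁻¹ supplies the inverse permutation.
      π : Permutation e e
      π = permutation (λ i → proj₁ (shift x x≉0 i)) (λ i → proj₁ (shift x⁻¹ x⁻¹≉0 i))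
        (shift-inverse x x⁻¹ x≉0 x⁻¹≉0 xx⁻¹≈1)
        (shift-inverse x⁻¹ x x⁻¹≉0 x≉0 (trans (*-comm _ _) xx⁻¹≈1))
      scalars : Fin e → K.Carrier
      scalars i = proj₁ (proj₂ (shift x x≉0 i))
      b = proj₁ (Π-in-K scalars)
      x^e≍b : proj₁ x ^ e ≍ ι.⟦ b ⟧
      -- The product of all ρᵢ x equals xᵉ times the product of the ρᵢ; its value is also that of
      -- the permuted product times scalars from K.
      x^e≍b = *-cancel-≍ (Π-≉0 ρ representative≉0) (≍-trans
        (≈⇒≍ (trans (*-congˡ (sym (Π.sum-replicate e))) (sym (Π.∑-distrib-+ ρ (λ _ → proj₁ x)))))
        (≍-trans (Π-cong-≍ (λ i → proj₂ (proj₂ (proj₂ (shift x x≉0 i)))))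
        (≈⇒≍ (trans (Π.∑-distrib-+ (λ i → ρ (π ⟨$⟩ʳ i)) (λ i → ι.⟦ scalars i ⟧))
          (*-cong (sym (Π.sum-permute ρ π)) (sym (proj₂ (Π-in-K scalars))))))))

    index-nonZero : NonZero e
    index-nonZero = Fin.nonZeroIndex (proj₁ (coset L.1# 1≉0))

    -- By injectivity of `residue`, e · 1 = 0 in the residue field of L would already hold in that
    -- of K, whose characteristic would then divide e.
    integer-unit : Tame → ¬ (Mult._×_ semiring e 1# ∼ 0#)
    integer-unit tame e×1∼0 =
      let p , char , p∣e = characteristic-∣ em (residueField v) {e} {{index-nonZero}}
            (Evaluation.⟦⟧-injective residue {e ×ᵏ Field.1# (residueField v)}
              (pos-resp (+-congʳ (sym (multiple e))) e×1∼0))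
      in Tame.primeToChar tame index char p∣e
      where
      open RawMonoidDefinitions (Field.+-rawMonoid (residueField v)) using () renaming (_×_ to _×ᵏ_)
      multiple : ∀ n → proj₁ (proj₁ (_⟶_.⟦ residue ⟧ (n ×ᵏ Field.1# (residueField v)))) ≈ Mult._×_ semiring n 1#
      multiple zero    = ι.0#-homo
      multiple (suc n) = trans (ι.+-homo _ _) (+-cong ι.1#-homo (multiple n))

-- Tame subfields admit no wild embedding except the inclusion.

module TameSubfield
  {ℓ} (em : ExcludedMiddle ℓ) {K : Field ℓ} {Γ : OrderedAbelianGroup ℓ} {v : Valuation K Γ}
  (henselian : Henselian v) (C : ValuedClosure v)
  (L : IntermediateField (ValuedClosure.ι C)) where

  open ValuedClosure C using (K̄; ι; valuation; extends)
  open Hensel em henselian C using (hensel)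
  open HenselianClosure em henselian C using (^-≉0)
  open Field K̄ hiding (zero)
  open FieldProperties K̄
  open ValuationOrder valuation
  open ResidueField valuation using (Integral; _∼_; ∼-sym; ∼-trans; pos-resp; reflexive-∼; int-*; int-neg; int-0; int-1; ∼-+; ∼-*)
  open RootsNear valuation
  open PolynomialProperties K̄ using (Poly)
  open Evaluation (identity K̄) using (eval; eval′)
  open IntermediateField
  open Sum semiring using (sum; sum-cong-≋; *-distribˡ-sum)
  open Exp semiring using (_^_; ^-congˡ)
  open Mult semiring using () renaming (_×_ to _×ᶠ_)
  open SetoidReasoning setoid
  open ValuedSubfield em henselian C L
  private
    module k = Field (residueField v)

  sum-∼ : ∀ {n} {s t : Fin n → Carrier} → (∀ i → s i ∼ t i) → sum s ∼ sum t
  sum-∼ {zero}  e = reflexive-∼ refl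
  sum-∼ {suc n} e = ∼-+ (e zero) (sum-∼ (λ i → e (suc i)))

  -- X^(n+1) - w
  binomial : ℕ → Carrier → Poly
  binomial n w = - w ∷ monomial n
    where
    monomial : ℕ → Poly
    monomial zero    = 1# ∷ []
    monomial (suc n) = 0# ∷ monomial n

  private
    eval-binomial : ∀ n w x → eval (binomial n w) x ≈ x ^ suc n - w
    eval-binomial n w x = trans (+-comm _ _) (+-congʳ (*-congˡ (eval-monomial n)))
      where
      -- `drop 1` recovers the power X^n, which is local to `binomial`.
      eval-monomial : ∀ n → eval (drop 1 (binomial n w)) x ≈ x ^ n
      eval-monomial zero    = trans (+-congˡ (zeroʳ x)) (+-identityʳ 1#)
      eval-monomial (suc n) = trans (+-identityˡ _) (*-congˡ (eval-monomial n))

    eval′-binomial-1 : ∀ n w → eval′ (binomial n w) 1# ≈ suc n ×ᶠ 1#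
    eval′-binomial-1 n w = +-cong (eval-monomial n) (trans (*-identityˡ _) (eval′-monomial n))
      where
      eval-monomial : ∀ n → eval (drop 1 (binomial n w)) 1# ≈ 1#
      eval-monomial zero    = trans (+-congˡ (zeroʳ 1#)) (+-identityʳ 1#)
      eval-monomial (suc n) = trans (+-identityˡ _) (trans (*-identityˡ _) (eval-monomial n))
      eval′-monomial : ∀ n → eval′ (drop 1 (binomial n w)) 1# ≈ n ×ᶠ 1#
      eval′-monomial zero    = trans (+-identityˡ _) (zeroʳ 1#)
      eval′-monomial (suc n) = +-cong (eval-monomial n) (trans (*-identityˡ _) (eval′-monomial n))

    binomial-integral : ∀ n {w} → Integral w → All Integral (binomial n w)
    binomial-integral n iw = int-neg iw ∷ monomial-integral n
      where
      monomial-integral : ∀ n → All Integral (drop 1 (binomial n 1#))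
      monomial-integral zero    = int-1 ∷ []
      monomial-integral (suc n) = int-0 ∷ monomial-integral n

    -- `hensel` takes its polynomial as a list over L, so X^(n+1) - w has to be exhibited as the
    -- image of such a list.
    binomial-in : ∀ n (w : L.Carrier) → ∃ λ f → map proj₁ f ≡ binomial n (proj₁ w)
    binomial-in n w = let f , e = monomial-in n in (L.- w) ∷ f , ≡.cong (- proj₁ w ∷_) e
      where
      monomial-in : ∀ n → ∃ λ (f : List L.Carrier) → map proj₁ f ≡ drop 1 (binomial n (proj₁ w))
      monomial-in zero    = L.1# ∷ [] , ≡.refl
      monomial-in (suc n) = let f , e = monomial-in n in L.0# ∷ f , ≡.cong (0# ∷_) e

    1^≈1 : ∀ n → 1# ^ n ≈ 1#
    1^≈1 zero    = refl
    1^≈1 (suc n) = trans (*-identityˡ _) (1^≈1 n)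

  -- 1 is a root modulo the maximal ideal, and the derivative there is n + 1, a unit.
  root-of-1-unit : ∀ n → ¬ (suc n ×ᶠ 1# ∼ 0#) → (w : L.Carrier) → proj₁ w ∼ 1# →
    ∃ λ (c : L.Carrier) → proj₁ c ^ suc n ≈ proj₁ w × proj₁ c ∼ 1#
  root-of-1-unit n unit w w∼1 =
    let f , f≡ = binomial-in n w
        c , c∈L , fc≈0 , c∼1 = hensel L f (≡.subst (All Integral) (≡.sym f≡) (binomial-integral n iw))
          (proj₂ L.1#) int-1
          (≡.subst (λ f → eval f 1# ∼ 0#) (≡.sym f≡) small)
          (≡.subst (λ f → ¬ (eval′ f 1# ∼ 0#)) (≡.sym f≡)
            λ e → unit (∼-trans (reflexive-∼ (sym (eval′-binomial-1 n (proj₁ w)))) e))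
    in (c , c∈L) , x-y≈0⇒x≈y (trans (sym (eval-binomial n (proj₁ w) c))
         (≡.subst (λ f → eval f c ≈ 0#) f≡ fc≈0)) , c∼1
    where
    iw : Integral (proj₁ w)
    iw = ∼-integral int-1 (∼-sym w∼1)
    small : eval (binomial n (proj₁ w)) 1# ∼ 0#
    small = pos-resp (sym (trans (+-congˡ -0#≈0#) (trans (+-identityʳ _)
      (trans (eval-binomial n (proj₁ w) 1#) (+-congʳ (1^≈1 (suc n))))))) (∼-sym w∼1)

  root-of-unity-near-1 : ∀ n → ¬ (suc n ×ᶠ 1# ∼ 0#) → ∀ {ζ} → ζ ^ suc n ≈ 1# → 1# ∼ ζ → ζ ≈ 1#
  root-of-unity-near-1 n unit {ζ} ζ^n≈1 1∼ζ =
    simple-root-unique {binomial n 1#} (binomial-integral n int-1) int-1 1∼ζ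
      (trans (eval-binomial n 1# 1#) (x≈y⇒x-y≈0 (1^≈1 (suc n))))
      (trans (eval-binomial n 1# ζ) (x≈y⇒x-y≈0 ζ^n≈1))
      (λ e → unit (∼-trans (reflexive-∼ (sym (eval′-binomial-1 n 1#))) e))

  module Inertia {f} (inertia : IsInertiaDegree f) where
    private
      b = proj₁ inertia
      module B = Extension.IsBasis (proj₂ inertia)

      residue-combination : ∀ {n} (c : Fin n → k.Carrier) b →
        proj₁ (proj₁ (Extension.combination residue c b)) ≈ sum (λ j → ι.⟦ proj₁ (c j) ⟧ * proj₁ (proj₁ (b j)))
      residue-combination {zero}  c b = refl
      residue-combination {suc n} c b = +-congˡ (residue-combination (λ j → c (suc j)) (λ j → b (suc j)))

      minimum-of : ∀ {n} (t : Fin n → Carrier) → Fin n → ∃ λ k → ∀ i → t k ≼ t i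
      minimum-of {suc n} t _ = minimum t

    -- Elements of L whose residues form a basis over Kv.
    generator : Fin f → L.Carrier
    generator j = proj₁ (b j)

    generator-integral : ∀ j → Integral (proj₁ (generator j))
    generator-integral j = proj₂ (b j)

    module _ (t : Fin f → Carrier) (t∼ : ∀ j → t j ∼ proj₁ (generator j)) where
      private
        t-integral : ∀ j → Integral (t j)
        t-integral j = ∼-integral (generator-integral j) (∼-sym (t∼ j))

        residues-independent : (c : Fin f → k.Carrier) → sum (λ j → ι.⟦ proj₁ (c j) ⟧ * t j) ∼ 0# →
          ∀ j → c j k.≈ k.0#
        residues-independent c relation = B.independent c (∼-trans
          (reflexive-∼ (residue-combination c b))
          (∼-trans (sum-∼ (λ j → ∼-* (proj₂ (_⟶_.⟦ residue ⟧ (c j))) (generator-integral j)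
            (reflexive-∼ refl) (∼-sym (t∼ j)))) relation))

      -- In effect v(Σ aⱼ tⱼ) = min v(aⱼ): after division by the coefficient of least value one
      -- coefficient is 1, and independence of the residues keeps the sum a unit.
      combination-value : (a : Fin f → K.Carrier) → ∀ j → ¬ (ι.⟦ a j ⟧ ≈ 0#) →
        ∃ λ k → ¬ (ι.⟦ a k ⟧ ≈ 0#) × sum (λ j → ι.⟦ a j ⟧ * t j) ≍ ι.⟦ a k ⟧
      combination-value a j aⱼ≉0 = k , aₖ≉0 , value
        where
        least-value = minimum-of (λ j → ι.⟦ a j ⟧) j
        k = proj₁ least-value
        aₖ≉0 : ¬ (ι.⟦ a k ⟧ ≈ 0#)
        aₖ≉0 e = aⱼ≉0 (0≼⇒≈0 (≼-resp (≈⇒≍ e) (≈⇒≍ refl) (proj₂ least-value j)))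
        aₖ⁻¹ = proj₁ (K-inverse aₖ≉0)
        c : Fin f → K.Carrier
        c j = a j K.* aₖ⁻¹
        aₖcⱼ≈aⱼ : ∀ j → ι.⟦ a k ⟧ * ι.⟦ c j ⟧ ≈ ι.⟦ a j ⟧
        aₖcⱼ≈aⱼ j = begin
          ι.⟦ a k ⟧ * ι.⟦ c j ⟧                    ≈⟨ *-congˡ (ι.*-homo (a j) aₖ⁻¹) ⟩
          ι.⟦ a k ⟧ * (ι.⟦ a j ⟧ * ι.⟦ aₖ⁻¹ ⟧)     ≈⟨ solve 3 (λ x y z → x :* (y :* z) := y :* (x :* z)) refl _ _ _ ⟩
          ι.⟦ a j ⟧ * (ι.⟦ a k ⟧ * ι.⟦ aₖ⁻¹ ⟧)     ≈⟨ *-congˡ (proj₂ (K-inverse aₖ≉0)) ⟩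
          ι.⟦ a j ⟧ * 1#                           ≈⟨ *-identityʳ _ ⟩
          ι.⟦ a j ⟧                                ∎
        1≼c : ∀ j → 1# ≼ ι.⟦ c j ⟧
        1≼c j = *-cancel-≼ aₖ≉0 (≼-resp (≈⇒≍ (sym (*-identityʳ _))) (≈⇒≍ (sym (aₖcⱼ≈aⱼ j))) (proj₂ least-value j))
        c-integral : ∀ j → ResidueField.Integral v (c j)
        c-integral j = Values.≤⁺-respˡ Γ (Valuation.v-1 v) (Equivalence.from (extends K.1# (c j))
          (≼-resp (≈⇒≍ (sym ι.1#-homo)) (≈⇒≍ refl) (1≼c j)))
        c̄ : Fin f → k.Carrier
        c̄ j = c j , c-integral j
        S = sum (λ j → ι.⟦ c j ⟧ * t j)
        S-integral : Integral S
        S-integral = 1≼⇒integral (sum-≼ _ λ j → integral⇒1≼ (int-* (1≼⇒integral (1≼c j)) (t-integral j)))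
        S≁0 : ¬ (S ∼ 0#)
        -- S ∼ 0 would force the residue of cₖ to vanish, although cₖ = 1.
        S≁0 S∼0 = k.1≉0 (ResidueField.∼-trans v (ResidueField.reflexive-∼ v (K.sym (proj₂
            (FieldProperties.inverse K (λ e → aₖ≉0 (trans (ι.⟦⟧-cong e) ι.0#-homo))))))
          (residues-independent c̄ S∼0 k))
        value : sum (λ j → ι.⟦ a j ⟧ * t j) ≍ ι.⟦ a k ⟧
        value = ≍-trans
          (≈⇒≍ (begin
            sum (λ j → ι.⟦ a j ⟧ * t j)
              ≈⟨ sum-cong-≋ (λ j → trans (*-congʳ (sym (aₖcⱼ≈aⱼ j))) (*-assoc _ _ _)) ⟩
            sum (λ j → ι.⟦ a k ⟧ * (ι.⟦ c j ⟧ * t j))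
              ≈⟨ *-distribˡ-sum ι.⟦ a k ⟧ (λ j → ι.⟦ c j ⟧ * t j) ⟨
            ι.⟦ a k ⟧ * S ∎))
          (≍-trans (*-cong-≍ (≈⇒≍ refl) (≁0⇒≍1 S-integral S≁0)) (≈⇒≍ (*-identityʳ _)))

  module IndependentProducts {e f} (index : IsRamificationIndex e) (inertia : IsInertiaDegree f) where
    open Ramification index
    open Inertia inertia
    private module M = LinearCombinations ι

    products-independent : (s : Fin e → Carrier) → (∀ i → s i ≍ proj₁ (representative i)) →
      (t : Fin f → Carrier) → (∀ j → t j ∼ proj₁ (generator j)) →
      ι.Independent (λ l → s (proj₁ (remQuot {e} f l)) * t (proj₂ (remQuot {e} f l)))
    products-independent s s≍ t t∼ c relation l = vanish (zero? _)
      where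
      u : Fin e → Carrier
      u i = sum (λ j → ι.⟦ c (combine i j) ⟧ * t j)

      sum-su≈0 : sum (λ i → s i * u i) ≈ 0#
      sum-su≈0 = begin
        sum (λ i → s i * u i)
          ≈⟨ sum-cong-≋ (λ i → trans (*-distribˡ-sum (s i) (λ j → ι.⟦ c (combine i j) ⟧ * t j))
               (sum-cong-≋ λ j → begin
                 s i * (ι.⟦ c (combine i j) ⟧ * t j)
                   ≈⟨ solve 3 (λ s c t → s :* (c :* t) := c :* (s :* t)) refl _ _ _ ⟩
                 ι.⟦ c (combine i j) ⟧ * (s i * t j)
                   ≡⟨ ≡.cong (λ (i′ , j′) → ι.⟦ c (combine i j) ⟧ * (s i′ * t j′)) (Fin.remQuot-combine i j) ⟨
                 term (combine i j) ∎)) ⟩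
        sum (λ (i : Fin e) → sum (λ (j : Fin f) → term (combine i j)))
          ≈⟨ sum-combine +-commutativeMonoid e {f} term ⟨
        sum term ≈⟨ relation ⟩
        0# ∎
        where
        term : Fin (e ℕ.* f) → Carrier
        term l = ι.⟦ c l ⟧ * (s (proj₁ (remQuot {e} f l)) * t (proj₂ (remQuot {e} f l)))

      s≉0 : ∀ i → ¬ (s i ≈ 0#)
      s≉0 i = ≉0-resp (≍-sym (s≍ i)) (representative≉0 i)

      u-in-K : ∀ i → ¬ (u i ≈ 0#) → ∃ λ a → ¬ (ι.⟦ a ⟧ ≈ 0#) × u i ≍ ι.⟦ a ⟧
      u-in-K i uᵢ≉0 with Fin.any? (λ j → ≉0? ι.⟦ c (combine i j) ⟧)
      ... | yes (j , cⱼ≉0) = let k , cₖ≉0 , e = combination-value t t∼ (λ j → c (combine i j)) j cⱼ≉0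
                             in c (combine i k) , cₖ≉0 , e
      ... | no  all-zero   = contradiction (M.sum-≈0 _ λ j → trans (*-congʳ
              ([ (λ e → e) , (λ ¬e → contradiction (j , ¬e) all-zero) ]′ (zero? _))) (zeroˡ (t j))) uᵢ≉0

      u≈0 : ∀ i → u i ≈ 0#
      u≈0 i = [ (λ e → e) , (λ uᵢ≉0 → contradiction
          (vanishing-sum (λ i → s i * u i) sum-su≈0 i (λ e → uᵢ≉0 (*-cancelˡ-0 (s≉0 i) e))) no-coincidence) ]′ (zero? (u i))
        where
        factor≉0 : ∀ {i} → ¬ (s i * u i ≈ 0#) → ¬ (u i ≈ 0#)
        factor≉0 su≉0 e = su≉0 (trans (*-congˡ e) (zeroʳ _))
        no-coincidence : ¬ (∃ λ j → ∃ λ k → j ≢ k × ¬ (s j * u j ≈ 0#) × s j * u j ≍ s k * u k)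
        no-coincidence (j , k , j≢k , su≉0 , e) =
          let a , a≉0 , uⱼ≍a = u-in-K j (factor≉0 su≉0)
              b , b≉0 , uₖ≍b = u-in-K k (factor≉0 (≉0-resp e su≉0))
          in j≢k (coset-unique′ j k a b a≉0 (≍-trans (≍-sym (*-cong-≍ (s≍ j) uⱼ≍a))
               (≍-trans e (*-cong-≍ (s≍ k) uₖ≍b))))

      i = proj₁ (remQuot {e} f l)
      j = proj₂ (remQuot {e} f l)
      vanish : ι.⟦ c l ⟧ ≈ 0# ⊎ ¬ (ι.⟦ c l ⟧ ≈ 0#) → c l K.≈ K.0#
      vanish (inj₁ e)    = ι.⟦⟧-injective e
      vanish (inj₂ cₗ≉0) =
        let k , cₖ≉0 , e = combination-value t t∼ (λ j → c (combine i j)) j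
              (≡.subst (λ l → ¬ (ι.⟦ c l ⟧ ≈ 0#)) (≡.sym (Fin.combine-remQuot {e} f l)) cₗ≉0)
        in contradiction (u≈0 i) (≉0-resp (≍-sym e) cₖ≉0)

  -- `wild` is the condition defining the ramification group, imposed on an embedding of L because L
  -- need not be normal.
  module Wild (tame : Tame) (τ : toField L ⟶ K̄)
              (τκ≈ι : ∀ a → _⟶_.⟦ τ ⟧ (_⟶_.⟦ base L ⟧ a) ≈ ι.⟦ a ⟧)
              (wild : ∀ (x : L.Carrier) → ¬ (proj₁ x ≈ 0#) → proj₁ x ≺ _⟶_.⟦ τ ⟧ x - proj₁ x) where
    private
      module τ where
        open _⟶_ τ public
        open Evaluation τ public

    Fixed : L.Carrier → Set ℓ
    Fixed x = τ.⟦ x ⟧ ≈ proj₁ x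

    τ-near : ∀ (x : L.Carrier) → Integral (proj₁ x) → proj₁ x ∼ τ.⟦ x ⟧
    τ-near x ix = near (zero? (proj₁ x))
      where
      near : proj₁ x ≈ 0# ⊎ ¬ (proj₁ x ≈ 0#) → proj₁ x ∼ τ.⟦ x ⟧
      near (inj₁ x≈0) = reflexive-∼ (trans x≈0 (sym (trans (τ.⟦⟧-cong x≈0) τ.0#-homo)))
      near (inj₂ x≉0) = ∼-sym (1≺⇒∼ (≼-≺-trans (integral⇒1≼ ix) (wild x x≉0)))

    -- Lift the separable minimal polynomial of the residue to K and take its root c near y in L.
    -- Then τ c is a root of the same polynomial in the same residue class, so τ c = c.
    fixed-residue : ∀ (y : L.Carrier) → Integral (proj₁ y) → ∃ λ (t : L.Carrier) → Fixed t × proj₁ t ∼ proj₁ y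
    fixed-residue y iy = (c , c∈L) , τc≈c , c∼y
      where
      ȳ : Field.Carrier (residueField (restrict (inclusion L) valuation))
      ȳ = y , iy
      separable-polynomial = Tame.residueSeparable tame ȳ
      p = proj₁ separable-polynomial
      minimal = proj₁ (proj₂ separable-polynomial)
      separable = proj₂ (proj₂ separable-polynomial)
      -- Residues are represented by integral elements, so the first projections already lift the
      -- coefficients to K.
      g : List K.Carrier
      g = map proj₁ p
      f : List L.Carrier
      f = map (_⟶_.⟦_⟧ (base L)) g
      f̄ : Poly
      f̄ = map proj₁ f

      residue-eval : ∀ p → proj₁ (proj₁ (Extension.eval residue p ȳ)) ≈
        eval (map proj₁ (map (_⟶_.⟦_⟧ (base L)) (map proj₁ p))) (proj₁ y)
      residue-eval []      = refl
      residue-eval (a ∷ p) = +-congˡ (*-congˡ (residue-eval p))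
      residue-eval′ : ∀ p → proj₁ (proj₁ (Evaluation.eval′ residue p ȳ)) ≈
        eval′ (map proj₁ (map (_⟶_.⟦_⟧ (base L)) (map proj₁ p))) (proj₁ y)
      residue-eval′ []      = refl
      residue-eval′ (a ∷ p) = +-cong (residue-eval p) (*-congˡ (residue-eval′ p))
      lift-integral : ∀ p → All Integral (map proj₁ (map (_⟶_.⟦_⟧ (base L)) (map proj₁ p)))
      lift-integral []      = []
      lift-integral (a ∷ p) = proj₂ (_⟶_.⟦ residue ⟧ a) ∷ lift-integral p

      pȳ≈0 : proj₁ (proj₁ (Extension.eval residue p ȳ)) ∼ 0#
      pȳ≈0 = proj₁ (proj₂ (proj₂ minimal))
      f̄y∼0 : eval f̄ (proj₁ y) ∼ 0#
      f̄y∼0 = ∼-trans (reflexive-∼ (sym (residue-eval p))) pȳ≈0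
      f̄′y≁0 : ¬ (eval′ f̄ (proj₁ y) ∼ 0#)
      f̄′y≁0 e = Evaluation.separable⇒eval′≉0 residue p separable ȳ pȳ≈0
        (∼-trans (reflexive-∼ (residue-eval′ p)) e)

      root = hensel L f (lift-integral p) (proj₂ y) iy f̄y∼0 f̄′y≁0
      c = proj₁ root
      c∈L = proj₁ (proj₂ root)
      f̄c≈0 = proj₁ (proj₂ (proj₂ root))
      c∼y = proj₂ (proj₂ (proj₂ root))
      ic : Integral c
      ic = ∼-integral iy (∼-sym c∼y)

      eval-f̄ : ∀ x → eval f̄ x ≈ ι.eval g x
      eval-f̄ x = trans (eval-map (inclusion L) (identity K̄) (inclusion L) (λ _ → refl) f x)
        (eval-map (base L) (inclusion L) ι (λ _ → refl) g x)
      f̄τc≈0 : eval f̄ τ.⟦ c , c∈L ⟧ ≈ 0#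
      f̄τc≈0 = trans (eval-f̄ _) (trans (sym (⟦eval⟧ (base L) τ ι τκ≈ι g (c , c∈L)))
        (trans (τ.⟦⟧-cong (trans (⟦eval⟧ (base L) (inclusion L) ι (λ _ → refl) g (c , c∈L))
          (trans (sym (eval-f̄ c)) f̄c≈0))) τ.0#-homo))
      τc≈c : τ.⟦ c , c∈L ⟧ ≈ c
      τc≈c = simple-root-unique {f̄} (lift-integral p) ic (τ-near (c , c∈L) ic) f̄c≈0 f̄τc≈0
        (λ e → f̄′y≁0 (∼-trans (eval′-∼ (lift-integral p) iy ic (∼-sym c∼y)) e))

    -- With t a fixed lift of the residue of the unit u = xᵉ / a, the quotient u / t is a
    -- 1-unit and so an e-th power cᵉ. Then y = x / c satisfies yᵉ = a t, whence τ y / y is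
    -- an e-th root of unity near 1.
    fixed-value : ∀ {e} → IsRamificationIndex e → ∀ (x : L.Carrier) → ¬ (proj₁ x ≈ 0#) →
      ∃ λ (y : L.Carrier) → Fixed y × proj₁ y ≍ proj₁ x
    -- A ramification index is never 0, since x lies in some coset.
    fixed-value {zero}  index x x≉0 = contradiction (proj₁ (Ramification.coset index x x≉0)) Fin.¬Fin0
    fixed-value {suc n} index x x≉0 = y , τy≈y , y≍x
      where
      open CommutativeExp commutativeSemiring using (^-distrib-*)
      module Lᴱ = Exp (Field.semiring (toField L))
      power = Ramification.power-in-K index x x≉0
      a = proj₁ power
      a≉0 = proj₁ (proj₂ power)
      x^e≍a = proj₂ (proj₂ power)
      a⁻¹ = proj₁ (K-inverse a≉0)
      aa⁻¹≈1 : ι.⟦ a ⟧ * ι.⟦ a⁻¹ ⟧ ≈ 1#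
      aa⁻¹≈1 = proj₂ (K-inverse a≉0)
      ^-in-L : ∀ z → proj₁ (z Lᴱ.^ suc n) ≈ proj₁ z ^ suc n
      ^-in-L z = ⟦^⟧ (inclusion L) z (suc n)

      u : L.Carrier
      u = x Lᴱ.^ suc n L.* _⟶_.⟦ base L ⟧ a⁻¹
      u≈ : proj₁ u ≈ proj₁ x ^ suc n * ι.⟦ a⁻¹ ⟧
      u≈ = *-congʳ (^-in-L x)
      u≍1 : proj₁ u ≍ 1#
      u≍1 = ≍-trans (≈⇒≍ u≈) (≍-trans (*-cong-≍ x^e≍a (≈⇒≍ refl)) (≈⇒≍ aa⁻¹≈1))

      residue-of-u = fixed-residue u (≍1⇒integral u≍1)
      t = proj₁ residue-of-u
      τt≈t = proj₁ (proj₂ residue-of-u)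
      t∼u : proj₁ t ∼ proj₁ u
      t∼u = proj₂ (proj₂ residue-of-u)
      t≍1 : proj₁ t ≍ 1#
      t≍1 = ∼≍1⇒≍1 t∼u u≍1
      t≉0 : ¬ (proj₁ t ≈ 0#)
      t≉0 = ≉0-resp (≍-sym t≍1) 1≉0
      t⁻¹ = proj₁ (LP.inverse {t} t≉0)
      tt⁻¹≈1 : proj₁ t * proj₁ t⁻¹ ≈ 1#
      tt⁻¹≈1 = proj₂ (LP.inverse {t} t≉0)
      t⁻¹≍1 : proj₁ t⁻¹ ≍ 1#
      t⁻¹≍1 = *-cancel-≍ t≉0 (≍-trans (≈⇒≍ tt⁻¹≈1) (≍-sym (≍-trans (≈⇒≍ (*-identityʳ _)) t≍1)))

      unit = Ramification.integer-unit index tame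
      root = root-of-1-unit n unit (u L.* t⁻¹) (∼-trans
        (∼-* (≍1⇒integral t≍1) (≍1⇒integral t⁻¹≍1) (∼-sym t∼u) (reflexive-∼ refl)) (reflexive-∼ tt⁻¹≈1))
      c = proj₁ root
      c^e≈ : proj₁ c ^ suc n ≈ proj₁ u * proj₁ t⁻¹
      c^e≈ = proj₁ (proj₂ root)
      c≍1 : proj₁ c ≍ 1#
      c≍1 = ∼≍1⇒≍1 (proj₂ (proj₂ root)) (≈⇒≍ refl)
      c≉0 : ¬ (proj₁ c ≈ 0#)
      c≉0 = ≉0-resp (≍-sym c≍1) 1≉0
      c⁻¹ = proj₁ (LP.inverse {c} c≉0)
      y : L.Carrier
      y = x L.* c⁻¹
      yc≈x : proj₁ y * proj₁ c ≈ proj₁ x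
      yc≈x = trans (*-assoc _ _ _) (trans (*-congˡ (trans (*-comm _ _) (proj₂ (LP.inverse {c} c≉0)))) (*-identityʳ _))
      y≍x : proj₁ y ≍ proj₁ x
      y≍x = ≍-trans (≈⇒≍ (sym (*-identityʳ _)))
        (≍-trans (*-cong-≍ (≈⇒≍ refl) (≍-sym c≍1)) (≈⇒≍ yc≈x))
      y≉0 : ¬ (proj₁ y ≈ 0#)
      y≉0 = ≉0-resp (≍-sym y≍x) x≉0

      y^e≈at : proj₁ y ^ suc n ≈ ι.⟦ a ⟧ * proj₁ t
      -- Checked after multiplication by X = xᵉ ≠ 0: here Y X A′ T′ = yᵉ cᵉ = X, while A A′ = T T′ =
      -- 1.
      y^e≈at = x-y≈0⇒x≈y (*-cancelˡ-0 (^-≉0 x≉0 (suc n)) (begin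
        X * (Y - A * T)
          ≈⟨ solve 6 (λ X Y A T A′ T′ → X :* (Y :- A :* T)
               := (Y :* ((X :* A′) :* T′)) :* (A :* T) :+ X :* Y :* (con (ℤ.+ 1) :- (A :* A′) :* (T :* T′)) :- X :* (A :* T))
               refl X Y A T A′ T′ ⟩
        (Y * ((X * A′) * T′)) * (A * T) + X * Y * (1# - (A * A′) * (T * T′)) - X * (A * T)
          ≈⟨ +-congʳ (+-cong (*-congʳ (trans (*-congˡ (trans (*-congʳ (sym u≈)) (sym c^e≈)))
               (trans (sym (^-distrib-* (proj₁ y) (proj₁ c) (suc n))) (^-congˡ (suc n) yc≈x))))
               (*-congˡ (+-congˡ (-‿cong (*-cong aa⁻¹≈1 tt⁻¹≈1))))) ⟩
        X * (A * T) + X * Y * (1# - 1# * 1#) - X * (A * T)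
          ≈⟨ solve 3 (λ X Y Z → X :* Z :+ X :* Y :* (con (ℤ.+ 1) :- con (ℤ.+ 1) :* con (ℤ.+ 1)) :- X :* Z := con (ℤ.+ 0))
               refl X Y (A * T) ⟩
        0# ∎))
        where
        X = proj₁ x ^ suc n
        Y = proj₁ y ^ suc n
        A = ι.⟦ a ⟧
        T = proj₁ t
        A′ = ι.⟦ a⁻¹ ⟧
        T′ = proj₁ t⁻¹

      τy^e≈y^e : τ.⟦ y ⟧ ^ suc n ≈ proj₁ y ^ suc n
      τy^e≈y^e = begin
        τ.⟦ y ⟧ ^ suc n                       ≈⟨ ⟦^⟧ τ y (suc n) ⟨
        τ.⟦ y Lᴱ.^ suc n ⟧                    ≈⟨ τ.⟦⟧-cong (trans (^-in-L y) y^e≈at) ⟩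
        τ.⟦ _⟶_.⟦ base L ⟧ a L.* t ⟧          ≈⟨ τ.*-homo _ _ ⟩
        τ.⟦ _⟶_.⟦ base L ⟧ a ⟧ * τ.⟦ t ⟧      ≈⟨ *-cong (τκ≈ι a) τt≈t ⟩
        ι.⟦ a ⟧ * proj₁ t                     ≈⟨ y^e≈at ⟨
        proj₁ y ^ suc n                       ∎

      y⁻¹ = proj₁ (inverse y≉0)
      yy⁻¹≈1 : proj₁ y * y⁻¹ ≈ 1#
      yy⁻¹≈1 = proj₂ (inverse y≉0)
      ζ = τ.⟦ y ⟧ * y⁻¹
      ζ^e≈1 : ζ ^ suc n ≈ 1#
      ζ^e≈1 = begin
        ζ ^ suc n                        ≈⟨ ^-distrib-* τ.⟦ y ⟧ y⁻¹ (suc n) ⟩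
        τ.⟦ y ⟧ ^ suc n * y⁻¹ ^ suc n    ≈⟨ *-congʳ τy^e≈y^e ⟩
        proj₁ y ^ suc n * y⁻¹ ^ suc n    ≈⟨ ^-distrib-* (proj₁ y) y⁻¹ (suc n) ⟨
        (proj₁ y * y⁻¹) ^ suc n          ≈⟨ ^-congˡ (suc n) yy⁻¹≈1 ⟩
        1# ^ suc n                       ≈⟨ 1^≈1 (suc n) ⟩
        1#                               ∎
      1∼ζ : 1# ∼ ζ
      -- This is `wild` at y, divided by y.
      1∼ζ = ∼-sym (1≺⇒∼ (≺-resp (≈⇒≍ (trans (*-comm _ _) yy⁻¹≈1))
        (≈⇒≍ (trans (solve 3 (λ i τy y → i :* (τy :- y) := τy :* i :- y :* i) refl y⁻¹ τ.⟦ y ⟧ (proj₁ y))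
          (+-congˡ (-‿cong yy⁻¹≈1))))
        (*-≺ (invertible⇒≉0 (trans (*-comm _ _) yy⁻¹≈1)) (wild y y≉0))))
      τy≈y : τ.⟦ y ⟧ ≈ proj₁ y
      τy≈y = begin
        τ.⟦ y ⟧                      ≈⟨ *-identityʳ _ ⟨
        τ.⟦ y ⟧ * 1#                 ≈⟨ *-congˡ yy⁻¹≈1 ⟨
        τ.⟦ y ⟧ * (proj₁ y * y⁻¹)    ≈⟨ solve 3 (λ τy y i → τy :* (y :* i) := (τy :* i) :* y) refl τ.⟦ y ⟧ (proj₁ y) y⁻¹ ⟩
        ζ * proj₁ y                  ≈⟨ *-congʳ (root-of-unity-near-1 n unit ζ^e≈1 1∼ζ) ⟩
        1# * proj₁ y                 ≈⟨ *-identityˡ _ ⟩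
        proj₁ y                      ∎

    private
      -- No fixed field is formed. Adjoining x to w exceeds the degree, so c₀ x + Σ cₗ wₗ = 0
      -- nontrivially; subtracting this from its image under τ leaves c₀ (τx - x) = 0, and c₀ = 0
      -- would contradict the independence of w.
      independent⇒trivial : ∀ {n k} → Extension.HasDegree (base L) n → n ℕ.≤ k →
        (w : Fin k → L.Carrier) → (∀ l → Fixed (w l)) → ι.Independent (λ l → proj₁ (w l)) →
        ∀ x → Fixed x
      independent⇒trivial {n} {k} degree n≤k w τw≈w w-independent x =
        [ x-y≈0⇒x≈y , (λ τx-x≉0 → contradiction nontrivial (relation-trivial τx-x≉0)) ]′
        (zero? (τ.⟦ x ⟧ - proj₁ x))
        where
        x∷w : Fin (suc k) → L.Carrier
        x∷w zero    = x
        x∷w (suc l) = w l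
        dependence = LinearCombinations.dependent (base L) (ℕ.s≤s n≤k) (proj₁ degree) x∷w
          (λ i → Extension.IsBasis.spans (proj₂ degree) (x∷w i))
        c = proj₁ dependence
        nontrivial : ∃ λ i → ¬ (c i K.≈ K.0#)
        nontrivial = proj₁ (proj₂ dependence)
        relation = proj₂ (proj₂ dependence)
        rest = ι.combination (λ l → c (suc l)) (λ l → proj₁ (w l))
        c₀x+rest≈0 : ι.⟦ c zero ⟧ * proj₁ x + rest ≈ 0#
        c₀x+rest≈0 = trans (sym (⟦combination⟧ (base L) (inclusion L) ι (λ _ → refl) c x∷w)) relation
        c₀τx+rest≈0 : ι.⟦ c zero ⟧ * τ.⟦ x ⟧ + rest ≈ 0#
        c₀τx+rest≈0 = trans (+-congˡ (sum-cong-≋ λ l → *-congˡ (sym (τw≈w l))))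
          (trans (sym (⟦combination⟧ (base L) τ ι τκ≈ι c x∷w)) (trans (τ.⟦⟧-cong relation) τ.0#-homo))
        relation-trivial : ¬ (τ.⟦ x ⟧ - proj₁ x ≈ 0#) → ¬ (∃ λ i → ¬ (c i K.≈ K.0#))
        relation-trivial τx-x≉0 = λ
          { (zero , c₀≉0)  → c₀≉0 (ι.⟦⟧-injective c₀≈0)
          ; (suc l , cₗ≉0) → cₗ≉0 (w-independent (λ l → c (suc l)) rest≈0 l) }
          where
          c₀≈0 : ι.⟦ c zero ⟧ ≈ 0#
          c₀≈0 = *-cancelˡ-0 τx-x≉0 (begin
            (τ.⟦ x ⟧ - proj₁ x) * ι.⟦ c zero ⟧
              ≈⟨ solve 4 (λ y x c r → (y :- x) :* c := (c :* y :+ r) :- (c :* x :+ r)) refl _ _ _ rest ⟩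
            (ι.⟦ c zero ⟧ * τ.⟦ x ⟧ + rest) - (ι.⟦ c zero ⟧ * proj₁ x + rest)
              ≈⟨ x≈y⇒x-y≈0 (trans c₀τx+rest≈0 (sym c₀x+rest≈0)) ⟩
            0# ∎)
          rest≈0 : rest ≈ 0#
          rest≈0 = trans (sym (trans (+-congʳ (trans (*-congʳ c₀≈0) (zeroˡ _))) (+-identityˡ rest))) c₀x+rest≈0

      products-fixed⇒trivial : ∀ {n e f} → Extension.HasDegree (base L) n → n ℕ.≤ e ℕ.* f →
        (index : IsRamificationIndex e) (inertia : IsInertiaDegree f) →
        (∀ i → ∃ λ (s : L.Carrier) → Fixed s × proj₁ s ≍ proj₁ (Ramification.representative index i)) →
        (∀ j → ∃ λ (t : L.Carrier) → Fixed t × proj₁ t ∼ proj₁ (Inertia.generator inertia j)) →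
        ∀ x → Fixed x
      products-fixed⇒trivial {e = e} {f} degree n≤ef index inertia s t =
        independent⇒trivial degree n≤ef st
          (λ l → trans (τ.*-homo _ _) (*-cong (proj₁ (proj₂ (s _))) (proj₁ (proj₂ (t _)))))
          (IndependentProducts.products-independent index inertia
            (λ i → proj₁ (proj₁ (s i))) (λ i → proj₂ (proj₂ (s i)))
            (λ j → proj₁ (proj₁ (t j))) (λ j → proj₂ (proj₂ (t j))))
        where
        st : Fin (e ℕ.* f) → L.Carrier
        st l = proj₁ (s (proj₁ (remQuot {e} f l))) L.* proj₁ (t (proj₂ (remQuot {e} f l)))

    -- The fixed field of τ has ramification index e and inertia degree f over K,
    -- hence degree at least e f = [L : K].
    trivial : ∀ x → Fixed x
    trivial =
      let n , e , f , degree , index , inertia , n≡ef1 = Tame.defectless tame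
      in products-fixed⇒trivial degree (ℕ.≤-reflexive (≡.trans n≡ef1 (ℕ.*-identityʳ (e ℕ.* f)))) index inertia
           (λ i → fixed-value index (Ramification.representative index i) (Ramification.representative≉0 index i))
           (λ j → fixed-residue (Inertia.generator inertia j) (Inertia.generator-integral inertia j))

-- Okutsu sequences: the filtration, the main invariant and Krasner's constant.

private
  ⊑⇒⟶ : ∀ {ℓ} {K Ω : Field ℓ} {φ : K ⟶ Ω} (L M : IntermediateField φ) → Subextensions._⊑_ φ L M →
    IntermediateField.toField L ⟶ IntermediateField.toField M
  ⊑⇒⟶ {Ω = Ω} L M L⊑M = record
    { ⟦_⟧ = λ (x , x∈L) → x , L⊑M x∈L
    ; isRingHomomorphism = record
      { isSemiringHomomorphism = record
        { isNearSemiringHomomorphism = record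
          { +-isMonoidHomomorphism = record
            { isMagmaHomomorphism = record
              { isRelHomomorphism = record { cong = λ e → e }
              ; homo = λ _ _ → refl
              }
            ; ε-homo = refl
            }
          ; *-homo = λ _ _ → refl
          }
        ; 1#-homo = refl
        }
      ; -‿homo = λ _ → refl
      }
    }
    where open Field Ω

module OkutsuFiltration
  {ℓ} (em : ExcludedMiddle ℓ) {K : Field ℓ} {Γ : OrderedAbelianGroup ℓ} {v : Valuation K Γ}
  (henselian : Henselian v) (C : ValuedClosure v) where

  open ValuedClosure C hiding (Carrier; _≈_; _-_)
  open HenselianClosure em henselian C
  open Field K̄ hiding (zero)
  open FieldProperties K̄
  open ValuationOrder valuation
  open IntermediateField
  open Over (identity K) ι (λ _ → refl) using (F[_]; K⟮α⟯⊑K[α]; minimalPolynomial⇒Deg;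
    conjugation; α∈K⟮α⟯; ^-closed)
  private
    module ι where
      open _⟶_ ι public
      open PolynomialProperties K public
      open Evaluation ι public
      open LinearCombinations ι public
    module Ω where
      open PolynomialProperties K̄ public
      open Evaluation (identity K̄) public
      open Factorisation K̄ public

  -- `Deg` refers to an arbitrary basis of K(α); the powers of α form another one.
  minimalPolynomial-degree : ∀ {α m n p} → Deg α m → ι.MinimalOfDegree n p α → n ≡ m
  minimalPolynomial-degree {α} {p = p} deg min = LinearCombinations.degree-unique (base K⟮ α ⟯)
    (minimalPolynomial⇒Deg {p = p} min) deg

  Deg-unique : ∀ {α β m n} → α ≈ β → Deg α m → Deg β n → m ≡ n
  Deg-unique {α} {β} α≈β degα degβ =
    let k , p , monic , pα≈0 , minimal = ι.minimalPolynomial em α (algebraic α)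
    in ≡.trans (≡.sym (minimalPolynomial-degree {p = p} degα (monic , pα≈0 , minimal)))
         (minimalPolynomial-degree {p = p} degβ (monic , trans (ι.eval-cong p (sym α≈β)) pα≈0
           , λ q q<k qβ≈0 → minimal q q<k (trans (ι.eval-cong q α≈β) qβ≈0)))

  Deg≢0 : ∀ {α} → ¬ Deg α 0
  Deg≢0 {α} (b , basis) = 1≉0 (proj₂ (Extension.IsBasis.spans basis (Field.1# (toField K⟮ α ⟯))))

  -- Each (α′ - ρ) / (α - ρ) is a 1-unit, and 1-units are closed under products; the statement
  -- avoids the division.
  linearProduct-near : ∀ {α α′ ρs} → All (λ ρ → α - ρ ≺ α - α′) ρs →
    Ω.linearProduct ρs α ≺ Ω.linearProduct ρs α′ - Ω.linearProduct ρs α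
  linearProduct-near [] = ≺-resp (≈⇒≍ refl) (≈⇒≍ (sym (-‿inverseʳ 1#))) (≉0⇒≺0 1≉0)
  linearProduct-near {α} {α′} {ρ ∷ ρs} (near ∷ nears) =
    ≺-resp (≈⇒≍ refl)
      (≈⇒≍ (solve 5 (λ a a′ r p p′ → (a′ :- r) :* (p′ :- p) :+ p :* (a′ :- a)
        := (a′ :- r) :* p′ :- (a :- r) :* p) refl α α′ ρ P P′))
      (+-≺ (≺-resp (≈⇒≍ refl) (*-cong-≍ (≍-sym α′-ρ≍α-ρ) (≈⇒≍ refl)) (*-≺ (≺⇒≉0 near) P≺))
           (≺-resp (≈⇒≍ (*-comm _ _)) (*-cong-≍ (≈⇒≍ refl) (-swap-≍ α α′)) (*-≺ (≺⇒≉0 P≺) near)))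
    where
    P = Ω.linearProduct ρs α
    P′ = Ω.linearProduct ρs α′
    P≺ = linearProduct-near nears
    α′-ρ≍α-ρ : α′ - ρ ≍ α - ρ
    α′-ρ≍α-ρ = ≍-trans (≈⇒≍ (solve 3 (λ a a′ r → a′ :- r := (a :- r) :+ (a′ :- a)) refl α α′ ρ))
      (+-dominant (≺-resp (≈⇒≍ refl) (-swap-≍ α α′) near))

  -- If no element of smaller degree were that close to α, then x ↦ x′ induced by
  -- α ↦ α′ would satisfy v(x′ - x) > v(x) throughout K(α).
  tame-conjugate : ∀ {α m} → Deg α m → Tame α → ∀ {α′} → Extension.Conjugate ι α α′ →
    (∀ ρ d → Deg ρ d → d ℕ.< m → α - ρ ≺ α - α′) → α′ ≈ α
  tame-conjugate {α} {m} deg tame {α′} (q , (n , min) , qα′≈0) isolated =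
    trans (sym (ι.eval-X α′)) (W.trivial (α , α∈K⟮α⟯ α))
    where
    n≡m : n ≡ m
    n≡m = minimalPolynomial-degree {p = q} deg min

    -- Only members of K[α] carry a polynomial that can be evaluated at α′, hence the detour through
    -- `F[ α ]`.
    τ : toField K⟮ α ⟯ ⟶ K̄
    τ = conjugation {q = q} min qα′≈0 ∘ᵣ ⊑⇒⟶ K⟮ α ⟯ F[ α ] (K⟮α⟯⊑K[α] α)

    -- A root of r has degree at most that of r, which is less than m.
    root-isolated : ∀ {k r} → ι.DegreeBelow n r → ι.HasLeadingTerm k r → ∀ ρ → ι.eval r ρ ≈ 0# →
      α - ρ ≺ α - α′
    root-isolated {k} {r} r<n lead ρ rρ≈0 =
      let d , p , minρ = ι.minimalPolynomial em ρ (algebraic ρ)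
          d≤k : d ℕ.≤ k
          d≤k = ℕ.≮⇒≥ λ k<d → proj₂ lead (proj₂ (proj₂ minρ) r
                  (λ i d≤i → proj₁ lead i (ℕ.≤-trans k<d d≤i)) rρ≈0 k)
      in isolated ρ d (minimalPolynomial⇒Deg {p = p} minρ)
           (≡.subst (d ℕ.<_) n≡m (ℕ.≤-<-trans d≤k (ι.leadingTerm-< {p = r} r<n lead)))

    near : ∀ r → ι.DegreeBelow n r → ¬ (ι.eval r α ≈ 0#) → ι.eval r α ≺ ι.eval r α′ - ι.eval r α
    near r r<n rα≉0 = by-degree (ι.zero-or-leadingTerm r)
      where
      by-degree : (r ι.≈ₚ []) ⊎ (∃ λ k → ι.HasLeadingTerm k r) → ι.eval r α ≺ ι.eval r α′ - ι.eval r α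
      by-degree (inj₁ r≈0)              = contradiction (ι.eval-zero r r≈0 α) rα≉0
      by-degree (inj₂ (k , below , lead)) = ≺-resp (≈⇒≍ (sym (eval-r α)))
        (≈⇒≍ (trans (solve 3 (λ l x y → l :* (x :- y) := l :* x :- l :* y) refl S.lead _ _)
          (+-cong (sym (eval-r α′)) (-‿cong (sym (eval-r α))))))
        (*-≺ S.lead≉0 (linearProduct-near (All.map (λ {ρ} e → root-isolated {r = r} r<n (below , lead) ρ
          (trans (sym (eval-map ι (identity K̄) ι (λ _ → refl) r ρ)) e)) S.areRoots)))
        where
        module S = Ω.Splitting (Ω.splitting algebraicallyClosed k (map ι.⟦_⟧ r)
          (ι.map-leadingTerm {p = r} (below , lead)))
        eval-r : ∀ x → ι.eval r x ≈ S.lead * Ω.linearProduct S.roots x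
        eval-r x = trans (sym (eval-map ι (identity K̄) ι (λ _ → refl) r x)) (S.eval-≈ x)

    -- Reduction modulo q presents x and its image as the values at α and α′ of one polynomial of
    -- degree below n.
    wild : ∀ x → ¬ (proj₁ x ≈ 0#) → proj₁ x ≺ _⟶_.⟦ τ ⟧ x - proj₁ x
    wild (x , x∈) x≉0 =
      let g , gα≈x = K⟮α⟯⊑K[α] α x∈
          module R = ι.Remainder (ι.remainderBy {q = q} (proj₁ min) g)
          rα≈x = trans (sym (R.eval-≈ α (proj₁ (proj₂ min)))) gα≈x
      in ≺-resp (≈⇒≍ rα≈x) (≈⇒≍ (+-cong (sym (R.eval-≈ α′ qα′≈0)) (-‿cong rα≈x)))
           (near R.remainder R.degreeBelow (λ e → x≉0 (trans (sym rα≈x) e)))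

    module W = TameSubfield.Wild em henselian C K⟮ α ⟯ tame τ
      (λ a → ι.eval-constant a α′) wild

  module _ (θ : Carrier) {r : ℕ} {n : ℕ} (degθ : Deg θ n) (α : Fin (suc r) → Carrier)
           (okutsu : IsOkutsuSequence θ n r α) where
    open IsOkutsuSequence okutsu

    -- `closer` covers the indices below the last. At the last one δ is ∞, while the preceding δ is
    -- finite because the two degrees differ.
    δ-increasing : ∀ (j : Fin r) → θ - α (inject₁ j) ≺ θ - α (suc j)
    δ-increasing j = go (view (suc j)) ≡.refl
      where
      go : ∀ {i} → View i → i ≡ suc j → θ - α (inject₁ j) ≺ θ - α (suc j)
      go ‵fromℕ e = ≺-resp (≈⇒≍ refl) (≈⇒≍ (sym (x≈y⇒x-y≈0 (sym last′))))
        (≉0⇒≺0 λ θ-αⱼ≈0 → ℕ.<-irrefl (Deg-unique (trans (sym (x-y≈0⇒x≈y θ-αⱼ≈0)) (sym last′))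
          (degrees (inject₁ j)) (degrees (suc j))) (increasing j))
        where
        last′ : α (suc j) ≈ θ
        last′ = ≡.subst (λ i → α i ≈ θ) e last
      go (‵inject₁ k) e = ≡.subst (λ i → θ - α (inject₁ j) ≺ θ - α i) e
        (closer k (α (inject₁ j)) (m (inject₁ j)) (degrees (inject₁ j))
          (≡.subst (λ i → m (inject₁ j) ℕ.< m i) (≡.sym e) (increasing j)))

    module _ (M : IntermediateField ι) (g : Gal M) where
      private
        module g = Extension.Aut g
        module gʳ = RingMorphisms.IsRingIsomorphism g.isRingIsomorphism
        ψ : toField M ⟶ K̄
        ψ = inclusion M ∘ᵣ record { ⟦_⟧ = g.σ ; isRingHomomorphism = gʳ.isRingHomomorphism }
        module ψ = _⟶_ ψ
        module M = Field (toField M)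

      automorphism-≍ : ∀ x → proj₁ x ≍ proj₁ (g.σ x)
      automorphism-≍ = embeddings-≍ (toField M) (base M) (inclusion M) ψ (λ _ → refl) g.fixes

      automorphism-conjugate : ∀ x → Extension.Conjugate ι (proj₁ x) (proj₁ (g.σ x))
      automorphism-conjugate x =
        let k , p , min = ι.minimalPolynomial em (proj₁ x) (algebraic (proj₁ x))
        in p , (k , min) , trans (sym (⟦eval⟧ (base M) ψ ι g.fixes p x))
          (trans (ψ.⟦⟧-cong (trans (⟦eval⟧ (base M) (inclusion M) ι (λ _ → refl) p x) (proj₁ (proj₂ min))))
            ψ.0#-homo)

      -- a - σa = (t - σt) + ((σt - σa) - (t - a)), and since σ preserves values both parts of the
      -- last bracket have value v(t - a), above v(t - σt).
      displacement-transfer : ∀ t a → proj₁ t - proj₁ (g.σ t) ≺ proj₁ t - proj₁ a →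
        proj₁ a - proj₁ (g.σ a) ≍ proj₁ t - proj₁ (g.σ t)
      displacement-transfer t a D≺ = ≍-trans
        (≈⇒≍ (solve 4 (λ t a t′ a′ → a :- a′ := (t :- t′) :+ ((t′ :- a′) :- (t :- a))) refl _ _ _ _))
        (+-dominant (minus-≺ (≺-resp (≈⇒≍ refl) (≍-trans (automorphism-≍ (t M.- a))
          (≈⇒≍ (trans (ψ.+-homo t (M.- a)) (+-congˡ (ψ.-‿homo a))))) D≺) D≺))

    module _ (i : Fin (suc r)) (M : IntermediateField ι) (K⟮θ&αᵢ⟯⊑M : K⟮ θ & α i ⟯ ⊑ M) where
      open Filtration θ α i M K⟮θ&αᵢ⟯⊑M
      private
        θᴹ αᴹ : Σ Carrier (Member M)
        θᴹ = θ , K⟮θ&αᵢ⟯⊑M (generator (inj₁ refl))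
        αᴹ = α i , K⟮θ&αᵢ⟯⊑M (generator (inj₂ refl))

      H⊆H̄ : Tame (α i) → H ⊆ H̄
      H⊆H̄ tame {g} g∈H = [ (λ δ≼D → δ≼D) , (λ D≺δ → contradiction (α′≈α D≺δ) (α′≉α D≺δ)) ]′
        (≼-or-≻ (θ - α i) (θ - σθ))
        where
        σθ = proj₁ (Extension.Aut.σ g θᴹ)
        α′ = proj₁ (Extension.Aut.σ g αᴹ)
        module _ (D≺δ : θ - σθ ≺ θ - α i) where
          -- σ displaces αᵢ exactly as far as θ; this displacement is finite, so α′ differs from αᵢ.
          α-α′≍D : α i - α′ ≍ θ - σθ
          α-α′≍D = displacement-transfer M g θᴹ αᴹ D≺δ
          α′≉α : ¬ (α′ ≈ α i)
          α′≉α e = ≉0-resp (≍-sym α-α′≍D) (≺⇒≉0 D≺δ) (x≈y⇒x-y≈0 (sym e))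
          -- Stated for k with k ≡ i, so that splitting on k also makes `H g` reveal its lower
          -- bound.
          isolated : ∀ (k : Fin (suc r)) → k ≡ i → ∀ ρ d → Deg ρ d → d ℕ.< m k → α i - ρ ≺ α i - α′
          -- As m₀ = 1, only degree 0 remains, and no element has degree 0.
          isolated zero    k≡i ρ d deg d<1 =
            contradiction (≡.subst (Deg ρ) (ℕ.n<1⇒n≡0 (≡.subst (d ℕ.<_) first d<1)) deg) (Deg≢0 {ρ})
          isolated (suc j) ≡.refl ρ d deg d<m = δⱼ≺D g∈H
            where
            δⱼ≺D : H g → α i - ρ ≺ α i - α′
            δⱼ≺D AddInfimum.[ δⱼ≺D ] = ≺-resp (≍-sym α-ρ≍θ-ρ) (≍-sym α-α′≍D) θ-ρ≺D
              where
              θ-ρ≺D : θ - ρ ≺ θ - σθ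
              θ-ρ≺D = ≼-≺-trans (closest j ρ d deg d<m) δⱼ≺D
              α-ρ≍θ-ρ : α i - ρ ≍ θ - ρ
              α-ρ≍θ-ρ = ≍-trans (≈⇒≍ (solve 3 (λ t a r → a :- r := (t :- r) :+ (a :- t)) refl θ (α i) ρ))
                (+-dominant (≺-resp (≈⇒≍ refl) (-swap-≍ θ (α i)) (≺-≼-trans θ-ρ≺D (≺⇒≼ D≺δ))))
          α′≈α : α′ ≈ α i
          α′≈α = tame-conjugate (degrees i) tame (automorphism-conjugate M g αᴹ) (isolated i ≡.refl)

    H̄⊆H : ∀ i M (K⟮θ&αᵢ⟯⊑M : K⟮ θ & α i ⟯ ⊑ M) → let open Filtration θ α i M K⟮θ&αᵢ⟯⊑M in H̄ ⊆ H
    H̄⊆H zero    M inM g∈H̄ = AddInfimum.⊥₋<[ _ ]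
    H̄⊆H (suc j) M inM g∈H̄ = AddInfimum.[ ≺-≼-trans (δ-increasing j) g∈H̄ ]

  -- Krasner's lemma.
  conjugate-beyond : ∀ {θ β n d} → Separable θ → Deg θ n → Deg β d → d ℕ.< n →
    ∃ λ θ′ → ¬ (θ′ ≈ θ) × Extension.Conjugate ι θ θ′ × θ - β ≼ θ - θ′
  conjugate-beyond {θ} {β} {n} {d} separable degθ degβ d<n =
    θ′ , θ′≉θ , (p , (k , p-monic , pθ≈0 , p-minimal) , pθ′≈0) ,
    -- θ - θ′ = (θ - β) - (θ′ - β), and the two differences have the same value.
    ≼-resp (≈⇒≍ refl) (≈⇒≍ (solve 3 (λ t t′ b → (t :- b) :- (t′ :- b) := t :- t′) refl θ θ′ β))
      (minus-≼ ≼-refl (≍⇒≼ θ-β≍θ′-β))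
    where
    L = K⟮ β ⟯
    θᶿ : Σ Carrier (Member K⟮ θ ⟯)
    θᶿ = θ , α∈K⟮α⟯ θ
    separable-polynomial = separable θᶿ
    p = proj₁ separable-polynomial
    p-min = proj₁ (proj₂ separable-polynomial)
    p-separable = proj₂ (proj₂ separable-polynomial)
    k = proj₁ p-min
    p-monic = proj₁ (proj₂ p-min)
    eval-θ : ∀ q → proj₁ (Extension.eval (base K⟮ θ ⟯) q θᶿ) ≈ ι.eval q θ
    eval-θ q = ⟦eval⟧ (base K⟮ θ ⟯) (inclusion K⟮ θ ⟯) ι (λ _ → refl) q θᶿ
    pθ≈0 : ι.eval p θ ≈ 0#
    pθ≈0 = trans (sym (eval-θ p)) (proj₁ (proj₂ (proj₂ p-min)))
    p-minimal : ∀ q → ι.DegreeBelow k q → ι.eval q θ ≈ 0# → q ι.≈ₚ []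
    p-minimal q q<k qθ≈0 = proj₂ (proj₂ (proj₂ p-min)) q q<k (trans (eval-θ q) qθ≈0)

    module O = Over (base L) (inclusion L) (λ _ → refl)
    module ℰ = Evaluation (inclusion L)
    module LL = Field (toField L)
    f : List LL.Carrier
    f = map (_⟶_.⟦_⟧ (base L)) p
    eval-f : ∀ x → ℰ.eval f x ≈ ι.eval p x
    eval-f x = eval-map (base L) (inclusion L) ι (λ _ → refl) p x

    -- The n independent powers of θ do not fit into K(β), of degree d < n.
    θ∉L : ∀ a → ¬ (proj₁ a ≈ θ)
    θ∉L (a , a∈L) a≈θ = ℕ.<⇒≱ d<n (LinearCombinations.independent⇒≤ (base L) (proj₁ degβ) powers
      (λ c relation → ι.powers-independent {p = p} min c
        (trans (sym (⟦combination⟧ (base L) (inclusion L) ι (λ _ → refl) c powers)) relation))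
      (λ i → Extension.IsBasis.spans (proj₂ degβ) (powers i)))
      where
      θ∈L : Member L θ
      θ∈L = resp L a≈θ a∈L
      powers : Fin n → LL.Carrier
      powers i = θ ι.^ toℕ i , ^-closed L θ∈L (toℕ i)
      min : ι.MinimalOfDegree n p θ
      min = ≡.subst (λ n → ι.MinimalOfDegree n p θ)
        (minimalPolynomial-degree {p = p} degθ (p-monic , pθ≈0 , p-minimal)) (p-monic , pθ≈0 , p-minimal)

    -- The conjugate is taken over K(β), so that X - β may be compared at θ and θ′.
    moved : ∃ λ θ′ → ¬ (θ′ ≈ θ) × ∀ g → ℰ.eval g θ ≍ ℰ.eval g θ′
    moved = O.moved-conjugate f (trans (eval-f θ) pθ≈0)
      (λ e → ι.separable⇒eval′≉0 p p-separable θ pθ≈0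
        (trans (sym (eval′-map (base L) (inclusion L) ι (λ _ → refl) p θ)) e))
      θ∉L
    θ′ = proj₁ moved
    θ′≉θ = proj₁ (proj₂ moved)
    pθ′≈0 : ι.eval p θ′ ≈ 0#
    pθ′≈0 = 0≼⇒≈0 (≼-resp (≈⇒≍ (trans (eval-f θ) pθ≈0)) (≈⇒≍ (eval-f θ′)) (≍⇒≼ (proj₂ (proj₂ moved) f)))
    θ-β≍θ′-β : θ - β ≍ θ′ - β
    θ-β≍θ′-β = ≍-trans (≈⇒≍ (sym (eval-X-β θ))) (≍-trans (proj₂ (proj₂ moved) X-β) (≈⇒≍ (eval-X-β θ′)))
      where
      X-β : List LL.Carrier
      X-β = LL.- (β , α∈K⟮α⟯ β) ∷ LL.1# ∷ []
      eval-X-β : ∀ x → ℰ.eval X-β x ≈ x - β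
      eval-X-β x = solve 2 (λ x y → :- y :+ x :* (con (ℤ.+ 1) :+ x :* con (ℤ.+ 0)) := x :- y) refl x β

  mainInvariant≡krasner : ∀ {θ n r} → Separable θ → Deg θ n → 1 ℕ.< n → (α : Fin (suc r) → Carrier) →
    IsOkutsuSequence θ n r α → Tame θ → ∃ λ γ → IsMainInvariant θ γ × IsKrasnerConstant θ γ
  -- A sequence consisting of θ alone would give n = m₀ = 1.
  mainInvariant≡krasner {r = zero} _ _ 1<n α okutsu _ =
    contradiction (≡.subst (1 ℕ.<_) (≡.trans (≡.sym lastDegree) first) 1<n) (ℕ.<-irrefl ≡.refl)
    where open IsOkutsuSequence okutsu
  mainInvariant≡krasner {θ} {n} {suc r} separable degθ 1<n α okutsu tame =
    v̄ (θ - β) ,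
    ( (λ { γ (ρ , (d , n′ , degρ , degθ′ , d<n′) , γ≈) → ≤⁺-respˡ (Eq.sym γ≈)
         (β-closest ρ d degρ (≡.subst (d ℕ.<_) (Deg-unique refl degθ′ degθ) d<n′)) })
    , λ u bound → bound _ (β , (m (inject₁ j) , n , degrees (inject₁ j) , degθ , d<n) , Eq.refl) ) ,
    -- Krasner's lemma bounds v(θ - θ′) below by v(θ - β); the bound from tameness holds above for
    -- every conjugate, so θ′ attains the maximum.
    ( (θ′ , proj₁ (proj₂ far) , proj₁ (proj₂ (proj₂ far)) ,
        ≼-antisym (proj₂ (proj₂ (proj₂ far))) (conjugate-bound θ′ (proj₁ (proj₂ far)) (proj₁ (proj₂ (proj₂ far)))))
    , λ { γ (θ″ , θ″≉θ , conj , γ≈) → ≤⁺-respˡ (Eq.sym γ≈) (conjugate-bound θ″ θ″≉θ conj) } )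
    where
    open IsOkutsuSequence okutsu
    open Values Γ̄ using (≤⁺-respˡ; module Eq)
    -- The last index is now r + 1, so `inject₁ j` is the penultimate one, where the supremum is
    -- attained.
    j = fromℕ r
    β = α (inject₁ j)
    d<n : m (inject₁ j) ℕ.< n
    d<n = ≡.subst (m (inject₁ j) ℕ.<_) lastDegree (increasing j)
    β-closest : ∀ ρ d → Deg ρ d → d ℕ.< n → θ - ρ ≼ θ - β
    β-closest ρ d degρ d<n = closest j ρ d degρ (≡.subst (d ℕ.<_) (≡.sym lastDegree) d<n)
    far = conjugate-beyond separable degθ (degrees (inject₁ j)) d<n
    θ′ = proj₁ far
    conjugate-bound : ∀ θ″ → ¬ (θ″ ≈ θ) → Extension.Conjugate ι θ θ″ → θ - θ″ ≼ θ - β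
    conjugate-bound θ″ θ″≉θ conj = [ (λ p → p) , (λ β≺ → contradiction
        (tame-conjugate degθ tame conj λ ρ d degρ d<n → ≼-≺-trans (β-closest ρ d degρ d<n) β≺) θ″≉θ) ]′
      (≼-or-≻ (θ - θ″) (θ - β))

corollary4p3 : (∀ a → ExcludedMiddle a) →
    ∀ {ℓ} {K : Field ℓ} {Γ : OrderedAbelianGroup ℓ} (v : Valuation K Γ) →
    Henselian v → (C : ValuedClosure v) →
    let open ValuedClosure C in
    (θ : Carrier) → Separable θ → Defectless θ →
    (n : ℕ) → Deg θ n → 1 < n →
    (r : ℕ) (α : Fin (suc r) → Carrier) → IsOkutsuSequence θ n r α →
    ((i : Fin r) → Separable (α (inject₁ i))) →
    ((i : Fin (suc r)) (M : IntermediateField ι) → IsFiniteGalois M →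
    (K⟮θ&αᵢ⟯⊑M : K⟮ θ & α i ⟯ ⊑ M) →
    let open Filtration θ α i M K⟮θ&αᵢ⟯⊑M in
    (H̄ ⊆ H) × (Tame (α i) → H ≐ H̄))
    × (Tame θ → ∃ λ γ → IsMainInvariant θ γ × IsKrasnerConstant θ γ)
corollary4p3 em {ℓ} v henselian C θ separable _ n degθ 1<n r α okutsu _ =
  (λ i M _ inM → (λ {g} → H̄⊆H θ degθ α okutsu i M inM {g}) ,
    λ tame → (λ {g} → H⊆H̄ θ degθ α okutsu i M inM tame {g}) , (λ {g} → H̄⊆H θ degθ α okutsu i M inM {g})) ,
  mainInvariant≡krasner separable degθ 1<n α okutsu
  where open OkutsuFiltration (em ℓ) henselian C
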